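{- Let $p=3$ and $F\in\mathscr F$. Let $K(F,6)$ denote the maximum $k$ such that the lexicographic code $\mathrm{Lex}_{F,6}(k)$ is a linear code ($\infty$ if it is linear for all $k$). Then $$K(F,6)=\begin{cases}6 & \text{if } F=F(\xi,9),\ 0\le \xi\le 8,\\ 3 & \text{if } F=F(\xi,\eta),\ 0\le\xi\le 8,\ \eta\ge 10\ (\eta\in\mathbb N),\\ 2 & \text{otherwise.}\end{cases}$$ In particular, if $F=F(\xi,9)$ and $0\le\xi\le 8$, then $\mathrm{Res}(\mathrm{Lex}_{F,6}(6))$ is the ternary Golay code.
   Context: $\mathbb N$ is the set of non-negative integers. $\mathbb F_p$ is identified with $\{0,1,\dots,p-1\}$, elements compared as integers (here $p=3$). $\mathbb F_p^{\mathbb N}$ is the space of finitely supported sequences $(x_i)_{i\in\mathbb N}$ over $\mathbb F_p$, with standard basis $E=(e_0,e_1,\dots)$. For distinct $\xi,\eta\in\mathbb N$, $F(\xi,\eta)=(f_i)_{i\in\mathbb N}$ is the ordered basis with $f_i=e_i$ for $i\ne\xi$ and $f_\xi=e_\xi+e_\eta$. Let $\mathscr F=\{E\}\cup\{F(\xi,\eta):\xi,\eta\in\mathbb N,\ \xi\neq\eta\}$. For an ordered basis $F=(f_i)$ write $x=\sum_i x_{[i]}f_i$; for $x\neq y$ let $N$ be the largest index with $x_{[N]}\ne y_{[N]}$ and set $x<_F y$ iff $x_{[N]}<y_{[N]}$. The Hamming distance is $d(x,y)=|\{i: x_i\neq y_i\}|$ in standard coordinates. For $d\ge2$, $w_{F,d}(a)$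 ($a\in\mathbb N$) is defined recursively as the $<_F$-minimum $z\in\mathbb F_p^{\mathbb N}$ with $d(z,w_{F,d}(b))\ge d$ for all $0\le b<a$, and $\mathrm{Lex}_{F,d}(k)=\{w_{F,d}(0),\dots,w_{F,d}(p^k-1)\}$. For a subset $L\subseteq\mathbb F_p^{\mathbb N}$, $\mathrm{Res}(L)$ is obtained from $L$ by deleting all standard coordinates $i$ at which every element of $L$ is zero. A code is linear if it is an $\mathbb F_p$-subspace. The ternary Golay code here is the (extended) $[12,6,6]$ code over $\mathbb F_3$, which is unique up to monomial equivalence. -}

module Defs where

open import Algebra.Bundles using (CommutativeRing)
open import Algebra.Module.Bundles.Raw using (RawLeftModule)
import Algebra.Definitions.RawMonoid as RawMonoidDefs
open import Data.Bool.Base using (Bool; true; false; if_then_else_)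
open import Data.Empty using (⊥; ⊥-elim)
open import Data.Fin.Base as Fin using (Fin; zero; suc; toℕ)
open import Data.Fin.Properties as Finₚ using (all?; toℕ-fromℕ<)
open import Data.List.Base using (List; []; _∷_; _++_; length; filter; upTo; allFin; [_])
open import Data.List.Properties using (filter-++; length-++; upTo-∷ʳ; filter-accept; filter-reject)
open import Data.List.Relation.Unary.All as All using (All; []; _∷_)
open import Data.Nat.Base as ℕ using (ℕ; zero; suc; _≤_; _<_; _⊔_; z≤n; s≤s)
open import Data.Nat.DivMod using (_mod_; _/_; _%_)
import Data.Nat.DivMod as DM
import Data.Nat.Properties as ℕₚ
open import Data.Nat.Induction using (<-rec)
open import Data.Product.Base using (Σ; ∃; ∃-syntax; _×_; _,_; proj₁; proj₂)
open import Data.Sum.Base as Sum using (_⊎_; inj₁; inj₂)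
open import Data.Vec.Functional using (Vector)
open import Function.Base using (_∘_; id)
open import Level using (0ℓ)
open import Relation.Binary.Definitions using (tri<; tri≈; tri>)
open import Relation.Binary.PropositionalEquality hiding ([_])
open import Relation.Nullary using (¬_; Dec; yes; no; does; ¬?)
open import Relation.Nullary.Decidable using (from-yes; dec-true; dec-false)
open import Relation.Nullary.Construct.Add.Supremum using (_⁺; ⊤⁺)
  renaming ([_] to fin)
open import Relation.Unary using (Pred; Decidable; _∈_)

-- Fin._<_ compares through toℕ, i.e. the order of {0,1,2} as integers.
𝔽 : Set
𝔽 = Fin 3

infixl 6 _+_
infixl 7 _*_
infix  8 -_

_+_ _*_ : 𝔽 → 𝔽 → 𝔽
x + y = (toℕ x ℕ.+ toℕ y) mod 3
x * y = (toℕ x ℕ.* toℕ y) mod 3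

-_ : 𝔽 → 𝔽
- x = (3 ℕ.∸ toℕ x) mod 3

0# 1# : 𝔽
0# = zero
1# = suc zero

𝔽-commutativeRing : CommutativeRing 0ℓ 0ℓ
𝔽-commutativeRing = record
  { Carrier = 𝔽 ; _≈_ = _≡_ ; _+_ = _+_ ; _*_ = _*_ ; -_ = -_ ; 0# = 0# ; 1# = 1#
  ; isCommutativeRing = record
    { isRing = record
      { +-isAbelianGroup = record
        { isGroup = record
          { isMonoid = record
            { isSemigroup = record
              { isMagma = record { isEquivalence = isEquivalence ; ∙-cong = cong₂ _+_ }
              ; assoc = from-yes (all? λ x → all? λ y → all? λ z → (x + y) + z Finₚ.≟ x + (y + z))
              }
            ; identity = from-yes (all? λ x → 0# + x Finₚ.≟ x)
                       , from-yes (all? λ x → x + 0# Finₚ.≟ x)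
            }
          ; inverse = from-yes (all? λ x → - x + x Finₚ.≟ 0#)
                    , from-yes (all? λ x → x + - x Finₚ.≟ 0#)
          ; ⁻¹-cong = cong -_
          }
        ; comm = from-yes (all? λ x → all? λ y → x + y Finₚ.≟ y + x)
        }
      ; *-cong = cong₂ _*_
      ; *-assoc = from-yes (all? λ x → all? λ y → all? λ z → (x * y) * z Finₚ.≟ x * (y * z))
      ; *-identity = from-yes (all? λ x → 1# * x Finₚ.≟ x)
                   , from-yes (all? λ x → x * 1# Finₚ.≟ x)
      ; distrib = from-yes (all? λ x → all? λ y → all? λ z → x * (y + z) Finₚ.≟ x * y + x * z)
                , from-yes (all? λ x → all? λ y → all? λ z → (y + z) * x Finₚ.≟ y * x + z * x)
      }
    ; *-comm = from-yes (all? λ x → all? λ y → x * y Finₚ.≟ y * x)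
    }
  }

private module R = CommutativeRing 𝔽-commutativeRing

module _ (M : RawLeftModule 𝔽 0ℓ 0ℓ) where
  open RawLeftModule M
  open RawMonoidDefs +ᴹ-rawMonoid using (sum)

  linearCombination : ∀ {n} → Vector 𝔽 n → Vector Carrierᴹ n → Carrierᴹ
  linearCombination c v = sum λ i → c i *ₗ v i

  record IsSubspace (P : Pred Carrierᴹ 0ℓ) : Set where
    field
      0-closed : 0ᴹ ∈ P
      +-closed : ∀ {x y} → x ∈ P → y ∈ P → x +ᴹ y ∈ P
      *-closed : ∀ a {x} → x ∈ P → a *ₗ x ∈ P

  HasDimension : Pred Carrierᴹ 0ℓ → ℕ → Set
  HasDimension P k = Σ (Vector Carrierᴹ k) λ b →
      (∀ i → b i ∈ P)
    × (∀ c → linearCombination c b ≈ᴹ 0ᴹ → ∀ i → c i ≡ 0#)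
    × (∀ {x} → x ∈ P → ∃[ c ] linearCombination c b ≈ᴹ x)

-- `bound` is any bound for the support; it is not part of the identity
-- of a sequence, which is why sequences are compared with _≈_.
record 𝔽^ℕ : Set where
  field
    coord     : ℕ → 𝔽
    bound     : ℕ
    vanishing : ∀ {i} → bound ≤ i → coord i ≡ 0#

open 𝔽^ℕ public

infix 4 _≈_

_≈_ : 𝔽^ℕ → 𝔽^ℕ → Set
x ≈ y = ∀ i → coord x i ≡ coord y i

𝔽^ℕ-module : RawLeftModule 𝔽 0ℓ 0ℓ
𝔽^ℕ-module = record
  { Carrierᴹ = 𝔽^ℕ
  ; _≈ᴹ_ = _≈_
  ; _+ᴹ_ = λ x y → record
    { coord = λ i → coord x i + coord y i
    ; bound = bound x ⊔ bound y
    ; vanishing = λ le → cong₂ _+_ (vanishing x (ℕₚ.m⊔n≤o⇒m≤o (bound x) (bound y) le))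
                                   (vanishing y (ℕₚ.m⊔n≤o⇒n≤o (bound x) (bound y) le))
    }
  ; _*ₗ_ = λ a x → record
    { coord = λ i → a * coord x i
    ; bound = bound x
    ; vanishing = λ le → trans (cong (a *_) (vanishing x le)) (R.zeroʳ a)
    }
  ; 0ᴹ = record { coord = λ _ → 0# ; bound = 0 ; vanishing = λ _ → refl }
  ; -ᴹ_ = λ x → record
    { coord = λ i → - coord x i
    ; bound = bound x
    ; vanishing = λ le → cong -_ (vanishing x le)
    }
  }

open RawLeftModule 𝔽^ℕ-module using (_+ᴹ_; _*ₗ_)

δ : ℕ → ℕ → 𝔽
δ i j = if does (i ℕₚ.≟ j) then 1# else 0#

e : ℕ → 𝔽^ℕ
e i = record
  { coord = δ i
  ; bound = suc i
  ; vanishing = λ {j} i<j → cong (if_then 1# else 0#) (dec-false (i ℕₚ.≟ j) (ℕₚ.<⇒≢ i<j))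
  }

-- Σᵢ cᵢ fᵢ
expand : (ℕ → 𝔽^ℕ) → 𝔽^ℕ → 𝔽^ℕ
expand f c = linearCombination 𝔽^ℕ-module {bound c} (coord c ∘ toℕ) (f ∘ toℕ)

sumBelow : ℕ → (ℕ → 𝔽) → 𝔽
sumBelow zero    g = 0#
sumBelow (suc n) g = g 0 + sumBelow n (g ∘ suc)

sumBelow-cong : ∀ n {g h} → (∀ i → g i ≡ h i) → sumBelow n g ≡ sumBelow n h
sumBelow-cong zero    eq = refl
sumBelow-cong (suc n) eq = cong₂ _+_ (eq 0) (sumBelow-cong n (eq ∘ suc))

sumBelow-zero : ∀ n {g} → (∀ i → g i ≡ 0#) → sumBelow n g ≡ 0#
sumBelow-zero zero    eq = refl
sumBelow-zero (suc n) eq = cong₂ _+_ (eq 0) (sumBelow-zero n (eq ∘ suc))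

sumBelow-extend : ∀ b n {g : ℕ → 𝔽} → (∀ {i} → b ≤ i → g i ≡ 0#) → b ≤ n → sumBelow b g ≡ sumBelow n g
sumBelow-extend zero    n       v _         = sym (sumBelow-zero n λ i → v z≤n)
sumBelow-extend (suc b) (suc n) {g} v (s≤s b≤n) = cong (g 0 +_) (sumBelow-extend b n (v ∘ s≤s) b≤n)

interchange : ∀ a b c d → (a + b) + (c + d) ≡ (a + c) + (b + d)
interchange = from-yes (all? λ a → all? λ b → all? λ c → all? λ d →
  (a + b) + (c + d) Finₚ.≟ (a + c) + (b + d))

sumBelow-+ : ∀ n g h → sumBelow n (λ i → g i + h i) ≡ sumBelow n g + sumBelow n h
sumBelow-+ zero    g h = refl
sumBelow-+ (suc n) g h = trans (cong (g 0 + h 0 +_) (sumBelow-+ n (g ∘ suc) (h ∘ suc)))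
                        (interchange (g 0) (h 0) (sumBelow n (g ∘ suc)) (sumBelow n (h ∘ suc)))

sumBelow-* : ∀ n g a → sumBelow n (λ i → g i * a) ≡ sumBelow n g * a
sumBelow-* zero    g a = sym (R.zeroˡ a)
sumBelow-* (suc n) g a = trans (cong (g 0 * a +_) (sumBelow-* n (g ∘ suc) a))
                        (sym (R.distribʳ a (g 0) (sumBelow n (g ∘ suc))))

sumBelow-δ : ∀ n (c : ℕ → 𝔽) j → (∀ {i} → n ≤ i → c i ≡ 0#) → sumBelow n (λ i → c i * δ i j) ≡ c j
sumBelow-δ zero    c j       v = sym (v z≤n)
sumBelow-δ (suc n) c zero    v = trans
  (cong₂ _+_ (R.*-identityʳ (c 0)) (sumBelow-zero n λ i → R.zeroʳ (c (suc i))))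
  (R.+-identityʳ (c 0))
sumBelow-δ (suc n) c (suc j) v = trans
  (cong₂ _+_ (R.zeroʳ (c 0)) (sumBelow-δ n (c ∘ suc) j (v ∘ s≤s)))
  (R.+-identityˡ (c (suc j)))

coord-sum : ∀ n (c : ℕ → 𝔽) (f : ℕ → 𝔽^ℕ) j →
  coord (linearCombination 𝔽^ℕ-module {n} (c ∘ toℕ) (f ∘ toℕ)) j
    ≡ sumBelow n (λ i → c i * coord (f i) j)
coord-sum zero    c f j = refl
coord-sum (suc n) c f j = cong (c 0 * coord (f 0) j +_) (coord-sum n (c ∘ suc) (f ∘ suc) j)

coord-expand : ∀ f c j → coord (expand f c) j ≡ sumBelow (bound c) (λ i → coord c i * coord (f i) j)
coord-expand f c = coord-sum (bound c) (coord c) f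

expand-cong : ∀ f {c c′} → c ≈ c′ → expand f c ≈ expand f c′
expand-cong f {c} {c′} eq j = begin
  coord (expand f c) j                           ≡⟨ coord-expand f c j ⟩
  sumBelow (bound c) (λ i → coord c i * coord (f i) j)  ≡⟨ sumBelow-extend (bound c) N (λ le → v c (vanishing c le)) (ℕₚ.m≤m⊔n _ _) ⟩
  sumBelow N (λ i → coord c i * coord (f i) j)          ≡⟨ sumBelow-cong N (λ i → cong (_* coord (f i) j) (eq i)) ⟩
  sumBelow N (λ i → coord c′ i * coord (f i) j)         ≡⟨ sumBelow-extend (bound c′) N (λ le → v c′ (vanishing c′ le)) (ℕₚ.m≤n⊔m (bound c) _) ⟨
  sumBelow (bound c′) (λ i → coord c′ i * coord (f i) j) ≡⟨ coord-expand f c′ j ⟨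
  coord (expand f c′) j                          ∎
  where
  open ≡-Reasoning
  N = bound c ⊔ bound c′
  v : ∀ c {i} → coord c i ≡ 0# → coord c i * coord (f i) j ≡ 0#
  v c {i} p = trans (cong (_* coord (f i) j) p) (R.zeroˡ (coord (f i) j))

record OrderedBasis : Set where
  field
    vector        : ℕ → 𝔽^ℕ
    coordinates   : 𝔽^ℕ → 𝔽^ℕ
    expansion     : ∀ x → expand vector (coordinates x) ≈ x
    unique        : ∀ c x → expand vector c ≈ x → c ≈ coordinates x

open OrderedBasis public

E : OrderedBasis
E = record
  { vector      = e
  ; coordinates = id
  ; expansion   = expand-e
  ; unique      = λ c x eq i → trans (sym (expand-e c i)) (eq i)
  }
  where
  expand-e : ∀ c → expand e c ≈ c
  expand-e c j = trans (coord-expand e c j) (sumBelow-δ (bound c) (coord c) j (vanishing c))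

Fvector : ℕ → ℕ → ℕ → 𝔽^ℕ
Fvector ξ η i = if does (i ℕₚ.≟ ξ) then e ξ +ᴹ e η else e i

Fvector-coord : ∀ ξ η i j → coord (Fvector ξ η i) j ≡ δ i j + δ i ξ * δ η j
Fvector-coord ξ η i j with i ℕₚ.≟ ξ
... | yes refl rewrite dec-true (i ℕₚ.≟ i) refl = cong (δ i j +_) (sym (R.*-identityˡ (δ η j)))
... | no  i≢ξ  rewrite dec-false (i ℕₚ.≟ ξ) i≢ξ =
  sym (trans (cong (δ i j +_) (R.zeroˡ (δ η j))) (R.+-identityʳ (δ i j)))

expand-F : ∀ ξ η c j → coord (expand (Fvector ξ η) c) j ≡ coord c j + coord c ξ * δ η j
expand-F ξ η c j = begin
  coord (expand (Fvector ξ η) c) j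
    ≡⟨ coord-expand (Fvector ξ η) c j ⟩
  sumBelow n (λ i → coord c i * coord (Fvector ξ η i) j)
    ≡⟨ sumBelow-cong n (λ i → trans (cong (coord c i *_) (Fvector-coord ξ η i j))
         (trans (R.distribˡ (coord c i) (δ i j) (δ i ξ * δ η j))
           (cong (coord c i * δ i j +_) (sym (R.*-assoc (coord c i) (δ i ξ) (δ η j)))))) ⟩
  sumBelow n (λ i → coord c i * δ i j + coord c i * δ i ξ * δ η j)
    ≡⟨ sumBelow-+ n (λ i → coord c i * δ i j) (λ i → coord c i * δ i ξ * δ η j) ⟩
  sumBelow n (λ i → coord c i * δ i j) + sumBelow n (λ i → coord c i * δ i ξ * δ η j)
    ≡⟨ cong (sumBelow n (λ i → coord c i * δ i j) +_) (sumBelow-* n (λ i → coord c i * δ i ξ) (δ η j)) ⟩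
  sumBelow n (λ i → coord c i * δ i j) + sumBelow n (λ i → coord c i * δ i ξ) * δ η j
    ≡⟨ cong₂ (λ a b → a + b * δ η j) (sumBelow-δ n (coord c) j (vanishing c)) (sumBelow-δ n (coord c) ξ (vanishing c)) ⟩
  coord c j + coord c ξ * δ η j ∎
  where
  open ≡-Reasoning
  n = bound c

cancel₁ : ∀ x y d → (x + - y * d) + y * d ≡ x
cancel₁ = from-yes (all? λ x → all? λ y → all? λ d → (x + - y * d) + y * d Finₚ.≟ x)

cancel₂ : ∀ x y d → x ≡ (x + y * d) + - y * d
cancel₂ = from-yes (all? λ x → all? λ y → all? λ d → x Finₚ.≟ (x + y * d) + - y * d)

+-0 : ∀ x y → x + y * 0# ≡ x
+-0 = from-yes (all? λ x → all? λ y → x + y * 0# Finₚ.≟ x)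

-- From x = Σ x_[i] fᵢ: x_i = x_[i] for i ≠ η, and x_η = x_[η] + x_[ξ].
F : (ξ η : ℕ) → ξ ≢ η → OrderedBasis
F ξ η ξ≢η = record
  { vector      = Fvector ξ η
  ; coordinates = coords
  ; expansion   = λ x j → begin
      coord (expand (Fvector ξ η) (coords x)) j           ≡⟨ expand-F ξ η (coords x) j ⟩
      coord (coords x) j + coord (coords x) ξ * δ η j     ≡⟨ cong (λ a → coord (coords x) j + a * δ η j) (at-ξ (coord x ξ) (- coord x ξ)) ⟩
      coord (coords x) j + coord x ξ * δ η j              ≡⟨ cancel₁ (coord x j) (coord x ξ) (δ η j) ⟩
      coord x j                                           ∎
  ; unique      = λ c x eq j → begin
      coord c j
        ≡⟨ cancel₂ (coord c j) (coord c ξ) (δ η j) ⟩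
      (coord c j + coord c ξ * δ η j) + - coord c ξ * δ η j
        ≡⟨ cong₂ (λ a b → a + - b * δ η j) (trans (sym (expand-F ξ η c j)) (eq j))
             (trans (sym (at-ξ (coord c ξ) (coord c ξ))) (trans (sym (expand-F ξ η c ξ)) (eq ξ))) ⟩
      coord x j + - coord x ξ * δ η j ∎
  }
  where
  open ≡-Reasoning
  coords : 𝔽^ℕ → 𝔽^ℕ
  coords x = x +ᴹ (- coord x ξ) *ₗ e η

  at-ξ : ∀ a b → a + b * δ η ξ ≡ a
  at-ξ a b rewrite dec-false (η ℕₚ.≟ ξ) (ξ≢η ∘ sym) = +-0 a b

data 𝓕 : Set where
  std  : 𝓕
  pair : (ξ η : ℕ) → ξ ≢ η → 𝓕

basis : 𝓕 → OrderedBasis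
basis std            = E
basis (pair ξ η ξ≢η) = F ξ η ξ≢η

-- F(ξ,9) with ξ ≤ 8, and F(ξ,η) with ξ ≤ 8 and η ≥ 10.
Case₁ Case₂ : 𝓕 → Set
Case₁ std          = ⊥
Case₁ (pair ξ η _) = ξ ≤ 8 × η ≡ 9
Case₂ std          = ⊥
Case₂ (pair ξ η _) = ξ ≤ 8 × 10 ≤ η

infix 4 _<[_]_

_<[_]_ : 𝔽^ℕ → OrderedBasis → 𝔽^ℕ → Set
x <[ B ] y = ∃[ N ] coord (coordinates B x) N Fin.< coord (coordinates B y) N
                  × (∀ i → N < i → coord (coordinates B x) i ≡ coord (coordinates B y) i)

IsMinimum : OrderedBasis → Pred 𝔽^ℕ 0ℓ → 𝔽^ℕ → Set
IsMinimum B P z = z ∈ P × (∀ x → x ∈ P → z ≈ x ⊎ z <[ B ] x)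

digit : ℕ → ℕ → 𝔽
digit n zero    = n mod 3
digit n (suc i) = digit (n / 3) i

digit-0 : ∀ i → digit 0 i ≡ 0#
digit-0 zero    = refl
digit-0 (suc i) = digit-0 i

digit-vanishing : ∀ {i} n → n ≤ i → digit n i ≡ 0#
digit-vanishing {i}     zero    _         = digit-0 i
digit-vanishing {suc i} (suc n) (s≤s n≤i) =
  digit-vanishing (suc n / 3) (ℕₚ.≤-trans (ℕ.s≤s⁻¹ (DM.m/n<m (suc n) 3 (s≤s (s≤s z≤n)))) n≤i)

digits : ℕ → 𝔽^ℕ
digits n = record { coord = digit n ; bound = n ; vanishing = digit-vanishing n }

val : ℕ → (ℕ → 𝔽) → ℕ
val zero    c = 0
val (suc b) c = toℕ (c 0) ℕ.+ val b (c ∘ suc) ℕ.* 3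

digit-val : ∀ b (c : ℕ → 𝔽) → (∀ {i} → b ≤ i → c i ≡ 0#) → ∀ i → digit (val b c) i ≡ c i
digit-val zero    c v i       = trans (digit-0 i) (sym (v z≤n))
digit-val (suc b) c v zero    = Finₚ.toℕ-injective (begin
  toℕ (digit (val (suc b) c) 0)  ≡⟨ toℕ-fromℕ< _ ⟩
  val (suc b) c % 3              ≡⟨ DM.[m+kn]%n≡m%n (toℕ (c 0)) (val b (c ∘ suc)) 3 ⟩
  toℕ (c 0) % 3                  ≡⟨ DM.m<n⇒m%n≡m (Finₚ.toℕ<n (c 0)) ⟩
  toℕ (c 0)                      ∎)
  where open ≡-Reasoning
digit-val (suc b) c v (suc i) = trans (cong (λ m → digit m i) quotient)
                                      (digit-val b (c ∘ suc) (v ∘ s≤s) i)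
  where
  open ≡-Reasoning
  quotient : val (suc b) c / 3 ≡ val b (c ∘ suc)
  quotient = begin
    (toℕ (c 0) ℕ.+ val b (c ∘ suc) ℕ.* 3) / 3
      ≡⟨ DM.+-distrib-/-∣ʳ (toℕ (c 0)) (divides (val b (c ∘ suc)) refl) ⟩
    toℕ (c 0) / 3 ℕ.+ val b (c ∘ suc) ℕ.* 3 / 3
      ≡⟨ cong₂ ℕ._+_ (DM.m<n⇒m/n≡0 (Finₚ.toℕ<n (c 0))) (DM.m*n/n≡m (val b (c ∘ suc)) 3) ⟩
    val b (c ∘ suc) ∎
    where open import Data.Nat.Divisibility using (divides)

digits-surjective : ∀ c → ∃[ n ] digits n ≈ c
digits-surjective c = val (bound c) (coord c) , digit-val (bound c) (coord c) (vanishing c)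

_≺_ : ℕ → ℕ → Set
n ≺ m = ∃[ N ] digit n N Fin.< digit m N × (∀ i → N < i → digit n i ≡ digit m i)

digits-mono : ∀ m n → n < m → n ≺ m
digits-mono = <-rec _ step
  where
  step : ∀ m → (∀ {k} → k < m → ∀ n → n < k → n ≺ k) → ∀ n → n < m → n ≺ m
  step (suc m) rec n n<m with ℕₚ.<-cmp (n / 3) (suc m / 3)
  ... | tri< lt _ _ = let N , l , eq = rec (DM.m/n<m (suc m) 3 (s≤s (s≤s z≤n))) (n / 3) lt in
    suc N , l , λ { (suc i) (s≤s N<i) → eq i N<i }
  ... | tri> _ _ gt = ⊥-elim (ℕₚ.<⇒≱ gt (DM./-monoˡ-≤ 3 (ℕₚ.<⇒≤ n<m)))
  ... | tri≈ _ eq _ = 0 , subst₂ _<_ (sym (toℕ-fromℕ< _)) (sym (toℕ-fromℕ< _)) rem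
                    , λ { (suc i) _ → cong (λ k → digit k i) eq }
    where
    rem : n % 3 < suc m % 3
    rem = ℕₚ.+-cancelʳ-< (suc m / 3 ℕ.* 3) (n % 3) (suc m % 3)
      (subst₂ _<_ (trans (DM.m≡m%n+[m/n]*n n 3) (cong (λ q → n % 3 ℕ.+ q ℕ.* 3) eq))
                  (DM.m≡m%n+[m/n]*n (suc m) 3) n<m)

least : {P : Pred ℕ 0ℓ} → Decidable P → ∀ n → P n → ∃[ m ] P m × (∀ k → P k → m ≤ k)
least {P} P? n pn with search n
  where
  search : ∀ n → (∀ k → k < n → ¬ P k) ⊎ (∃[ m ] P m × (∀ k → P k → m ≤ k))
  search zero = inj₁ λ _ ()
  search (suc n) with search n
  ... | inj₂ found = inj₂ found
  ... | inj₁ none with P? n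
  ...   | yes pn = inj₂ (n , pn , λ k pk → ℕₚ.≮⇒≥ λ k<n → none k k<n pk)
  ...   | no ¬pn = inj₁ λ k k<1+n pk → none k (ℕₚ.≤∧≢⇒< (ℕ.s≤s⁻¹ k<1+n) λ { refl → ¬pn pk }) pk
... | inj₂ found = found
... | inj₁ none  = n , pn , λ k pk → ℕₚ.≮⇒≥ λ k<n → none k k<n pk

-- The sequences in increasing order for _<[ B ]_.
enumerate : OrderedBasis → ℕ → 𝔽^ℕ
enumerate B n = expand (vector B) (digits n)

enumerate-surjective : ∀ B x → ∃[ n ] enumerate B n ≈ x
enumerate-surjective B x = let n , eq = digits-surjective (coordinates B x) in
  n , λ i → trans (expand-cong (vector B) {digits n} {coordinates B x} eq i) (expansion B x i)

enumerate-mono : ∀ B m n {x} → m < n → enumerate B n ≈ x → enumerate B m <[ B ] x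
enumerate-mono B m n {x} m<n eq = let N , l , above = digits-mono n m m<n in
  N , subst₂ Fin._<_ (cm N) (cx N) l , λ i N<i → trans (sym (cm i)) (trans (above i N<i) (cx i))
  where
  cm : digits m ≈ coordinates B (enumerate B m)
  cm = unique B (digits m) (enumerate B m) λ _ → refl
  cx : digits n ≈ coordinates B x
  cx = unique B (digits n) x eq

≈-sym : ∀ {x y} → x ≈ y → y ≈ x
≈-sym eq i = sym (eq i)

abstract
  minimum : ∀ B {P : Pred 𝔽^ℕ 0ℓ} → Decidable P → (∀ {x y} → x ≈ y → P x → P y) →
            ∃ P → ∃ (IsMinimum B P)
  minimum B {P} P? resp (x₀ , px₀) = from-least (start (enumerate-surjective B x₀))
    where
    transport : ∀ x n → enumerate B n ≈ x → P x → P (enumerate B n)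
    transport x n eq = resp {x} {enumerate B n} (≈-sym {enumerate B n} {x} eq)

    start : (∃[ n ] enumerate B n ≈ x₀) → ∃[ m ] P (enumerate B m) × (∀ k → P (enumerate B k) → m ≤ k)
    start (n , eq) = least (P? ∘ enumerate B) n (transport x₀ n eq px₀)

    from-least : (∃[ m ] P (enumerate B m) × (∀ k → P (enumerate B k) → m ≤ k)) → ∃ (IsMinimum B P)
    from-least (m , pm , m≤) = enumerate B m , pm , λ x px → below x px (enumerate-surjective B x)
      where
      below : ∀ x → P x → (∃[ n ] enumerate B n ≈ x) → enumerate B m ≈ x ⊎ enumerate B m <[ B ] x
      below x px (n , eq) = Sum.[ (λ m<n → inj₂ (enumerate-mono B m n {x} m<n eq))
                                , (λ m≡n → inj₁ (subst (λ k → enumerate B k ≈ x) (sym m≡n) eq))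
                                ]′ (ℕₚ.m≤n⇒m<n∨m≡n (m≤ n (transport x n eq px)))

countBelow : {P : Pred ℕ 0ℓ} → Decidable P → ℕ → ℕ
countBelow P? n = length (filter P? (upTo n))

module _ {P : Pred ℕ 0ℓ} (P? : Decidable P) where

  countBelow-suc : ∀ n → countBelow P? (suc n) ≡ countBelow P? n ℕ.+ length (filter P? [ n ])
  countBelow-suc n = begin
    length (filter P? (upTo (suc n)))                        ≡⟨ cong (length ∘ filter P?) (sym (upTo-∷ʳ n)) ⟩
    length (filter P? (upTo n ++ [ n ]))                     ≡⟨ cong length (filter-++ P? (upTo n) [ n ]) ⟩
    length (filter P? (upTo n) ++ filter P? [ n ])           ≡⟨ length-++ (filter P? (upTo n)) ⟩
    length (filter P? (upTo n)) ℕ.+ length (filter P? [ n ]) ∎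
    where open ≡-Reasoning

  countBelow-reject : ∀ n → ¬ P n → countBelow P? (suc n) ≡ countBelow P? n
  countBelow-reject n ¬p = trans (countBelow-suc n)
    (trans (cong (λ l → countBelow P? n ℕ.+ length l) (filter-reject P? {n} {[]} ¬p)) (ℕₚ.+-identityʳ _))

  countBelow-accept : ∀ n → P n → countBelow P? (suc n) ≡ suc (countBelow P? n)
  countBelow-accept n p = trans (countBelow-suc n)
    (trans (cong (λ l → countBelow P? n ℕ.+ length l) (filter-accept P? {n} {[]} p)) (ℕₚ.+-comm _ 1))

  countBelow-stable : ∀ b → (∀ {i} → b ≤ i → ¬ P i) → ∀ k → countBelow P? (k ℕ.+ b) ≡ countBelow P? b
  countBelow-stable b ¬p zero    = refl
  countBelow-stable b ¬p (suc k) = trans (countBelow-reject (k ℕ.+ b) (¬p (ℕₚ.m≤n+m b k)))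
                                         (countBelow-stable b ¬p k)

  countBelow-lower : ∀ s k → (∀ {i} → s ≤ i → i < k ℕ.+ s → P i) → k ≤ countBelow P? (k ℕ.+ s)
  countBelow-lower s zero    p = z≤n
  countBelow-lower s (suc k) p = subst (suc k ≤_)
    (sym (countBelow-accept (k ℕ.+ s) (p (ℕₚ.m≤n+m s k) ℕₚ.≤-refl)))
    (s≤s (countBelow-lower s k λ s≤i i<k → p s≤i (ℕₚ.m<n⇒m<1+n i<k)))

countBelow-cong : {P Q : Pred ℕ 0ℓ} (P? : Decidable P) (Q? : Decidable Q) →
  (∀ {i} → P i → Q i) → (∀ {i} → Q i → P i) → ∀ n → countBelow P? n ≡ countBelow Q? n
countBelow-cong P? Q? to from zero    = refl
countBelow-cong P? Q? to from (suc n) = case (P? n)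
  where
  case : Dec _ → countBelow P? (suc n) ≡ countBelow Q? (suc n)
  case (yes p) = trans (countBelow-accept P? n p) (trans (cong suc (countBelow-cong P? Q? to from n))
                   (sym (countBelow-accept Q? n (to p))))
  case (no ¬p) = trans (countBelow-reject P? n ¬p) (trans (countBelow-cong P? Q? to from n)
                   (sym (countBelow-reject Q? n (¬p ∘ from))))

Differ : 𝔽^ℕ → 𝔽^ℕ → Pred ℕ 0ℓ
Differ x y i = coord x i ≢ coord y i

differ? : ∀ x y → Decidable (Differ x y)
differ? x y i = ¬? (coord x i Finₚ.≟ coord y i)

-- All indices at which x and y differ lie below bound x ⊔ bound y.
dist : 𝔽^ℕ → 𝔽^ℕ → ℕ
dist x y = countBelow (differ? x y) (bound x ⊔ bound y)

agree : ∀ x y {i} → bound x ⊔ bound y ≤ i → ¬ Differ x y i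
agree x y le ne = ne (trans (vanishing x (ℕₚ.m⊔n≤o⇒m≤o (bound x) (bound y) le))
                            (sym (vanishing y (ℕₚ.m⊔n≤o⇒n≤o (bound x) (bound y) le))))

count≡dist : ∀ x y n → bound x ⊔ bound y ≤ n → countBelow (differ? x y) n ≡ dist x y
count≡dist x y n le = trans (cong (countBelow (differ? x y)) (sym (ℕₚ.m∸n+n≡m le)))
  (countBelow-stable (differ? x y) (bound x ⊔ bound y) (agree x y) (n ℕ.∸ (bound x ⊔ bound y)))

Differ-congˡ : ∀ x x′ y → x ≈ x′ → ∀ {i} → Differ x y i → Differ x′ y i
Differ-congˡ x x′ y eq {i} ne p = ne (trans (eq i) p)

dist-congˡ : ∀ x x′ y → x ≈ x′ → dist x y ≡ dist x′ y
dist-congˡ x x′ y eq = begin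
  dist x y                      ≡⟨ count≡dist x y N (ℕₚ.m≤m⊔n _ _) ⟨
  countBelow (differ? x y) N    ≡⟨ countBelow-cong (differ? x y) (differ? x′ y)
                                     (Differ-congˡ x x′ y eq) (Differ-congˡ x′ x y (λ i → sym (eq i))) N ⟩
  countBelow (differ? x′ y) N   ≡⟨ count≡dist x′ y N (ℕₚ.m≤n⊔m (bound x ⊔ bound y) _) ⟩
  dist x′ y                     ∎
  where
  open ≡-Reasoning
  N = (bound x ⊔ bound y) ⊔ (bound x′ ⊔ bound y)

ones : ℕ → 𝔽^ℕ
ones n = record
  { coord = λ i → if does (i ℕₚ.<? n) then 1# else 0#
  ; bound = n
  ; vanishing = λ {i} n≤i → cong (if_then 1# else 0#) (dec-false (i ℕₚ.<? n) (ℕₚ.≤⇒≯ n≤i))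
  }

ones-differ : ∀ n x {i} → bound x ≤ i → i < n → Differ (ones n) x i
ones-differ n x {i} le i<n eq = 1≢0 (trans
  (sym (cong (if_then 1# else 0#) (dec-true (i ℕₚ.<? n) i<n))) (trans eq (vanishing x le)))
  where
  1≢0 : 1# ≢ 0#
  1≢0 ()

far : ∀ d s x → bound x ≤ s → d ≤ dist (ones (d ℕ.+ s)) x
far d s x le = ℕₚ.≤-trans
  (countBelow-lower (differ? (ones n) x) s d λ s≤i → ones-differ n x (ℕₚ.≤-trans le s≤i))
  (ℕₚ.≤-reflexive (count≡dist (ones n) x n (ℕₚ.⊔-lub ℕₚ.≤-refl (ℕₚ.≤-trans le (ℕₚ.m≤n+m s d)))))
  where n = d ℕ.+ s

Avoids : ℕ → List 𝔽^ℕ → Pred 𝔽^ℕ 0ℓ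
Avoids d ws z = All (λ x → d ≤ dist z x) ws

supBound : List 𝔽^ℕ → ℕ
supBound []       = 0
supBound (x ∷ ws) = bound x ⊔ supBound ws

avoids-exists : ∀ d ws → ∃ (Avoids d ws)
avoids-exists d ws = ones (d ℕ.+ supBound ws) , All.map (λ {x} → far d (supBound ws) x) (bounds ws)
  where
  bounds : ∀ ws → All (λ x → bound x ≤ supBound ws) ws
  bounds []       = []
  bounds (x ∷ ws) = ℕₚ.m≤m⊔n _ _
                  ∷ All.map (λ le → ℕₚ.≤-trans le (ℕₚ.m≤n⊔m (bound x) _)) (bounds ws)

next : ∀ B d ws → ∃ (IsMinimum B (Avoids d ws))
next B d ws = minimum B (λ z → All.all? (λ x → d ℕₚ.≤? dist z x) ws)
  (λ {x} {y} eq → All.map λ {v} → subst (d ≤_) (dist-congˡ x y v eq))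
  (avoids-exists d ws)

-- w (a - 1), …, w 0
earlier : OrderedBasis → ℕ → ℕ → List 𝔽^ℕ
earlier B d zero    = []
earlier B d (suc a) = proj₁ (next B d (earlier B d a)) ∷ earlier B d a

w : OrderedBasis → ℕ → ℕ → 𝔽^ℕ
w B d a = proj₁ (next B d (earlier B d a))

-- The defining recursion of w; by it w is determined up to _≈_, as
-- `minimum` is abstract and does not compute.
w-minimum : ∀ B d a → IsMinimum B (λ z → ∀ b → b < a → d ≤ dist z (w B d b)) (w B d a)
w-minimum B d a = let member , below = proj₂ (next B d (earlier B d a)) in
  all-w a member , λ x ok → below x (w-all a ok)
  where
  all-w : ∀ a {P : Pred 𝔽^ℕ 0ℓ} → All P (earlier B d a) → ∀ b → b < a → P (w B d b)
  all-w (suc a) {P} (p ∷ ps) b b<1+a = Sum.[ all-w a ps b , (λ b≡a → subst (P ∘ w B d) (sym b≡a) p) ]′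
                                       (ℕₚ.m≤n⇒m<n∨m≡n (ℕ.s≤s⁻¹ b<1+a))

  w-all : ∀ a {P : Pred 𝔽^ℕ 0ℓ} → (∀ b → b < a → P (w B d b)) → All P (earlier B d a)
  w-all zero    ok = []
  w-all (suc a) ok = ok a ℕₚ.≤-refl ∷ w-all a λ b b<a → ok b (ℕₚ.m<n⇒m<1+n b<a)

Lex : OrderedBasis → ℕ → ℕ → Pred 𝔽^ℕ 0ℓ
Lex B d k x = ∃[ a ] a < 3 ℕ.^ k × x ≈ w B d a

IsLinear : Pred 𝔽^ℕ 0ℓ → Set
IsLinear = IsSubspace 𝔽^ℕ-module

-- IsK B d κ says K(B,d) = κ, where ⊤⁺ is the value ∞.
IsK : OrderedBasis → ℕ → ℕ ⁺ → Set
IsK B d (fin k) = IsLinear (Lex B d k) × (∀ k′ → IsLinear (Lex B d k′) → k′ ≤ k)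
IsK B d ⊤⁺      = ∀ k → IsLinear (Lex B d k)

Word : ℕ → Set
Word n = Vector 𝔽 n

Word-module : ℕ → RawLeftModule 𝔽 0ℓ 0ℓ
Word-module n = record
  { Carrierᴹ = Word n
  ; _≈ᴹ_ = _≗_
  ; _+ᴹ_ = λ u v i → u i + v i
  ; _*ₗ_ = λ a v i → a * v i
  ; 0ᴹ   = λ _ → 0#
  ; -ᴹ_  = λ v i → - v i
  }

hamming : ∀ {n} → Word n → Word n → ℕ
hamming {n} u v = length (filter (λ i → ¬? (u i Finₚ.≟ v i)) (allFin n))

HasMinimumDistance : ∀ {n} → Pred (Word n) 0ℓ → ℕ → Set
HasMinimumDistance {n} C d =
    (∃[ u ] ∃[ v ] u ∈ C × v ∈ C × ¬ (u ≗ v) × hamming u v ≡ d)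
  × (∀ u v → u ∈ C → v ∈ C → ¬ (u ≗ v) → d ≤ hamming u v)

-- Linear [n,k,d] codes over 𝔽.
record Is[_,_,_]Code (n k d : ℕ) (C : Pred (Word n) 0ℓ) : Set where
  field
    isSubspace      : IsSubspace (Word-module n) C
    dimension       : HasDimension (Word-module n) C k
    minimumDistance : HasMinimumDistance C d

-- The [12,6,6] code is unique up to monomial equivalence, and "the"
-- ternary Golay code means any code with these parameters.
IsTernaryGolayCode : Pred (Word 12) 0ℓ → Set
IsTernaryGolayCode = Is[ 12 , 6 , 6 ]Code

Deleted : Pred 𝔽^ℕ 0ℓ → Pred ℕ 0ℓ
Deleted L i = ∀ x → x ∈ L → coord x i ≡ 0#

-- The increasing enumeration of the coordinates that are not deleted.
record Surviving (L : Pred 𝔽^ℕ 0ℓ) (n : ℕ) : Set where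
  field
    position   : Fin n → ℕ
    increasing : ∀ {i j} → i Fin.< j → position i < position j
    sound      : ∀ j → ¬ Deleted L (position j)
    complete   : ∀ i → ¬ Deleted L i → ∃[ j ] position j ≡ i

open Surviving public

Res : ∀ {n} (L : Pred 𝔽^ℕ 0ℓ) → Surviving L n → Pred (Word n) 0ℓ
Res L s v = ∃[ x ] x ∈ L × (∀ j → v j ≡ coord x (position s j))

{-# OPTIONS --safe #-}
-- Write vectors in F-coordinates, most significant first. If C is a linear code with minimum
-- distance 6 such that every vector outside C is within distance 5 of a smaller codeword, then the
-- greedy algorithm lists exactly the codewords of C in increasing order. The condition on C depends
-- on little more than cosets: building C one coordinate at a time, a vector s ∷ x outside C is
-- blocked as soon as some y = (s − t) ∷ … in C with 0 < t ≤ s lies within distance 5 of it, and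
-- whether there is one depends only on s and on the coset of x. The few other cosets are searched
-- exhaustively.
--
-- For the upper bound, let u be the first vector far from C, with leading coordinate 1. If a longer
-- lexicode is linear, it contains u and 2 u, and its elements led by 1 in this place are u + C. In
-- each case some x between u and 2 u, not in u + C, is far from C and from all smaller elements of
-- u + C, so the greedy algorithm selects it: a contradiction. For the Golay code, u sits at
-- coordinate 14 since the covering radius is 3.
module Submission where

open import Algebra.Bundles using (CommutativeRing)
open import Algebra.Module.Bundles.Raw using (RawLeftModule)
open import Data.Bool.Base using (Bool; true; false; if_then_else_; _∧_; _∨_; not; T)
open import Data.Bool.ListAction using (all; any)
open import Data.Bool.Properties using (T-∧; T-∨; T-≡)
open import Data.Empty using (⊥; ⊥-elim)
open import Data.Fin.Base as Fin using (Fin; zero; suc; toℕ; fromℕ<)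
open import Data.Fin.Properties as Finₚ using (all?; toℕ<n; toℕ-injective; toℕ-fromℕ<)
open import Data.List.Base as List
  using (List; []; _∷_; length; filter; applyUpTo; tabulate; allFin; cartesianProductWith)
import Data.List.Membership.Propositional as Membership
open import Data.List.Membership.Propositional.Properties using (∈-allFin; ∈-cartesianProductWith⁺)
open import Data.List.Relation.Unary.All as All using (All)
open import Data.List.Relation.Unary.All.Properties as Allₚ using (all⁺)
open import Data.List.Relation.Unary.Any as Any using (Any; here; there)
open import Data.List.Relation.Unary.Any.Properties as Anyₚ using (any⁻)
open import Data.Maybe.Base using (Maybe; just; nothing)
open import Data.Nat.Base as ℕ using (ℕ; zero; suc; _≤_; _<_; _⊔_; _≡ᵇ_; _<ᵇ_; _≤ᵇ_; z≤n; s≤s)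
import Data.Nat.DivMod as DivMod
open import Data.Nat.Induction using (<-rec)
import Data.Nat.Properties as ℕₚ
open import Data.Product.Base using (∃; ∃₂; ∃-syntax; _×_; _,_; proj₁; proj₂)
open import Data.Sum.Base as Sum using (_⊎_; inj₁; inj₂)
open import Data.Vec.Base as Vec using (Vec; []; _∷_; map; zipWith; replicate; _++_; lookup)
open import Data.Vec.Properties
  using (zipWith-comm; zipWith-identityˡ; zipWith-identityʳ; tabulate∘lookup; lookup∘tabulate; lookup-replicate)
open import Function.Base using (_∘_; id)
open import Function.Bundles using (Equivalence)
open import Level using (0ℓ)
open import Relation.Binary.Definitions using (Tri; tri<; tri≈; tri>)
open import Relation.Binary.PropositionalEquality
open import Relation.Nullary using (¬_; Dec; yes; no; does; contradiction; ¬?)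
open import Relation.Nullary.Construct.Add.Supremum using () renaming ([_] to fin)
open import Relation.Nullary.Decidable using (from-yes; dec-true; dec-false)
open import Relation.Unary using (Pred; Decidable; _∈_)
open import Defs

-- Infinitely many bases reduce to finitely many computations, because a code of length n is tested
-- only on vectors with n + 1 entries. If ξ > n, the basis vector with index ξ does not occur in
-- them and the basis acts like `E`. If η > n, the coordinate η merely repeats the entry at ξ,
-- whatever η is. So n = 8 settles `E` and all ξ ≥ 9 at once, and n = 9 settles all η ≥ 10 for a
-- given ξ; this leaves 1 + 72 + 9 + 9 computations.
--
-- The obstacle is that the order lives in F-coordinates and the distance in standard coordinates.
-- Once the entry at ξ is fixed, the change of coordinates is a translation, so Hamming balls remain
-- Hamming balls and coverings by balls can be decided by branching on F-coordinates.
--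
-- There is no search over k′ in the upper bound: of a longer lexicode only linearity and the
-- presence of an element after the first 3^k are used, so one pair u, x excludes every k′ > k.
-- Codes and pairs are given as data and checked by evaluation.

private variable
  n m k j : ℕ

-- Arithmetic of the field and of vectors over it

pattern 0′ = zero
pattern 1′ = suc zero
pattern 2′ = suc (suc zero)

-- The operations of Defs go through _mod_, which is slow to evaluate.
infixl 6 _⊞_ _⊕_
infixl 7 _⊠_ _⊙_

_⊞_ : 𝔽 → 𝔽 → 𝔽
0′ ⊞ y  = y
1′ ⊞ 0′ = 1′
1′ ⊞ 1′ = 2′
1′ ⊞ 2′ = 0′
2′ ⊞ 0′ = 2′
2′ ⊞ 1′ = 0′
2′ ⊞ 2′ = 1′

_⊠_ : 𝔽 → 𝔽 → 𝔽
0′ ⊠ y  = 0′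
1′ ⊠ y  = y
2′ ⊠ 0′ = 0′
2′ ⊠ 1′ = 2′
2′ ⊠ 2′ = 1′

⊞≡+ : ∀ x y → x ⊞ y ≡ x + y
⊞≡+ = from-yes (all? λ x → all? λ y → x ⊞ y Finₚ.≟ x + y)

⊠≡* : ∀ x y → x ⊠ y ≡ x * y
⊠≡* = from-yes (all? λ x → all? λ y → x ⊠ y Finₚ.≟ x * y)

⊞-comm : ∀ x y → x ⊞ y ≡ y ⊞ x
⊞-comm = from-yes (all? λ x → all? λ y → x ⊞ y Finₚ.≟ y ⊞ x)

⊞-identityʳ : ∀ x → x ⊞ 0′ ≡ x
⊞-identityʳ = from-yes (all? λ x → x ⊞ 0′ Finₚ.≟ x)

⊞-interchange : ∀ w x y z → (w ⊞ x) ⊞ (y ⊞ z) ≡ (w ⊞ y) ⊞ (x ⊞ z)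
⊞-interchange = from-yes (all? λ w → all? λ x → all? λ y → all? λ z →
  (w ⊞ x) ⊞ (y ⊞ z) Finₚ.≟ (w ⊞ y) ⊞ (x ⊞ z))

⊠-distribˡ-⊞ : ∀ s x y → s ⊠ (x ⊞ y) ≡ s ⊠ x ⊞ s ⊠ y
⊠-distribˡ-⊞ = from-yes (all? λ s → all? λ x → all? λ y → s ⊠ (x ⊞ y) Finₚ.≟ s ⊠ x ⊞ s ⊠ y)

⊠-distribʳ-⊞ : ∀ x s t → (s ⊞ t) ⊠ x ≡ s ⊠ x ⊞ t ⊠ x
⊠-distribʳ-⊞ = from-yes (all? λ x → all? λ s → all? λ t → (s ⊞ t) ⊠ x Finₚ.≟ s ⊠ x ⊞ t ⊠ x)

⊠-assoc : ∀ s t x → (s ⊠ t) ⊠ x ≡ s ⊠ (t ⊠ x)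
⊠-assoc = from-yes (all? λ s → all? λ t → all? λ x → (s ⊠ t) ⊠ x Finₚ.≟ s ⊠ (t ⊠ x))

⊞-cancel : ∀ s x → s ⊞ (2′ ⊠ s ⊞ x) ≡ x
⊞-cancel = from-yes (all? λ s → all? λ x → s ⊞ (2′ ⊠ s ⊞ x) Finₚ.≟ x)

_⊕_ : Vec 𝔽 n → Vec 𝔽 n → Vec 𝔽 n
_⊕_ = zipWith _⊞_

_⊙_ : 𝔽 → Vec 𝔽 n → Vec 𝔽 n
s ⊙ v = map (s ⊠_) v

𝟎 : Vec 𝔽 n
𝟎 = replicate _ 0′

⊕-comm : (x y : Vec 𝔽 n) → x ⊕ y ≡ y ⊕ x
⊕-comm = zipWith-comm ⊞-comm

⊕-identityˡ : (x : Vec 𝔽 n) → 𝟎 ⊕ x ≡ x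
⊕-identityˡ = zipWith-identityˡ λ _ → refl

⊕-identityʳ : (x : Vec 𝔽 n) → x ⊕ 𝟎 ≡ x
⊕-identityʳ = zipWith-identityʳ ⊞-identityʳ

⊕-interchange : (w x y z : Vec 𝔽 n) → (w ⊕ x) ⊕ (y ⊕ z) ≡ (w ⊕ y) ⊕ (x ⊕ z)
⊕-interchange []      []      []      []      = refl
⊕-interchange (a ∷ w) (b ∷ x) (c ∷ y) (d ∷ z) = cong₂ _∷_ (⊞-interchange a b c d) (⊕-interchange w x y z)

⊙-distribʳ-⊕ : (s t : 𝔽) (x : Vec 𝔽 n) → (s ⊞ t) ⊙ x ≡ s ⊙ x ⊕ t ⊙ x
⊙-distribʳ-⊕ s t []      = refl
⊙-distribʳ-⊕ s t (a ∷ x) = cong₂ _∷_ (⊠-distribʳ-⊞ a s t) (⊙-distribʳ-⊕ s t x)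

⊙-distribˡ-⊕ : (s : 𝔽) (x y : Vec 𝔽 n) → s ⊙ (x ⊕ y) ≡ s ⊙ x ⊕ s ⊙ y
⊙-distribˡ-⊕ s []      []      = refl
⊙-distribˡ-⊕ s (a ∷ x) (b ∷ y) = cong₂ _∷_ (⊠-distribˡ-⊞ s a b) (⊙-distribˡ-⊕ s x y)

⊙-assoc : (s t : 𝔽) (x : Vec 𝔽 n) → (s ⊠ t) ⊙ x ≡ s ⊙ (t ⊙ x)
⊙-assoc s t []      = refl
⊙-assoc s t (a ∷ x) = cong₂ _∷_ (⊠-assoc s t a) (⊙-assoc s t x)

⊙-zeroˡ : (x : Vec 𝔽 n) → 0′ ⊙ x ≡ 𝟎
⊙-zeroˡ []      = refl
⊙-zeroˡ (a ∷ x) = cong (0′ ∷_) (⊙-zeroˡ x)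

⊙-zeroʳ : ∀ s → s ⊙ 𝟎 {n} ≡ 𝟎
⊙-zeroʳ {zero}  s = refl
⊙-zeroʳ {suc n} s = cong₂ _∷_ (s⊠0 s) (⊙-zeroʳ s)
  where
  s⊠0 : ∀ s → s ⊠ 0′ ≡ 0′
  s⊠0 = from-yes (all? λ s → s ⊠ 0′ Finₚ.≟ 0′)

⊕-cancel : (s : 𝔽) (b x : Vec 𝔽 n) → s ⊙ b ⊕ ((2′ ⊠ s) ⊙ b ⊕ x) ≡ x
⊕-cancel s []      []      = refl
⊕-cancel s (b ∷ bs) (a ∷ x) = cong₂ _∷_
  (trans (cong (λ t → s ⊠ b ⊞ (t ⊞ a)) (⊠-assoc 2′ s b)) (⊞-cancel (s ⊠ b) a)) (⊕-cancel s bs x)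

⊕-move : (x y z : Vec 𝔽 n) → x ⊕ 2′ ⊙ y ≡ z → x ≡ y ⊕ z
⊕-move x y _ refl = sym (trans (⊕-comm y _) (back x y))
  where
  back : (x y : Vec 𝔽 n) → (x ⊕ 2′ ⊙ y) ⊕ y ≡ x
  back []      []      = refl
  back (a ∷ x) (b ∷ y) = cong₂ _∷_ (field-back a b) (back x y)
    where
    field-back : ∀ a b → (a ⊞ 2′ ⊠ b) ⊞ b ≡ a
    field-back = from-yes (all? λ a → all? λ b → (a ⊞ 2′ ⊠ b) ⊞ b Finₚ.≟ a)

vecs : ∀ k → List (Vec 𝔽 k)
vecs zero    = [] ∷ []
vecs (suc k) = cartesianProductWith _∷_ (0′ ∷ 1′ ∷ 2′ ∷ []) (vecs k)

∈-trits : ∀ (x : 𝔽) → x Membership.∈ (0′ ∷ 1′ ∷ 2′ ∷ [])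
∈-trits 0′ = here refl
∈-trits 1′ = there (here refl)
∈-trits 2′ = there (there (here refl))

vecs-complete : (v : Vec 𝔽 k) → v Membership.∈ vecs k
vecs-complete []      = here refl
vecs-complete (x ∷ v) = ∈-cartesianProductWith⁺ _∷_ (∈-trits x) (vecs-complete v)

module _ {A : Set} where

  image : (Vec 𝔽 k → A) → List A
  image {k} f = List.map f (vecs k)

  any-image : (p : A → Bool) (f : Vec 𝔽 k → A) → T (any p (image f)) → ∃ λ v → T (p (f v))
  any-image p f t = Any.satisfied (Anyₚ.map⁻ (any⁻ p (image f) t))

  all-image : (p : A → Bool) (f : Vec 𝔽 k → A) → T (all p (image f)) → ∀ v → T (p (f v))
  all-image p f t v = All.lookup (Allₚ.map⁻ (all⁺ p (image f) t)) (vecs-complete v)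

all-vecs : (p : Vec 𝔽 k → Bool) → T (all p (vecs k)) → ∀ v → T (p v)
all-vecs p t v = All.lookup (all⁺ p _ t) (vecs-complete v)

∧⁻ : ∀ {a b} → T (a ∧ b) → T a × T b
∧⁻ = Equivalence.to T-∧

∨⁻ : ∀ {a b} → T (a ∨ b) → T a ⊎ T b
∨⁻ = Equivalence.to T-∨

isZero : Vec 𝔽 n → Bool
isZero []          = true
isZero (0′ ∷ v)    = isZero v
isZero (suc _ ∷ v) = false

isZero⇒≡𝟎 : (v : Vec 𝔽 n) → T (isZero v) → v ≡ 𝟎
isZero⇒≡𝟎 []       _ = refl
isZero⇒≡𝟎 (0′ ∷ v) t = cong (0′ ∷_) (isZero⇒≡𝟎 v t)

-- The lexicographic order

-- The head of a vector is its most significant entry.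
rank : Vec 𝔽 n → ℕ
rank []              = 0
rank {suc n} (x ∷ v) = toℕ x ℕ.* 3 ℕ.^ n ℕ.+ rank v

rank<3^n : (v : Vec 𝔽 n) → rank v < 3 ℕ.^ n
rank-head : ∀ {x y} (u v : Vec 𝔽 n) → toℕ x < toℕ y → rank (x ∷ u) < rank (y ∷ v)

rank<3^n []              = s≤s z≤n
rank<3^n {suc n} (x ∷ v) = ℕₚ.<-≤-trans (ℕₚ.+-monoʳ-< (toℕ x ℕ.* 3 ℕ.^ n) (rank<3^n v))
  (ℕₚ.≤-trans (ℕₚ.≤-reflexive (ℕₚ.+-comm (toℕ x ℕ.* 3 ℕ.^ n) (3 ℕ.^ n))) (ℕₚ.*-monoˡ-≤ (3 ℕ.^ n) (toℕ<n x)))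

rank-head {n} {x} {y} u v x<y = ℕₚ.<-≤-trans (ℕₚ.+-monoʳ-< (toℕ x ℕ.* 3 ℕ.^ n) (rank<3^n u))
  (ℕₚ.≤-trans (ℕₚ.≤-reflexive (ℕₚ.+-comm (toℕ x ℕ.* 3 ℕ.^ n) (3 ℕ.^ n)))
    (ℕₚ.≤-trans (ℕₚ.*-monoˡ-≤ (3 ℕ.^ n) x<y) (ℕₚ.m≤m+n _ (rank v))))

rank-injective : (u v : Vec 𝔽 n) → rank u ≡ rank v → u ≡ v
rank-injective []      []      _  = refl
rank-injective {suc n} (x ∷ u) (y ∷ v) eq with ℕₚ.<-cmp (toℕ x) (toℕ y)
... | tri< x<y _ _ = contradiction eq (ℕₚ.<⇒≢ (rank-head u v x<y))
... | tri> _ _ y<x = contradiction (sym eq) (ℕₚ.<⇒≢ (rank-head v u y<x))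
... | tri≈ _ x≡y _ with refl ← toℕ-injective {i = x} {y} x≡y =
  cong (x ∷_) (rank-injective u v (ℕₚ.+-cancelˡ-≡ (toℕ x ℕ.* 3 ℕ.^ n) _ _ eq))

infix 4 _⊏_

-- A record rather than an inequality of ranks, so that `u` and `v` can be inferred by unification.
record _⊏_ (u v : Vec 𝔽 n) : Set where
  constructor by-rank
  field rank-< : rank u < rank v

open _⊏_ public

⊏-head : ∀ {x y} {u v : Vec 𝔽 n} → toℕ x < toℕ y → (x ∷ u) ⊏ (y ∷ v)
⊏-head {u = u} {v} x<y = by-rank (rank-head u v x<y)

⊏-tail : ∀ {x} {u v : Vec 𝔽 n} → u ⊏ v → (x ∷ u) ⊏ (x ∷ v)
⊏-tail {n} {x} (by-rank u<v) = by-rank (ℕₚ.+-monoʳ-< (toℕ x ℕ.* 3 ℕ.^ n) u<v)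

⊏-∷⁻ : ∀ {x y} {u v : Vec 𝔽 n} → (x ∷ u) ⊏ (y ∷ v) → toℕ x < toℕ y ⊎ (x ≡ y × u ⊏ v)
⊏-∷⁻ {n} {x} {y} {u} {v} (by-rank lt) with ℕₚ.<-cmp (toℕ x) (toℕ y)
... | tri< x<y _ _ = inj₁ x<y
... | tri> _ _ y<x = contradiction lt (ℕₚ.<-asym (rank-head v u y<x))
... | tri≈ _ eq _ with refl ← toℕ-injective {i = x} {y} eq =
  inj₂ (refl , by-rank (ℕₚ.+-cancelˡ-< (toℕ x ℕ.* 3 ℕ.^ n) _ _ lt))

⊏-irrefl : {u : Vec 𝔽 n} → ¬ u ⊏ u
⊏-irrefl (by-rank lt) = ℕₚ.<-irrefl refl lt

⊏-asym : {u v : Vec 𝔽 n} → u ⊏ v → ¬ v ⊏ u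
⊏-asym (by-rank lt) (by-rank gt) = ℕₚ.<-asym lt gt

⊏-cmp : (u v : Vec 𝔽 n) → u ⊏ v ⊎ u ≡ v ⊎ v ⊏ u
⊏-cmp u v with ℕₚ.<-cmp (rank u) (rank v)
... | tri< lt _ _ = inj₁ (by-rank lt)
... | tri≈ _ eq _ = inj₂ (inj₁ (rank-injective u v eq))
... | tri> _ _ gt = inj₂ (inj₂ (by-rank gt))

unrank : ∀ n a → a < 3 ℕ.^ n → ∃ λ (v : Vec 𝔽 n) → rank v ≡ a
unrank zero    zero    _   = [] , refl
unrank zero    (suc a) (s≤s ())
unrank (suc n) a       a<  =
  let instance _ = ℕₚ.m^n≢0 3 n
      q<3 = DivMod.m<n*o⇒m/o<n {a} {3} {3 ℕ.^ n} a<
      v , eq = unrank n (a DivMod.% 3 ℕ.^ n) (DivMod.m%n<n a (3 ℕ.^ n))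
  in fromℕ< q<3 ∷ v , (begin
    toℕ (fromℕ< q<3) ℕ.* 3 ℕ.^ n ℕ.+ rank v
      ≡⟨ cong₂ (λ q r → q ℕ.* 3 ℕ.^ n ℕ.+ r) (toℕ-fromℕ< q<3) eq ⟩
    a DivMod./ 3 ℕ.^ n ℕ.* 3 ℕ.^ n ℕ.+ a DivMod.% 3 ℕ.^ n
      ≡⟨ ℕₚ.+-comm _ (a DivMod.% 3 ℕ.^ n) ⟩
    a DivMod.% 3 ℕ.^ n ℕ.+ a DivMod./ 3 ℕ.^ n ℕ.* 3 ℕ.^ n
      ≡⟨ DivMod.m≡m%n+[m/n]*n a (3 ℕ.^ n) ⟨
    a ∎)
  where open ≡-Reasoning

-- Partially prescribed vectors

Pattern : ℕ → Set
Pattern n = Vec (Maybe 𝔽) n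

data Fits : Pattern n → Vec 𝔽 n → Set where
  []   : Fits [] []
  hole : ∀ {p x} {v : Vec 𝔽 n} → Fits p v → Fits (nothing ∷ p) (x ∷ v)
  by   : ∀ {p x} {v : Vec 𝔽 n} → Fits p v → Fits (just x ∷ p) (x ∷ v)

holes : Pattern n
holes = replicate _ nothing

fits-holes : (v : Vec 𝔽 n) → Fits holes v
fits-holes []      = []
fits-holes (x ∷ v) = hole (fits-holes v)

-- One pattern for each place of a first difference from `u` and each smaller value there. Together
-- they partition the vectors below `u` into few subcubes.
before : Vec 𝔽 n → List (Pattern n)
before []       = []
before (0′ ∷ u) = List.map (just 0′ ∷_) (before u)
before (1′ ∷ u) = (just 0′ ∷ holes) ∷ List.map (just 1′ ∷_) (before u)
before (2′ ∷ u) = (just 0′ ∷ holes) ∷ (just 1′ ∷ holes) ∷ List.map (just 2′ ∷_) (before u)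

fits-before : (u v : Vec 𝔽 n) → v ⊏ u → Any (λ p → Fits p v) (before u)
fits-before []       []      (by-rank ())
fits-before (y ∷ u)  (x ∷ v) v⊏u = go y x (⊏-∷⁻ v⊏u)
  where
  go : ∀ y x → toℕ x < toℕ y ⊎ (x ≡ y × v ⊏ u) → Any (λ p → Fits p (x ∷ v)) (before (y ∷ u))
  later : ∀ x → v ⊏ u → Any (λ p → Fits p (x ∷ v)) (List.map (just x ∷_) (before u))
  later x v⊏u = Anyₚ.map⁺ (Any.map by (fits-before u v v⊏u))
  go 0′ _  (inj₂ (refl , v⊏u)) = later 0′ v⊏u
  go 1′ 0′ (inj₁ _)            = here (by (fits-holes v))
  go 1′ (suc _) (inj₁ (s≤s ()))
  go 1′ _  (inj₂ (refl , v⊏u)) = there (later 1′ v⊏u)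
  go 2′ 0′ (inj₁ _)            = here (by (fits-holes v))
  go 2′ 1′ (inj₁ _)            = there (here (by (fits-holes v)))
  go 2′ 2′ (inj₁ (s≤s (s≤s ())))
  go 2′ _  (inj₂ (refl , v⊏u)) = there (there (later 2′ v⊏u))

-- Systematic codes and their cosets

-- Linear codes of length n and dimension k in systematic form. Reading the coordinates from the
-- most significant one, `lead b C` adds a generator with leading entry 1 and entries b at the
-- n − k coordinates that lead no generator.
data Code : ℕ → ℕ → ℕ → Set where
  []   : Code 0 0 0
  free : Code n m k → Code (suc n) (suc m) k
  lead : Vec 𝔽 m → Code n m k → Code (suc n) m (suc k)

-- `point C r` enumerates, in increasing order, the coset of C with representative r.
point : Code n m k → Vec 𝔽 m → Vec 𝔽 k → Vec 𝔽 n
point []         []      []      = []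
point (free C)   (x ∷ r) c       = x ∷ point C r c
point (lead b C) r       (s ∷ c) = s ∷ point C (s ⊙ b ⊕ r) c

codeword : Code n m k → Vec 𝔽 k → Vec 𝔽 n
codeword C = point C 𝟎

rep : Code n m k → Vec 𝔽 n → Vec 𝔽 m
rep []         []      = []
rep (free C)   (x ∷ v) = x ∷ rep C v
rep (lead b C) (_ ∷ v) = rep C v

-- With 0 prescribed at the leading coordinates, exactly one vector of each coset fits, namely
-- `point C r 𝟎`. On such vectors `rep` returns the coset `r`; on others it only reads off the free
-- entries.
rep-pattern : Code n m k → Pattern n
rep-pattern []         = []
rep-pattern (free C)   = nothing ∷ rep-pattern C
rep-pattern (lead b C) = just 0′ ∷ rep-pattern C

rep-point : (C : Code n m k) (r : Vec 𝔽 m) → rep C (point C r 𝟎) ≡ r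
rep-point []         []      = refl
rep-point (free C)   (x ∷ r) = cong (x ∷_) (rep-point C r)
rep-point (lead b C) r       = trans (rep-point C (0′ ⊙ b ⊕ r)) (trans (cong (_⊕ r) (⊙-zeroˡ b)) (⊕-identityˡ r))

fits-rep : (C : Code n m k) (r : Vec 𝔽 m) → Fits (rep-pattern C) (point C r 𝟎)
fits-rep []         []      = []
fits-rep (free C)   (x ∷ r) = hole (fits-rep C r)
fits-rep (lead b C) r       = by (fits-rep C (0′ ⊙ b ⊕ r))

point-surjective : (C : Code n m k) (x : Vec 𝔽 n) → ∃₂ λ r c → x ≡ point C r c
point-surjective []         []      = [] , [] , refl
point-surjective (free C)   (x ∷ v) = let r , c , eq = point-surjective C v in x ∷ r , c , cong (x ∷_) eq
point-surjective (lead b C) (s ∷ v) = let r , c , eq = point-surjective C v in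
  (2′ ⊠ s) ⊙ b ⊕ r , s ∷ c , cong (s ∷_) (trans eq (cong (λ r → point C r c) (sym (⊕-cancel s b r))))

point-⊕ : (C : Code n m k) (r r′ : Vec 𝔽 m) (c c′ : Vec 𝔽 k) →
          point C (r ⊕ r′) (c ⊕ c′) ≡ point C r c ⊕ point C r′ c′
point-⊕ []         []      []       []      []       = refl
point-⊕ (free C)   (x ∷ r) (y ∷ r′) c       c′       = cong (x ⊞ y ∷_) (point-⊕ C r r′ c c′)
point-⊕ (lead b C) r       r′       (s ∷ c) (t ∷ c′) = cong (s ⊞ t ∷_) (trans
  (cong (λ r → point C r (c ⊕ c′)) (trans (cong (_⊕ (r ⊕ r′)) (⊙-distribʳ-⊕ s t b)) (⊕-interchange (s ⊙ b) (t ⊙ b) r r′)))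
  (point-⊕ C (s ⊙ b ⊕ r) (t ⊙ b ⊕ r′) c c′))

point-⊙ : (C : Code n m k) (s : 𝔽) (r : Vec 𝔽 m) (c : Vec 𝔽 k) → point C (s ⊙ r) (s ⊙ c) ≡ s ⊙ point C r c
point-⊙ []         s []      []      = refl
point-⊙ (free C)   s (x ∷ r) c       = cong (s ⊠ x ∷_) (point-⊙ C s r c)
point-⊙ (lead b C) s r       (t ∷ c) = cong (s ⊠ t ∷_) (trans
  (cong (λ r → point C r (s ⊙ c)) (trans (cong (_⊕ s ⊙ r) (⊙-assoc s t b)) (sym (⊙-distribˡ-⊕ s (t ⊙ b) r))))
  (point-⊙ C s (t ⊙ b ⊕ r) c))

-- Above the leading coordinate where `c` and `d` first differ, the two points have been built from
-- the same data and coincide.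
point-mono : (C : Code n m k) (r : Vec 𝔽 m) {c d : Vec 𝔽 k} → c ⊏ d → point C r c ⊏ point C r d
point-mono []         []      {[]}    {[]}    (by-rank ())
point-mono (free C)   (x ∷ r) c⊏d = ⊏-tail (point-mono C r c⊏d)
point-mono (lead b C) r       {s ∷ c} {t ∷ d} lt with ⊏-∷⁻ lt
... | inj₁ s<t          = ⊏-head s<t
... | inj₂ (refl , c⊏d) = ⊏-tail (point-mono C (s ⊙ b ⊕ r) c⊏d)

point-cancel-⊏ : (C : Code n m k) (r : Vec 𝔽 m) (c d : Vec 𝔽 k) → point C r c ⊏ point C r d → c ⊏ d
point-cancel-⊏ C r c d lt with ⊏-cmp c d
... | inj₁ c⊏d        = c⊏d
... | inj₂ (inj₁ refl) = contradiction lt ⊏-irrefl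
... | inj₂ (inj₂ d⊏c) = contradiction lt (⊏-asym (point-mono C r d⊏c))

point-injective : (C : Code n m k) (r : Vec 𝔽 m) (c d : Vec 𝔽 k) → point C r c ≡ point C r d → c ≡ d
point-injective C r c d eq with ⊏-cmp c d
... | inj₁ c⊏d        = contradiction (subst (_⊏ point C r d) eq (point-mono C r c⊏d)) ⊏-irrefl
... | inj₂ (inj₁ c≡d) = c≡d
... | inj₂ (inj₂ d⊏c) = contradiction (subst (point C r d ⊏_) eq (point-mono C r d⊏c)) ⊏-irrefl

codeword-⊕ : (C : Code n m k) (c d : Vec 𝔽 k) → codeword C (c ⊕ d) ≡ codeword C c ⊕ codeword C d
codeword-⊕ C c d = trans (cong (λ r → point C r (c ⊕ d)) (sym (⊕-identityˡ 𝟎))) (point-⊕ C 𝟎 𝟎 c d)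

codeword-⊙ : (C : Code n m k) (s : 𝔽) (c : Vec 𝔽 k) → codeword C (s ⊙ c) ≡ s ⊙ codeword C c
codeword-⊙ C s c = trans (cong (λ r → point C r (s ⊙ c)) (sym (⊙-zeroʳ s))) (point-⊙ C s 𝟎 c)

codeword-𝟎 : (C : Code n m k) → codeword C 𝟎 ≡ 𝟎
codeword-𝟎 C = trans (cong (codeword C) (sym (⊙-zeroˡ 𝟎))) (trans (codeword-⊙ C 0′ 𝟎) (⊙-zeroˡ (codeword C 𝟎)))

-- Hamming distance of vectors

infix 4 _==_

_==_ : 𝔽 → 𝔽 → Bool
0′ == 0′ = true
1′ == 1′ = true
2′ == 2′ = true
_  == _  = false

miss : 𝔽 → 𝔽 → ℕ
miss x y = if x == y then 0 else 1

miss-≢ : ∀ x y → x ≢ y → miss x y ≡ 1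
miss-≢ 0′ 0′ ne = contradiction refl ne
miss-≢ 0′ 1′ ne = refl
miss-≢ 0′ 2′ ne = refl
miss-≢ 1′ 0′ ne = refl
miss-≢ 1′ 1′ ne = contradiction refl ne
miss-≢ 1′ 2′ ne = refl
miss-≢ 2′ 0′ ne = refl
miss-≢ 2′ 1′ ne = refl
miss-≢ 2′ 2′ ne = contradiction refl ne

miss-refl : ∀ x → miss x x ≡ 0
miss-refl 0′ = refl
miss-refl 1′ = refl
miss-refl 2′ = refl

miss-sym : ∀ x y → miss x y ≡ miss y x
miss-sym = from-yes (all? λ x → all? λ y → miss x y ℕₚ.≟ miss y x)

miss-⊞ : ∀ x y z → miss (x ⊞ z) (y ⊞ z) ≡ miss x y
miss-⊞ = from-yes (all? λ x → all? λ y → all? λ z → miss (x ⊞ z) (y ⊞ z) ℕₚ.≟ miss x y)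

miss≤1 : ∀ x y → miss x y ≤ 1
miss≤1 = from-yes (all? λ x → all? λ y → miss x y ℕₚ.≤? 1)

ham : Vec 𝔽 n → Vec 𝔽 n → ℕ
ham []      []      = 0
ham (x ∷ u) (y ∷ v) = miss x y ℕ.+ ham u v

ham-refl : (u : Vec 𝔽 n) → ham u u ≡ 0
ham-refl []      = refl
ham-refl (x ∷ u) = cong₂ ℕ._+_ (miss-refl x) (ham-refl u)

ham-sym : (u v : Vec 𝔽 n) → ham u v ≡ ham v u
ham-sym []      []      = refl
ham-sym (x ∷ u) (y ∷ v) = cong₂ ℕ._+_ (miss-sym x y) (ham-sym u v)

ham-⊕ : (u v z : Vec 𝔽 n) → ham (u ⊕ z) (v ⊕ z) ≡ ham u v
ham-⊕ []      []      []      = refl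
ham-⊕ (x ∷ u) (y ∷ v) (a ∷ z) = cong₂ ℕ._+_ (miss-⊞ x y a) (ham-⊕ u v z)

-- Gives up at mismatch number d + 1, which is cheaper than computing `ham` and comparing.
close : ℕ → Vec 𝔽 n → Vec 𝔽 n → Bool
close d       []      []      = true
close zero    (x ∷ u) (y ∷ v) = (x == y) ∧ close zero u v
close (suc d) (x ∷ u) (y ∷ v) = if x == y then close (suc d) u v else close d u v

close-sound : ∀ d (u v : Vec 𝔽 n) → T (close d u v) → ham u v ≤ d
close-sound d       []      []      _ = z≤n
close-sound zero    (x ∷ u) (y ∷ v) t with x == y
... | true  = close-sound zero u v t
close-sound (suc d) (x ∷ u) (y ∷ v) t with x == y
... | true  = close-sound (suc d) u v t
... | false = s≤s (close-sound d u v t)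

close-complete : ∀ d (u v : Vec 𝔽 n) → T (not (close d u v)) → d < ham u v
close-complete d       []      []      ()
close-complete zero    (x ∷ u) (y ∷ v) t with x == y
... | true  = close-complete zero u v t
... | false = s≤s z≤n
close-complete (suc d) (x ∷ u) (y ∷ v) t with x == y
... | true  = close-complete (suc d) u v t
... | false = s≤s (close-complete d u v t)

ham≤n : (u v : Vec 𝔽 n) → ham u v ≤ n
ham≤n []      []      = z≤n
ham≤n (x ∷ u) (y ∷ v) = ℕₚ.+-mono-≤ (miss≤1 x y) (ham≤n u v)

-- Deciding whether balls cover a subcube

Ball : ℕ → Set
Ball n = ℕ × Vec 𝔽 n

_∈ᴮ_ : Vec 𝔽 n → Ball n → Set
v ∈ᴮ (d , σ) = ham v σ ≤ d

whole : Ball n → Bool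
whole {n} (d , _) = n ≤ᵇ d

shrink : Bool → ℕ → Vec 𝔽 n → List (Ball n) → List (Ball n)
shrink true  d       σ balls = (d , σ) ∷ balls
shrink false (suc d) σ balls = (d , σ) ∷ balls
shrink false zero    σ balls = balls

-- Intersecting a ball with the hyperplane of vectors led by `x` gives a ball one dimension lower:
-- of the same radius if its centre lies there, otherwise of radius one less, or nothing if the
-- radius was 0.
slice : 𝔽 → List (Ball (suc n)) → List (Ball n)
slice x []                    = []
slice x ((d , y ∷ σ) ∷ balls) = shrink (x == y) d σ (slice x balls)

slice-sound : ∀ x (balls : List (Ball (suc n))) {v} → Any (v ∈ᴮ_) (slice x balls) → Any ((x ∷ v) ∈ᴮ_) balls
slice-sound x ((d , y ∷ σ) ∷ balls) {v} h =
  Sum.[ here , there ∘ slice-sound x balls ]′ (shrink-sound (x == y) d (slice x balls) h)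
  where
  shrink-sound : ∀ b d rest → Any (v ∈ᴮ_) (shrink b d σ rest) → (if b then 0 else 1) ℕ.+ ham v σ ≤ d ⊎ Any (v ∈ᴮ_) rest
  shrink-sound true  d       rest (here le) = inj₁ le
  shrink-sound true  d       rest (there h) = inj₂ h
  shrink-sound false (suc d) rest (here le) = inj₁ (s≤s le)
  shrink-sound false (suc d) rest (there h) = inj₂ h
  shrink-sound false zero    rest h         = inj₂ h

-- Branches over the entries; a ball whose radius is no less than the number of entries left ends a
-- branch.
covers split : Pattern n → List (Ball n) → (Vec 𝔽 n → Bool) → Bool
covers p balls q = any whole balls ∨ split p balls q
-- With no entries left every remaining ball counts as `whole`, so `q` decides only for vectors that
-- lie in no ball.
split []            balls q = q []
split (just x ∷ p)  balls q = covers p (slice x balls) (q ∘ (x ∷_))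
split (nothing ∷ p) balls q =
  covers p (slice 0′ balls) (q ∘ (0′ ∷_)) ∧ covers p (slice 1′ balls) (q ∘ (1′ ∷_)) ∧ covers p (slice 2′ balls) (q ∘ (2′ ∷_))

covers-sound : ∀ {p} {v : Vec 𝔽 n} balls q → Fits p v → T (covers p balls q) → Any (v ∈ᴮ_) balls ⊎ T (q v)
split-sound  : ∀ {p} {v : Vec 𝔽 n} balls q → Fits p v → T (split p balls q) → Any (v ∈ᴮ_) balls ⊎ T (q v)

covers-sound {n} {p} {v} balls q f t with ∨⁻ {any whole balls} t
... | inj₁ t = inj₁ (Any.map (λ {(d , σ)} w → ℕₚ.≤-trans (ham≤n v σ) (ℕₚ.≤ᵇ⇒≤ n d w)) (any⁻ whole balls t))
... | inj₂ t = split-sound balls q f t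

split-sound balls q []       t = inj₂ t
split-sound balls q (by {x = x} f) t = Sum.map₁ (slice-sound x balls) (covers-sound (slice x balls) (q ∘ (x ∷_)) f t)
split-sound {v = x ∷ v} balls q (hole {p = p} f) t =
  Sum.map₁ (slice-sound x balls) (covers-sound (slice x balls) (q ∘ (x ∷_)) f (branch x t))
  where
  branch : ∀ x → T (split (nothing ∷ p) balls q) → T (covers p (slice x balls) (q ∘ (x ∷_)))
  branch 0′ t = proj₁ (∧⁻ t)
  branch 1′ t = proj₁ (∧⁻ (proj₂ (∧⁻ {covers p (slice 0′ balls) (q ∘ (0′ ∷_))} t)))
  branch 2′ t = proj₂ (∧⁻ {covers p (slice 1′ balls) (q ∘ (1′ ∷_))} (proj₂ (∧⁻ {covers p (slice 0′ balls) (q ∘ (0′ ∷_))} t)))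

-- Standard coordinates with respect to F(ξ,η)

at : Vec 𝔽 n → ℕ → 𝔽
at []              i = 0′
at {suc n} (x ∷ v) i = if i ≡ᵇ n then x else at v i

addAt : ℕ → 𝔽 → Vec 𝔽 n → Vec 𝔽 n
addAt η a []              = []
addAt {suc n} η a (x ∷ v) = (if η ≡ᵇ n then x ⊞ a else x) ∷ addAt η a v

-- For the basis F(ξ,η), the standard coordinates of Σ vᵢ fᵢ where the sum runs over i < n: the
-- head is the coordinate η if η ≥ n, and the tail holds the coordinates below n.
standard : ℕ → ℕ → Vec 𝔽 n → Vec 𝔽 (suc n)
standard {n} ξ η v = (if η <ᵇ n then 0′ else at v ξ) ∷ addAt η (at v ξ) v

≡ᵇ-refl : ∀ n → (n ≡ᵇ n) ≡ true
≡ᵇ-refl n = dec-true (n ℕₚ.≟ n) refl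

≢⇒≡ᵇ : ∀ {m n} → m ≢ n → (m ≡ᵇ n) ≡ false
≢⇒≡ᵇ {m} {n} = dec-false (m ℕₚ.≟ n)

<⇒<ᵇ : ∀ {m n} → m < n → (m <ᵇ n) ≡ true
<⇒<ᵇ m<n = Equivalence.to T-≡ (ℕₚ.<⇒<ᵇ m<n)

≤⇒≮ᵇ : ∀ {m n} → n ≤ m → (m <ᵇ n) ≡ false
≤⇒≮ᵇ {m} {n} n≤m with m <ᵇ n in eq
... | false = refl
... | true  = contradiction (ℕₚ.<ᵇ⇒< m n (Equivalence.from T-≡ eq)) (ℕₚ.≤⇒≯ n≤m)

at-⊕ : (u v : Vec 𝔽 n) → ∀ i → at (u ⊕ v) i ≡ at u i ⊞ at v i
at-⊕ []      []      i = refl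
at-⊕ {suc n} (x ∷ u) (y ∷ v) i with i ≡ᵇ n
... | true  = refl
... | false = at-⊕ u v i

at-⊙ : ∀ s (v : Vec 𝔽 n) i → at (s ⊙ v) i ≡ s ⊠ at v i
at-⊙ 0′ [] i = refl
at-⊙ 1′ [] i = refl
at-⊙ 2′ [] i = refl
at-⊙ {suc n} s (x ∷ v) i with i ≡ᵇ n
... | true  = refl
... | false = at-⊙ s v i

at-≥ : (v : Vec 𝔽 n) → ∀ {i} → n ≤ i → at v i ≡ 0′
at-≥ []      _   = refl
at-≥ (x ∷ v) n<i rewrite ≢⇒≡ᵇ (ℕₚ.>⇒≢ n<i) = at-≥ v (ℕₚ.<⇒≤ n<i)

at-top : ∀ x (v : Vec 𝔽 n) → at (x ∷ v) n ≡ x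
at-top {n} x v rewrite ≡ᵇ-refl n = refl

at-below : ∀ x (v : Vec 𝔽 n) {i} → i < n → at (x ∷ v) i ≡ at v i
at-below {n} x v i<n rewrite ≢⇒≡ᵇ (ℕₚ.<⇒≢ i<n) = refl

at-0∷ : (v : Vec 𝔽 n) → ∀ i → at (0′ ∷ v) i ≡ at v i
at-0∷ {n} v i with i ℕₚ.≟ n
... | yes refl rewrite ≡ᵇ-refl n = sym (at-≥ v ℕₚ.≤-refl)
... | no  i≢n  rewrite ≢⇒≡ᵇ i≢n  = refl

at-injective : (u v : Vec 𝔽 n) → (∀ i → at u i ≡ at v i) → u ≡ v
at-injective []      []      eq = refl
at-injective (x ∷ u) (y ∷ v) eq = cong₂ _∷_ x≡y (at-injective u v tail)
  where
  x≡y : x ≡ y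
  x≡y = trans (sym (at-top x u)) (trans (eq _) (at-top y v))
  tail : ∀ i → at u i ≡ at v i
  tail i with i ℕₚ.<? _
  ... | yes i<n = trans (sym (at-below x u i<n)) (trans (eq i) (at-below y v i<n))
  ... | no  i≮n = trans (at-≥ u (ℕₚ.≮⇒≥ i≮n)) (sym (at-≥ v (ℕₚ.≮⇒≥ i≮n)))

addAt-⊕ : ∀ η a b (u v : Vec 𝔽 n) → addAt η (a ⊞ b) (u ⊕ v) ≡ addAt η a u ⊕ addAt η b v
addAt-⊕ η a b []      []      = refl
addAt-⊕ {suc n} η a b (x ∷ u) (y ∷ v) with η ≡ᵇ n
... | true  = cong₂ _∷_ (⊞-interchange x y a b) (addAt-⊕ η a b u v)
... | false = cong (_ ∷_) (addAt-⊕ η a b u v)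

standard-⊕ : ∀ ξ η (u v : Vec 𝔽 n) → standard ξ η (u ⊕ v) ≡ standard ξ η u ⊕ standard ξ η v
standard-⊕ {n} ξ η u v rewrite at-⊕ u v ξ with η <ᵇ n
... | true  = cong (0′ ∷_) (addAt-⊕ η _ _ u v)
... | false = cong (_ ∷_) (addAt-⊕ η _ _ u v)

addAt-≥ : ∀ {η} a (v : Vec 𝔽 n) → n ≤ η → addAt η a v ≡ v
addAt-≥ a []      _   = refl
addAt-≥ a (x ∷ v) n<η rewrite ≢⇒≡ᵇ (ℕₚ.>⇒≢ n<η) = cong (x ∷_) (addAt-≥ a v (ℕₚ.<⇒≤ n<η))

addAt-0 : ∀ η (v : Vec 𝔽 n) → addAt η 0′ v ≡ v
addAt-0 η [] = refl
addAt-0 {suc n} η (x ∷ v) with η ≡ᵇ n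
... | true  = cong₂ _∷_ (⊞-identityʳ x) (addAt-0 η v)
... | false = cong (x ∷_) (addAt-0 η v)

standard-≥ : ∀ ξ η (v : Vec 𝔽 n) → n ≤ η → standard ξ η v ≡ at v ξ ∷ v
standard-≥ ξ η v n≤η rewrite ≤⇒≮ᵇ n≤η = cong (at v ξ ∷_) (addAt-≥ (at v ξ) v n≤η)

-- `addAt η a` is a translation, so it moves to the other argument with the sign of `a` changed; 2
-- is -1.
ham-addAt : ∀ η a (u v : Vec 𝔽 n) → ham (addAt η a u) v ≡ ham u (addAt η (2′ ⊠ a) v)
ham-addAt η a []      []      = refl
ham-addAt {suc n} η a (x ∷ u) (y ∷ v) with η ≡ᵇ n
... | true  = cong₂ ℕ._+_ (miss-move x a y) (ham-addAt η a u v)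
  where
  miss-move : ∀ x a y → miss (x ⊞ a) y ≡ miss x (y ⊞ 2′ ⊠ a)
  miss-move = from-yes (all? λ x → all? λ a → all? λ y → miss (x ⊞ a) y ℕₚ.≟ miss x (y ⊞ 2′ ⊠ a))
... | false = cong (miss x y ℕ.+_) (ham-addAt η a u v)

entry : Pattern n → ℕ → Maybe 𝔽
-- The default agrees with `at`, which reads 0 outside the vector; for ξ ≥ n only one value is
-- tried.
entry []              i = just 0′
entry {suc n} (x ∷ p) i = if i ≡ᵇ n then x else entry p i

choices : Maybe 𝔽 → List 𝔽
choices nothing  = 0′ ∷ 1′ ∷ 2′ ∷ []
choices (just x) = x ∷ []

at∈choices : ∀ {p} {v : Vec 𝔽 n} i → Fits p v → at v i Membership.∈ choices (entry p i)
at∈choices i [] = here refl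
at∈choices {suc n} {v = x ∷ v} i (hole f) with i ≡ᵇ n
... | true  = ∈-trits x
... | false = at∈choices i f
at∈choices {suc n} i (by f) with i ≡ᵇ n
... | true  = here refl
... | false = at∈choices i f

fill : ℕ → 𝔽 → Pattern n → Pattern n
fill         i a []      = []
fill {suc n} i a (x ∷ p) = (if i ≡ᵇ n then just a else x) ∷ fill i a p

fits-fill : ∀ i a {p} {v : Vec 𝔽 n} → (i < n → at v i ≡ a) → Fits p v → Fits (fill i a p) v
fits-fill i a _  []       = []
fits-fill {suc n} i a eq (hole {x = x} {v} f) with i ℕₚ.≟ n
... | yes refl rewrite ≡ᵇ-refl i with refl ← eq ℕₚ.≤-refl = by (fits-fill i x (λ i<i → contradiction i<i (ℕₚ.<-irrefl refl)) f)
... | no  i≢n  rewrite ≢⇒≡ᵇ i≢n = hole (fits-fill i a (eq ∘ ℕₚ.m<n⇒m<1+n) f)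
fits-fill {suc n} i a eq (by {x = x} {v} f) with i ℕₚ.≟ n
... | yes refl rewrite ≡ᵇ-refl i with refl ← eq ℕₚ.≤-refl = by (fits-fill i x (λ i<i → contradiction i<i (ℕₚ.<-irrefl refl)) f)
... | no  i≢n  rewrite ≢⇒≡ᵇ i≢n = by (fits-fill i a (eq ∘ ℕₚ.m<n⇒m<1+n) f)

-- The ball of radius d + 1 around the vector with standard coordinates σ, cut down to the vectors
-- whose entry at ξ is a.
ball : ℕ → 𝔽 → ℕ → Vec 𝔽 (suc n) → Ball n
ball {n} η a d (y ∷ σ) = (if (if η <ᵇ n then 0′ else a) == y then suc d else d) , addAt η (2′ ⊠ a) σ

ball-sound : ∀ ξ η d (v : Vec 𝔽 n) σ → v ∈ᴮ ball η (at v ξ) d σ → ham (standard ξ η v) σ ≤ suc d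
ball-sound {n} ξ η d v (y ∷ σ) le rewrite ham-addAt η (at v ξ) v σ with (if η <ᵇ n then 0′ else at v ξ) == y
... | true  = le
... | false = s≤s le

-- Splits by the entry at ξ: for a fixed value `a`, the vectors close to a standard word form a ball
-- in F-coordinates, and `covers` applies. The radius is `suc d`, since a mismatch in the head
-- coordinate costs one and `ball` must not subtract from 0.
allNear : ℕ → ℕ → ℕ → Pattern n → List (Vec 𝔽 (suc n)) → (Vec 𝔽 n → Bool) → Bool
allNear ξ η d p σs q = all (λ a → covers (fill ξ a p) (List.map (ball η a d) σs) q) (choices (entry p ξ))

allNear-sound : ∀ ξ η d p σs q → T (allNear ξ η d p σs q) → (v : Vec 𝔽 n) → Fits p v →
  Any (λ σ → ham (standard ξ η v) σ ≤ suc d) σs ⊎ T (q v)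
allNear-sound ξ η d p σs q t v f = Sum.map₁ (λ h → Any.map (λ {σ} → ball-sound ξ η d v σ) (Anyₚ.map⁻ h))
  (covers-sound (List.map (ball η a d) σs) q (fits-fill ξ a (λ _ → refl) f) (All.lookup (all⁺ _ _ t) (at∈choices ξ f)))
  where a = at v ξ

abstract
  -- Abstract, so that type checking never unfolds distances of concrete codewords; what follows
  -- uses only the laws stated here.
  dst : ℕ → ℕ → Vec 𝔽 n → Vec 𝔽 n → ℕ
  dst ξ η u v = ham (standard ξ η u) (standard ξ η v)

  dst≡ham : ∀ ξ η (u v : Vec 𝔽 n) → dst ξ η u v ≡ ham (standard ξ η u) (standard ξ η v)
  dst≡ham ξ η u v = refl

  dst-⊕ : ∀ ξ η (u v z : Vec 𝔽 n) → dst ξ η (u ⊕ z) (v ⊕ z) ≡ dst ξ η u v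
  dst-⊕ ξ η u v z = trans (cong₂ ham (standard-⊕ ξ η u z) (standard-⊕ ξ η v z))
    (ham-⊕ (standard ξ η u) (standard ξ η v) (standard ξ η z))

  dst-refl : ∀ ξ η (u : Vec 𝔽 n) → dst ξ η u u ≡ 0
  dst-refl ξ η u = ham-refl (standard ξ η u)

  dst-sym : ∀ ξ η (u v : Vec 𝔽 n) → dst ξ η u v ≡ dst ξ η v u
  dst-sym ξ η u v = ham-sym (standard ξ η u) (standard ξ η v)

  dst-0∷ : ∀ ξ η (u v : Vec 𝔽 n) → dst ξ η (0′ ∷ u) (0′ ∷ v) ≡ dst ξ η u v
  dst-0∷ {n} ξ η u v rewrite at-0∷ u ξ | at-0∷ v ξ with ℕₚ.<-cmp η n
  ... | tri< η<n η≢n _ rewrite <⇒<ᵇ (ℕₚ.m<n⇒m<1+n η<n) | <⇒<ᵇ η<n | ≢⇒≡ᵇ η≢n = refl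
  ... | tri≈ _ refl _ rewrite <⇒<ᵇ (ℕₚ.n<1+n n) | ≤⇒≮ᵇ (ℕₚ.≤-refl {n}) | ≡ᵇ-refl n = refl
  ... | tri> _ η≢n n<η rewrite ≤⇒≮ᵇ n<η | ≤⇒≮ᵇ (ℕₚ.<⇒≤ n<η) | ≢⇒≡ᵇ η≢n = refl

  -- Once ξ and η both lie below n, a further entry is a standard coordinate on its own and does not
  -- affect the others.
  dst-∷ : ∀ ξ η → ξ < n → η < n → ∀ x y (u v : Vec 𝔽 n) → dst ξ η (x ∷ u) (y ∷ v) ≡ miss x y ℕ.+ dst ξ η u v
  dst-∷ {n} ξ η ξ<n η<n x y u v rewrite ≢⇒≡ᵇ (ℕₚ.<⇒≢ ξ<n) | <⇒<ᵇ (ℕₚ.m<n⇒m<1+n η<n) | <⇒<ᵇ η<n | ≢⇒≡ᵇ (ℕₚ.<⇒≢ η<n) = refl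

  close⇒dst : ∀ ξ η d (u v : Vec 𝔽 n) → T (close d (standard ξ η u) (standard ξ η v)) → dst ξ η u v ≤ d
  close⇒dst ξ η d u v = close-sound d (standard ξ η u) (standard ξ η v)

  ¬close⇒dst : ∀ ξ η d (u v : Vec 𝔽 n) → T (not (close d (standard ξ η u) (standard ξ η v))) → d < dst ξ η u v
  ¬close⇒dst ξ η d u v = close-complete d (standard ξ η u) (standard ξ η v)

-- Certifying that a code blocks all other vectors

module _ (ξ η : ℕ) where

  Greedy : Code n m k → Set
  Greedy {m = m} {k} C = (r : Vec 𝔽 m) (c : Vec 𝔽 k) →
    r ≡ 𝟎 ⊎ ∃ λ d → codeword C d ⊏ point C r c × dst ξ η (point C r c) (codeword C d) ≤ 5

  dst-translate : (C : Code n m k) (r : Vec 𝔽 m) (c c′ z : Vec 𝔽 k) →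
    dst ξ η (point C r (c ⊕ z)) (codeword C (c′ ⊕ z)) ≡ dst ξ η (point C r c) (codeword C c′)
  dst-translate C r c c′ z = trans (cong₂ (dst ξ η)
    (trans (cong (λ r → point C r (c ⊕ z)) (sym (⊕-identityʳ r))) (point-⊕ C r 𝟎 c z))
    (codeword-⊕ C c′ z)) (dst-⊕ ξ η (point C r c) (codeword C c′) (codeword C z))

  -- Codewords have 0 at a free coordinate, so every codeword is smaller than a vector led by
  -- `suc x` and only the distance matters. Distances are invariant under adding a codeword to both
  -- sides, so one vector per coset is enough.
  greedy-free : (C : Code n m k) → Greedy C →
    (∀ x r → ∃ λ d → dst ξ η (point (free C) (suc x ∷ r) 𝟎) (codeword (free C) d) ≤ 5) → Greedy (free C)
  greedy-free C g near (0′ ∷ r) c = Sum.map (cong (0′ ∷_))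
    (λ (d , lt , le) → d , ⊏-tail lt , subst (_≤ 5) (sym (dst-0∷ ξ η (point C r c) (codeword C d))) le) (g r c)
  greedy-free C g near (suc x ∷ r) c = let d , le = near x r in inj₂ (d ⊕ c
    , ⊏-head (s≤s z≤n)
    , subst (λ z → dst ξ η (point (free C) (suc x ∷ r) z) (codeword (free C) (d ⊕ c)) ≤ 5) (⊕-identityˡ c)
        (subst (_≤ 5) (sym (dst-translate (free C) (suc x ∷ r) 𝟎 d c)) le))

  ball-near : (C : Code n m k) (d : ℕ) {v : Vec 𝔽 n} →
    Any (λ σ → ham (standard ξ η v) σ ≤ d) (image (standard ξ η ∘ codeword C)) → ∃ λ c → dst ξ η v (codeword C c) ≤ d
  ball-near C d {v} h = let c , le = Any.satisfied (Anyₚ.map⁻ h) in c , subst (_≤ d) (sym (dst≡ham ξ η v (codeword C c))) le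

  -- The radius tested is `suc d`: the argument 4 stands for distance 5, and 2 for the covering
  -- radius 3.
  allNearCode : ℕ → Code n m k → Pattern n → Bool
  allNearCode d C p = allNear ξ η d p (image (standard ξ η ∘ codeword C)) λ _ → false

  allNearCode-sound : ∀ d (C : Code n m k) p → T (allNearCode d C p) → ∀ v → Fits p v → ∃ λ c → dst ξ η v (codeword C c) ≤ suc d
  allNearCode-sound d C p t v f =
    Sum.[ ball-near C (suc d) , (λ ()) ]′ (allNear-sound ξ η d p (image (standard ξ η ∘ codeword C)) (λ _ → false) t v f)

  closeTo : Vec 𝔽 n → Vec 𝔽 k × Vec 𝔽 n → Bool
  closeTo ρ (_ , σ) = close 5 ρ σ

  isDrop : Code (suc n) m k → List (Vec 𝔽 j × Vec 𝔽 (suc (suc n))) → Vec 𝔽 m → Vec 𝔽 k → Bool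
  isDrop L σs r c = any (closeTo (standard ξ η (point L r c))) σs

  blocks : Code n m k → Vec 𝔽 m → Vec 𝔽 n → Vec 𝔽 (suc (suc n)) → Vec 𝔽 k → Vec 𝔽 k × Vec 𝔽 (suc (suc n)) → Bool
  blocks C b x ρ c (d , σ) = close 5 ρ σ ∧ (rank (point C b (d ⊕ c)) <ᵇ rank x)

  isBlocked : Code n m k → List (Vec 𝔽 k × Vec 𝔽 (suc (suc n))) → Vec 𝔽 m → Vec 𝔽 m → Vec 𝔽 (suc (suc n)) → Bool
  isBlocked {k = k} C σs b r ρ = all (λ c → any (blocks C b (point C (b ⊕ r) c) ρ c) σs) (vecs k)

  isLeadOK : (b : Vec 𝔽 m) (C : Code n m k) → List (Vec 𝔽 k × Vec 𝔽 (suc (suc n))) → Vec 𝔽 m → Bool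
  isLeadOK b C σs r = isZero r ∨
    (isBlocked C σs (1′ ⊙ b) r (standard ξ η (0′ ∷ point C r 𝟎)) ∧
      (isDrop (lead b C) σs r (2′ ∷ 𝟎) ∨ isBlocked C σs (2′ ⊙ b) r (standard ξ η (0′ ∷ point C r 𝟎))))

  -- The distance tests need the standard coordinates of a codeword, the order test its message `d`;
  -- both are tabulated once for all cosets.
  sheet : Vec 𝔽 m → Code n m k → List (Vec 𝔽 k × Vec 𝔽 (suc (suc n)))
  sheet b C = image λ d → d , standard ξ η (codeword (lead b C) (0′ ∷ d))

  -- The vector reached is `point (lead b C) r (1′ ∷ 𝟎)`, whose free entries are b + r; subtracting
  -- `b` recovers the coset `r`.
  uncovered : (b : Vec 𝔽 m) (C : Code n m k) → Vec 𝔽 (suc n) → Bool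
  uncovered b C v = isLeadOK b C (sheet b C) (2′ ⊙ b ⊕ rep (lead b C) v)

  isGreedy : Code n m k → Bool
  isGreedy [] = true
  isGreedy (free C) = isGreedy C ∧
    allNearCode 4 (free C) (just 1′ ∷ rep-pattern C) ∧ allNearCode 4 (free C) (just 2′ ∷ rep-pattern C)
  isGreedy (lead b C) = isGreedy C ∧
    allNear ξ η 4 (just 1′ ∷ rep-pattern C) (image λ d → standard ξ η (codeword (lead b C) (0′ ∷ d))) (uncovered b C)

  module _ (b : Vec 𝔽 m) (C : Code n m k) where

    -- Adding the codeword with message s′ ∷ c to both sides gives a codeword led by s′ close to a
    -- coset element led by t + s′. It is smaller whenever s′ < t + s′, that is, when the sum does
    -- not wrap around modulo 3.
    Drop : Vec 𝔽 m → 𝔽 → Set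
    Drop r t = ∃ λ d → dst ξ η (point (lead b C) r (t ∷ 𝟎)) (codeword (lead b C) (0′ ∷ d)) ≤ 5

    -- Here the blocking codeword has the same leading entry `s`, so the tails decide the order. By
    -- translation the distance condition depends on neither `s` nor `c`, but the order does, hence
    -- `d` may vary with `c`.
    Blocked : Vec 𝔽 m → 𝔽 → Set
    Blocked r s = ∀ c → ∃ λ d → point C (s ⊙ b) (d ⊕ c) ⊏ point C (s ⊙ b ⊕ r) c
                              × dst ξ η (point C r 𝟎) (codeword C d) ≤ 5

    zero-shift : ∀ r → 0′ ⊙ b ⊕ r ≡ r
    zero-shift r = trans (cong (_⊕ r) (⊙-zeroˡ b)) (⊕-identityˡ r)

    codeword-lead-0 : ∀ d → codeword (lead b C) (0′ ∷ d) ≡ 0′ ∷ codeword C d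
    codeword-lead-0 d = cong (λ r → 0′ ∷ point C r d) (zero-shift 𝟎)

    codeword-lead : ∀ s d → codeword (lead b C) (s ∷ d) ≡ s ∷ point C (s ⊙ b) d
    codeword-lead s d = cong (λ r → s ∷ point C r d) (⊕-identityʳ (s ⊙ b))

    drop-sound : ∀ r t → T (isDrop (lead b C) (sheet b C) r (t ∷ 𝟎)) → Drop r t
    drop-sound r t h = let d , c = any-image (closeTo (standard ξ η (point (lead b C) r (t ∷ 𝟎)))) _ h in
      d , close⇒dst ξ η 5 (point (lead b C) r (t ∷ 𝟎)) (codeword (lead b C) (0′ ∷ d)) c

    isBlocked-sound : ∀ r s → T (isBlocked C (sheet b C) (s ⊙ b) r (standard ξ η (0′ ∷ point C r 𝟎))) → Blocked r s
    isBlocked-sound r s h c =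
      let d , h′ = any-image _ _ (all-vecs _ h c)
          near , lt = ∧⁻ {close 5 (standard ξ η (0′ ∷ point C r 𝟎)) (standard ξ η (codeword (lead b C) (0′ ∷ d)))} h′
      in d , by-rank (ℕₚ.<ᵇ⇒< _ _ lt)
       , subst (_≤ 5) (trans (cong (dst ξ η (0′ ∷ point C r 𝟎)) (codeword-lead-0 d)) (dst-0∷ ξ η _ _))
           (close⇒dst ξ η 5 (0′ ∷ point C r 𝟎) (codeword (lead b C) (0′ ∷ d)) near)

    drop : ∀ r c t s′ → Drop r (suc t) → toℕ s′ < toℕ (suc t ⊞ s′) →
           ∃ λ d → codeword (lead b C) d ⊏ (point (lead b C) r ((suc t ⊞ s′) ∷ c))
                 × dst ξ η (point (lead b C) r ((suc t ⊞ s′) ∷ c)) (codeword (lead b C) d) ≤ 5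
    drop r c t s′ (d , le) s′< = s′ ∷ (d ⊕ c) , ⊏-head s′<
      , subst (λ z → dst ξ η (point (lead b C) r ((suc t ⊞ s′) ∷ z)) (codeword (lead b C) (s′ ∷ (d ⊕ c))) ≤ 5) (⊕-identityˡ c)
          (subst (_≤ 5) (sym (dst-translate (lead b C) r (suc t ∷ 𝟎) (0′ ∷ d) (s′ ∷ c))) le)

    blocked : ∀ r c s → Blocked r s →
           ∃ λ d → codeword (lead b C) d ⊏ (point (lead b C) r (s ∷ c))
                 × dst ξ η (point (lead b C) r (s ∷ c)) (codeword (lead b C) d) ≤ 5
    blocked r c s bl = let d , lt , le = bl c in
      s ∷ (d ⊕ c)
      , subst (λ y → y ⊏ (point (lead b C) r (s ∷ c))) (sym (codeword-lead s (d ⊕ c))) (⊏-tail lt)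
      , subst (λ z → dst ξ η (point (lead b C) r (s ∷ z)) (codeword (lead b C) (s ∷ (d ⊕ c))) ≤ 5) (⊕-identityˡ c)
          (subst (_≤ 5) (sym (dst-translate (lead b C) r (0′ ∷ 𝟎) (0′ ∷ d) (s ∷ c)))
            (subst (_≤ 5) (sym (trans (cong₂ (dst ξ η) (cong (λ r → 0′ ∷ point C r 𝟎) (zero-shift r)) (codeword-lead-0 d)) (dst-0∷ ξ η _ _))) le))

    -- `Drop r 1′` serves both nonzero leading entries, 1 = 1 + 0 and 2 = 1 + 1, whereas `Drop r 2′`
    -- serves only 2 = 2 + 0. Without the former, the entry 1 has to be blocked within its own
    -- level.
    greedy-lead : Greedy C → (∀ r → r ≡ 𝟎 ⊎ Drop r 1′ ⊎ (Blocked r 1′ × (Drop r 2′ ⊎ Blocked r 2′))) → Greedy (lead b C)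
    greedy-lead g ok r (0′ ∷ c) rewrite zero-shift r = Sum.map id
      (λ (d , lt , le) → 0′ ∷ d
        , subst (λ y → y ⊏ (0′ ∷ point C r c)) (sym (codeword-lead-0 d)) (⊏-tail lt)
        , subst (_≤ 5) (sym (trans (cong (dst ξ η (0′ ∷ point C r c)) (codeword-lead-0 d)) (dst-0∷ ξ η _ _))) le)
      (g r c)
    greedy-lead g ok r (1′ ∷ c) with ok r
    ... | inj₁ r≡𝟎                  = inj₁ r≡𝟎
    ... | inj₂ (inj₁ dr)            = inj₂ (drop r c zero 0′ dr (s≤s z≤n))
    ... | inj₂ (inj₂ (bl , _))      = inj₂ (blocked r c 1′ bl)
    greedy-lead g ok r (2′ ∷ c) with ok r
    ... | inj₁ r≡𝟎                  = inj₁ r≡𝟎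
    ... | inj₂ (inj₁ dr)            = inj₂ (drop r c zero 1′ dr (s≤s (s≤s z≤n)))
    ... | inj₂ (inj₂ (_ , inj₁ dr)) = inj₂ (drop r c 1′ 0′ dr (s≤s z≤n))
    ... | inj₂ (inj₂ (_ , inj₂ bl)) = inj₂ (blocked r c 2′ bl)

  isGreedy-sound : (C : Code n m k) → T (isGreedy C) → Greedy C
  isGreedy-sound [] _ [] [] = inj₁ refl
  isGreedy-sound (free C) t = greedy-free C (isGreedy-sound C (proj₁ (∧⁻ t))) near
    where
    checked = ∧⁻ {allNearCode 4 (free C) (just 1′ ∷ rep-pattern C)} (proj₂ (∧⁻ {isGreedy C} t))
    near : ∀ x r → ∃ λ d → dst ξ η (point (free C) (suc x ∷ r) 𝟎) (codeword (free C) d) ≤ 5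
    near 0′ r = allNearCode-sound 4 (free C) _ (proj₁ checked) _ (by (fits-rep C r))
    near 1′ r = allNearCode-sound 4 (free C) _ (proj₂ checked) _ (by (fits-rep C r))
  isGreedy-sound {m = m} (lead b C) t = greedy-lead b C (isGreedy-sound C (proj₁ (∧⁻ t))) λ r → ok r
    (allNear-sound ξ η 4 (just 1′ ∷ rep-pattern C) (image λ d → standard ξ η (codeword (lead b C) (0′ ∷ d))) (uncovered b C)
      (proj₂ (∧⁻ {isGreedy C} t)) (point (lead b C) r (1′ ∷ 𝟎)) (by (fits-rep C (1′ ⊙ b ⊕ r))))
    where
    ok : ∀ r → Any (λ σ → ham (standard ξ η (point (lead b C) r (1′ ∷ 𝟎))) σ ≤ 5) (image λ d → standard ξ η (codeword (lead b C) (0′ ∷ d)))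
             ⊎ T (uncovered b C (point (lead b C) r (1′ ∷ 𝟎))) →
         r ≡ 𝟎 ⊎ Drop b C r 1′ ⊎ (Blocked b C r 1′ × (Drop b C r 2′ ⊎ Blocked b C r 2′))
    ok r (inj₁ h) = let d , le = Any.satisfied (Anyₚ.map⁻ h) in
      inj₂ (inj₁ (d , subst (_≤ 5) (sym (dst≡ham ξ η (point (lead b C) r (1′ ∷ 𝟎)) (codeword (lead b C) (0′ ∷ d)))) le))
    ok r (inj₂ t) = blocks-or-zero (subst (T ∘ isLeadOK b C (sheet b C)) (trans (cong (2′ ⊙ b ⊕_) (rep-point C (1′ ⊙ b ⊕ r))) (back b r)) t)
      where
      back : (b r : Vec 𝔽 j) → 2′ ⊙ b ⊕ (1′ ⊙ b ⊕ r) ≡ r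
      back = ⊕-cancel 2′
      blocks-or-zero : T (isLeadOK b C (sheet b C) r) → r ≡ 𝟎 ⊎ Drop b C r 1′ ⊎ (Blocked b C r 1′ × (Drop b C r 2′ ⊎ Blocked b C r 2′))
      blocks-or-zero t with ∨⁻ {isZero r} t
      ... | inj₁ z = inj₁ (isZero⇒≡𝟎 r z)
      ... | inj₂ t = let bl , t′ = ∧⁻ {isBlocked C (sheet b C) (1′ ⊙ b) r (standard ξ η (0′ ∷ point C r 𝟎))} t in
        inj₂ (inj₂ (isBlocked-sound b C r 1′ bl , Sum.map (drop-sound b C r 2′) (isBlocked-sound b C r 2′) (∨⁻ t′)))

  isSpaced : Code n m k → Bool
  isSpaced {k = k} C = all (λ c → isZero c ∨ not (close 5 (standard ξ η 𝟎) (standard ξ η (codeword C c)))) (vecs k)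

  isCovering : Code n m k → Bool
  isCovering C = allNearCode 2 C (rep-pattern C)

  isFarFrom : List (Vec 𝔽 (suc n)) → Vec 𝔽 (suc n) → Bool
  isFarFrom σs ρ = all (λ σ → not (close 5 ρ σ)) σs

  isFar : Code n m k → Vec 𝔽 n → Bool
  isFar C u = isFarFrom (image (standard ξ η ∘ codeword (free C))) (standard ξ η (1′ ∷ u))

  isLaterFar : Code n m k → Vec 𝔽 n → Vec 𝔽 n → Bool
  isLaterFar {k = k} C u x = all (λ c → (rank x <ᵇ rank (u ⊕ codeword C c)) ∨
    not (close 5 (standard ξ η (0′ ∷ x)) (standard ξ η (0′ ∷ u ⊕ codeword C c)))) (vecs k)

-- The numeral is read digit by digit, without conversion of base, and padded with zeros on the left
-- to length n.
decimal : ∀ n → ℕ → Vec 𝔽 n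
decimal zero    x = []
decimal (suc n) x = trit (DivMod._/_ x (10 ℕ.^ n) {{ℕₚ.m^n≢0 10 n}} DivMod.% 10) ∷ decimal n x
  where
  trit : ℕ → 𝔽
  trit 0 = 0′
  trit 1 = 1′
  trit _ = 2′

infixr 5 _▸_ _↑_

_▸_ : ℕ → Code n m k → Code (suc n) m (suc k)
b ▸ C = lead (decimal _ b) C

_↑_ : ∀ j → Code n m k → Code (j ℕ.+ n) (j ℕ.+ m) k
zero  ↑ C = C
suc j ↑ C = free (j ↑ C)

-- The `j` top entries are prescribed to be 1: one in general, three for the Golay code, whose first
-- far vector has ones at the coordinates 12, 13 and 14.
isFirst : ℕ → ℕ → ∀ j → Code n m k → Vec 𝔽 n → Bool
isFirst ξ η j C u = all (λ p → allNearCode ξ η 4 (j ↑ C) (replicate j (just 1′) ++ p)) (before u)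

-- Finite vectors as sequences, and their distances

open RawLeftModule 𝔽^ℕ-module using (_+ᴹ_; _*ₗ_; 0ᴹ)
private module 𝔽ᵣ = CommutativeRing 𝔽-commutativeRing

sequence : Vec 𝔽 n → 𝔽^ℕ
sequence {n} v = record { coord = at v ; bound = n ; vanishing = at-≥ v }

restrict : ∀ n → (ℕ → 𝔽) → Vec 𝔽 n
restrict zero    f = []
restrict (suc n) f = f n ∷ restrict n f

at-restrict : ∀ n f {i} → i < n → at (restrict n f) i ≡ f i
at-restrict (suc n) f {i} i<1+n with i ℕₚ.≟ n
... | yes refl = at-top (f n) (restrict n f)
... | no  i≢n  = let i<n = ℕₚ.≤∧≢⇒< (ℕ.s≤s⁻¹ i<1+n) i≢n in
  trans (at-below (f n) (restrict n f) i<n) (at-restrict n f i<n)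

restrict-⊏ : ∀ n f (v : Vec 𝔽 n) {N} → N < n → f N Fin.< at v N →
             (∀ i → N < i → i < n → f i ≡ at v i) → restrict n f ⊏ v
restrict-⊏ (suc n) f (x ∷ v) {N} N<1+n lt above with N ℕₚ.≟ n
... | yes refl = ⊏-head (subst (f n Fin.<_) (at-top x v) lt)
... | no  N≢n  = let N<n = ℕₚ.≤∧≢⇒< (ℕ.s≤s⁻¹ N<1+n) N≢n in
  subst (λ y → (y ∷ restrict n f) ⊏ (x ∷ v)) (sym (trans (above n N<n ℕₚ.≤-refl) (at-top x v)))
    (⊏-tail (restrict-⊏ n f v N<n (subst (f N Fin.<_) (at-below x v N<n) lt)
      λ i N<i i<n → trans (above i N<i (ℕₚ.m<n⇒m<1+n i<n)) (at-below x v i<n)))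

dist-sym : ∀ x y → dist x y ≡ dist y x
dist-sym x y = trans (cong (countBelow (differ? x y)) (ℕₚ.⊔-comm (bound x) (bound y)))
  (countBelow-cong (differ? x y) (differ? y x) (_∘ sym) (_∘ sym) (bound y ⊔ bound x))

dist-cong : ∀ {x x′ y y′} → x ≈ x′ → y ≈ y′ → dist x y ≡ dist x′ y′
dist-cong {x} {x′} {y} {y′} x≈x′ y≈y′ = trans (dist-congˡ x x′ y x≈x′)
  (trans (dist-sym x′ y) (trans (dist-congˡ y y′ x′ y≈y′) (dist-sym y′ x′)))

count≡ham : ∀ x y (u v : Vec 𝔽 n) → (∀ {i} → i < n → coord x i ≡ at u i) → (∀ {i} → i < n → coord y i ≡ at v i) →
            countBelow (differ? x y) n ≡ ham u v
count≡ham x y [] [] _ _ = refl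
count≡ham {suc n} x y (a ∷ u) (b ∷ v) eqx eqy = extend (a Finₚ.≟ b)
  where
  x-top : coord x n ≡ a
  x-top = trans (eqx ℕₚ.≤-refl) (at-top a u)
  y-top : coord y n ≡ b
  y-top = trans (eqy ℕₚ.≤-refl) (at-top b v)
  ih : countBelow (differ? x y) n ≡ ham u v
  ih = count≡ham x y u v (λ i<n → trans (eqx (ℕₚ.m<n⇒m<1+n i<n)) (at-below a u i<n))
                         (λ i<n → trans (eqy (ℕₚ.m<n⇒m<1+n i<n)) (at-below b v i<n))
  extend : Dec (a ≡ b) → countBelow (differ? x y) (suc n) ≡ miss a b ℕ.+ ham u v
  extend (yes refl) = trans (countBelow-reject (differ? x y) n λ ne → ne (trans x-top (sym y-top)))
                            (trans ih (cong (ℕ._+ ham u v) (sym (miss-refl a))))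
  extend (no a≢b)   = trans (countBelow-accept (differ? x y) n λ eq → a≢b (trans (sym x-top) (trans eq y-top)))
                            (trans (cong suc ih) (cong (ℕ._+ ham u v) (sym (miss-≢ a b a≢b))))

dist≡count : ∀ x y n → (∀ {i} → n ≤ i → coord x i ≡ coord y i) → dist x y ≡ countBelow (differ? x y) n
dist≡count x y n beyond = trans (sym (count≡dist x y (bound x ⊔ bound y ℕ.+ n) (ℕₚ.m≤m+n _ n)))
  (countBelow-stable (differ? x y) n (λ n≤i ne → ne (beyond n≤i)) (bound x ⊔ bound y))

dist≡ham : ∀ x y (u v : Vec 𝔽 n) → (∀ i → coord x i ≡ at u i) → (∀ i → coord y i ≡ at v i) → dist x y ≡ ham u v
dist≡ham {n} x y u v eqx eqy = trans
  (dist≡count x y n λ n≤i → trans (eqx _) (trans (at-≥ u n≤i) (sym (trans (eqy _) (at-≥ v n≤i)))))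
  (count≡ham x y u v (λ {i} _ → eqx i) (λ {i} _ → eqy i))

-- Appends the entries of index n, …, η to a vector of length n, all zero but the last.
extend : ∀ j → 𝔽 → Vec 𝔽 n → Vec 𝔽 (suc (j ℕ.+ n))
extend j a v = a ∷ (replicate j 0′ ++ v)

ham-replicate : ∀ j (u v : Vec 𝔽 n) → ham (replicate j 0′ ++ u) (replicate j 0′ ++ v) ≡ ham u v
ham-replicate zero    u v = refl
ham-replicate (suc j) u v = ham-replicate j u v

at-replicate : ∀ j (v : Vec 𝔽 n) i → at (replicate j 0′ ++ v) i ≡ at v i
at-replicate zero    v i = refl
at-replicate (suc j) v i = trans (at-0∷ (replicate j 0′ ++ v) i) (at-replicate j v i)

at-addAt : ∀ η a (v : Vec 𝔽 n) → η < n → ∀ i → at (addAt η a v) i ≡ at v i + a * δ η i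
at-addAt {suc n} η a (x ∷ v) η<1+n i with η ℕₚ.≟ n
at-addAt {suc n} η a (x ∷ v) η<1+n i | yes refl with i ℕₚ.≟ n
... | yes refl rewrite ≡ᵇ-refl n = trans (⊞≡+ x a) (cong (x +_) (sym (𝔽ᵣ.*-identityʳ a)))
... | no  i≢n  rewrite ≢⇒≡ᵇ i≢n | ≢⇒≡ᵇ (i≢n ∘ sym) | addAt-≥ a v (ℕₚ.≤-refl {n}) = sym (+-0 (at v i) a)
at-addAt {suc n} η a (x ∷ v) η<1+n i | no η≢n with i ℕₚ.≟ n
... | yes refl rewrite ≡ᵇ-refl n | ≢⇒≡ᵇ η≢n = sym (+-0 x a)
... | no  i≢n  rewrite ≢⇒≡ᵇ i≢n = at-addAt η a v (ℕₚ.≤∧≢⇒< (ℕ.s≤s⁻¹ η<1+n) η≢n) i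

at-extend : ∀ j a (v : Vec 𝔽 n) i → at (extend j a v) i ≡ at v i + a * δ (j ℕ.+ n) i
at-extend {n} j a v i with i ℕₚ.≟ j ℕ.+ n
... | yes refl rewrite ≡ᵇ-refl (j ℕ.+ n) | at-≥ v (ℕₚ.m≤n+m n j) = sym (trans (𝔽ᵣ.+-identityˡ (a * 1#)) (𝔽ᵣ.*-identityʳ a))
... | no  i≢   rewrite ≢⇒≡ᵇ i≢ | ≢⇒≡ᵇ (i≢ ∘ sym) = trans (at-replicate j v i) (sym (+-0 (at v i) a))

-- For η < n all standard coordinates lie below n. Otherwise those from n to η - 1 vanish, so only
-- the single coordinate η is added, which `standard` keeps in its head.
dist≡dst : ∀ ξ η x y (u v : Vec 𝔽 n) →
  (∀ i → coord x i ≡ at u i + at u ξ * δ η i) → (∀ i → coord y i ≡ at v i + at v ξ * δ η i) → dist x y ≡ dst ξ η u v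
dist≡dst {n} ξ η x y u v eqx eqy with η ℕₚ.<? n
... | yes η<n = trans (dist≡ham x y (addAt η (at u ξ) u) (addAt η (at v ξ) v)
  (λ i → trans (eqx i) (sym (at-addAt η (at u ξ) u η<n i))) (λ i → trans (eqy i) (sym (at-addAt η (at v ξ) v η<n i))))
  (sym (trans (dst≡ham ξ η u v) (heads η<n)))
  where
  heads : η < n → ham (standard ξ η u) (standard ξ η v) ≡ ham (addAt η (at u ξ) u) (addAt η (at v ξ) v)
  heads η<n rewrite <⇒<ᵇ η<n = refl
... | no  η≮n with ℕₚ.m≤n⇒∃[o]m+o≡n (ℕₚ.≮⇒≥ η≮n)
...   | j , n+j≡η with refl ← trans (ℕₚ.+-comm j n) n+j≡η = trans
  (dist≡ham x y (extend j (at u ξ) u) (extend j (at v ξ) v)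
    (λ i → trans (eqx i) (sym (at-extend j (at u ξ) u i))) (λ i → trans (eqy i) (sym (at-extend j (at v ξ) v i))))
  (trans (cong (miss (at u ξ) (at v ξ) ℕ.+_) (ham-replicate j u v))
    (sym (trans (dst≡ham ξ (j ℕ.+ n) u v)
      (cong₂ ham (standard-≥ ξ (j ℕ.+ n) u (ℕₚ.m≤n+m n j)) (standard-≥ ξ (j ℕ.+ n) v (ℕₚ.m≤n+m n j))))))

-- An index beyond the vectors contributes one extra coordinate equal to the entry at ξ. This makes
-- η = 10 represent all η ≥ 10.
dst-irrelevant : ∀ ξ {η η′} (u v : Vec 𝔽 n) → n ≤ η → n ≤ η′ → dst ξ η u v ≡ dst ξ η′ u v
dst-irrelevant ξ {η} {η′} u v n≤η n≤η′ = trans (dst≡ham ξ η u v) (trans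
  (cong₂ ham (trans (standard-≥ ξ η u n≤η) (sym (standard-≥ ξ η′ u n≤η′)))
             (trans (standard-≥ ξ η v n≤η) (sym (standard-≥ ξ η′ v n≤η′))))
  (sym (dst≡ham ξ η′ u v)))

-- Linear combinations of basis vectors

module _ (B : OrderedBasis) where

  combination : Vec 𝔽 n → 𝔽^ℕ
  combination v = expand (vector B) (sequence v)

  combination-⊕ : (u v : Vec 𝔽 n) → combination (u ⊕ v) ≈ (combination u +ᴹ combination v)
  combination-⊕ {n} u v j = begin
    coord (combination (u ⊕ v)) j                                 ≡⟨ coord-expand f (sequence (u ⊕ v)) j ⟩
    sumBelow n (λ i → at (u ⊕ v) i * g i)                          ≡⟨ sumBelow-cong n (λ i → cong (_* g i) (trans (at-⊕ u v i) (⊞≡+ (at u i) (at v i)))) ⟩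
    sumBelow n (λ i → (at u i + at v i) * g i)                     ≡⟨ sumBelow-cong n (λ i → 𝔽ᵣ.distribʳ (g i) (at u i) (at v i)) ⟩
    sumBelow n (λ i → at u i * g i + at v i * g i)                 ≡⟨ sumBelow-+ n (λ i → at u i * g i) (λ i → at v i * g i) ⟩
    sumBelow n (λ i → at u i * g i) + sumBelow n (λ i → at v i * g i)
      ≡⟨ cong₂ _+_ (coord-expand f (sequence u) j) (coord-expand f (sequence v) j) ⟨
    coord (combination u) j + coord (combination v) j              ∎
    where
    open ≡-Reasoning
    f = vector B
    g = λ i → coord (f i) j

  combination-⊙ : ∀ s (v : Vec 𝔽 n) → combination (s ⊙ v) ≈ (s *ₗ combination v)
  combination-⊙ {n} s v j = begin
    coord (combination (s ⊙ v)) j              ≡⟨ coord-expand f (sequence (s ⊙ v)) j ⟩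
    sumBelow n (λ i → at (s ⊙ v) i * g i)       ≡⟨ sumBelow-cong n (λ i → trans (cong (_* g i) (trans (at-⊙ s v i) (trans (⊠≡* s (at v i)) (𝔽ᵣ.*-comm s (at v i))))) (swap (at v i) s (g i))) ⟩
    sumBelow n (λ i → at v i * g i * s)         ≡⟨ sumBelow-* n (λ i → at v i * g i) s ⟩
    sumBelow n (λ i → at v i * g i) * s         ≡⟨ 𝔽ᵣ.*-comm _ s ⟩
    s * sumBelow n (λ i → at v i * g i)         ≡⟨ cong (s *_) (coord-expand f (sequence v) j) ⟨
    s * coord (combination v) j                ∎
    where
    open ≡-Reasoning
    f = vector B
    g = λ i → coord (f i) j
    swap : ∀ a s b → a * s * b ≡ a * b * s
    swap a s b = trans (𝔽ᵣ.*-assoc a s b) (trans (cong (a *_) (𝔽ᵣ.*-comm s b)) (sym (𝔽ᵣ.*-assoc a b s)))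

  combination-injective : (u v : Vec 𝔽 n) → combination u ≈ combination v → u ≡ v
  combination-injective u v eq = at-injective u v λ i →
    trans (unique B (sequence u) (combination v) eq i) (sym (unique B (sequence v) (combination v) (λ _ → refl) i))

  -- At the top difference `v` has a positive entry, so that index is below n, and beyond n both
  -- sequences vanish. Hence a greedy choice below a vector of length n is itself such a vector.
  <-combination : ∀ {z} (v : Vec 𝔽 n) → z <[ B ] combination v → ∃ λ u → u ⊏ v × z ≈ combination u
  <-combination {n} {z} v (N , lt , above) = u , u⊏v , z≈u
    where
    c = coord (coordinates B z)
    u = restrict n c
    coords : ∀ i → coord (coordinates B (combination v)) i ≡ at v i
    coords i = sym (unique B (sequence v) (combination v) (λ _ → refl) i)
    N<n : N < n
    N<n = ℕₚ.≰⇒> λ n≤N → ℕₚ.n≮0 (subst (c N Fin.<_) (trans (coords N) (at-≥ v n≤N)) lt)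
    u⊏v : u ⊏ v
    u⊏v = restrict-⊏ n c v N<n (subst (c N Fin.<_) (coords N) lt) λ i N<i _ → trans (above i N<i) (coords i)
    c≈u : ∀ i → c i ≡ at u i
    c≈u i = compare (i ℕₚ.<? n)
      where
      compare : Dec (i < n) → c i ≡ at u i
      compare (yes i<n) = sym (at-restrict n c i<n)
      compare (no  i≮n) = let n≤i = ℕₚ.≮⇒≥ i≮n in
        trans (above i (ℕₚ.<-≤-trans N<n n≤i)) (trans (coords i) (trans (at-≥ v n≤i) (sym (at-≥ u n≤i))))
    z≈u : z ≈ combination u
    z≈u i = trans (sym (expansion B z i)) (expand-cong (vector B) {coordinates B z} {sequence u} c≈u i)

-- The greedy algorithm: which vectors are selected

w-far : ∀ B {a b} → b < a → 6 ≤ dist (w B 6 a) (w B 6 b)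
w-far B {a} {b} b<a = proj₁ (w-minimum B 6 a) b b<a

w-least : ∀ B a x → (∀ b → b < a → 6 ≤ dist x (w B 6 b)) → w B 6 a ≈ x ⊎ w B 6 a <[ B ] x
w-least B a x = proj₂ (w-minimum B 6 a) x

-- A record, so that this type does not unfold under with-abstraction.
record Isometric (B : OrderedBasis) (ξ η n : ℕ) : Set where
  constructor isometric
  field dist≡ : (u v : Vec 𝔽 n) → dist (combination B u) (combination B v) ≡ dst ξ η u v

open Isometric

-- Vectors have one entry more than `C` and codewords get a 0 on top; the extra place carries the
-- leading 1 of the vectors in `Obstructed`.
module Lexicode (B : OrderedBasis) (ξ η : ℕ) (C : Code n m k)
  (link : Isometric B ξ η (suc n))
  (spaced : ∀ c → c ≢ 𝟎 → 6 ≤ dst ξ η 𝟎 (codeword C c))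
  (greedy : Greedy ξ η C) where

  private
    ⟦_⟧ : Vec 𝔽 (suc n) → 𝔽^ℕ
    ⟦_⟧ = combination B

    d[_,_] : Vec 𝔽 j → Vec 𝔽 j → ℕ
    d[_,_] = dst ξ η

  word : Vec 𝔽 k → Vec 𝔽 (suc n)
  word = codeword (free C)

  word-injective : ∀ {c d} → word c ≡ word d → c ≡ d
  word-injective {c} {d} = point-injective (free C) 𝟎 c d

  codeword-spaced : ∀ c d → c ≢ d → 6 ≤ d[ codeword C c , codeword C d ]
  codeword-spaced c d c≢d = subst (6 ≤_) shift (spaced (d ⊕ 2′ ⊙ c) λ eq → c≢d (sym (trans (⊕-move d c 𝟎 eq) (⊕-identityʳ c))))
    where
    shift : d[ 𝟎 , codeword C (d ⊕ 2′ ⊙ c) ] ≡ d[ codeword C c , codeword C d ]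
    shift = trans (sym (dst-⊕ ξ η 𝟎 (codeword C (d ⊕ 2′ ⊙ c)) (codeword C c)))
      (cong₂ d[_,_] (⊕-identityˡ (codeword C c)) (trans (sym (codeword-⊕ C (d ⊕ 2′ ⊙ c) c))
        (cong (codeword C) (trans (⊕-comm (d ⊕ 2′ ⊙ c) c) (sym (⊕-move d c (d ⊕ 2′ ⊙ c) refl))))))

  word-spaced : ∀ c d → c ≢ d → 6 ≤ d[ word c , word d ]
  word-spaced c d c≢d = subst (6 ≤_) (sym (dst-0∷ ξ η (codeword C c) (codeword C d))) (codeword-spaced c d c≢d)

  record Selected (a : ℕ) (v : Vec 𝔽 (suc n)) : Set where
    constructor selects
    field w≈ : w B 6 a ≈ ⟦ v ⟧

  open Selected

  selected-unique : ∀ {a u v} → Selected a u → Selected a v → u ≡ v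
  selected-unique {u = u} {v} (selects su) (selects sv) = combination-injective B u v λ i → trans (sym (su i)) (sv i)

  dist-selected : ∀ {a v} u → Selected a v → dist ⟦ u ⟧ (w B 6 a) ≡ d[ u , v ]
  dist-selected {a} {v} u (selects s) = trans (dist-cong {⟦ u ⟧} {⟦ u ⟧} {w B 6 a} {⟦ v ⟧} (λ _ → refl) s) (dist≡ link u v)

  selected-< : ∀ {a b u v} → b < a → Selected a u → Selected b v → 6 ≤ d[ u , v ]
  selected-< {a} {b} {u} {v} b<a su sv = subst (6 ≤_)
    (trans (dist-cong {w B 6 a} {⟦ u ⟧} {w B 6 b} {w B 6 b} (w≈ su) (λ _ → refl)) (dist-selected u sv))
    (w-far B b<a)

  selected-≢ : ∀ {a b u v} → Selected a u → Selected b v → u ≢ v → 6 ≤ d[ u , v ]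
  selected-≢ {a} {b} {u} {v} su sv u≢v with ℕₚ.<-cmp b a
  ... | tri< b<a _ _  = selected-< b<a su sv
  ... | tri≈ _ refl _ = contradiction (selected-unique su sv) u≢v
  ... | tri> _ _ a<b  = subst (6 ≤_) (dst-sym ξ η v u) (selected-< a<b sv su)

  select : ∀ a u → (∀ b → b < a → ∃ λ v → Selected b v × 6 ≤ d[ u , v ]) → ∃ λ v → Selected a v × (v ≡ u ⊎ v ⊏ u)
  select a u far = conclude (w-least B a ⟦ u ⟧ far′)
    where
    far′ : ∀ b → b < a → 6 ≤ dist ⟦ u ⟧ (w B 6 b)
    far′ b b<a = transport (far b b<a)
      where
      transport : (∃ λ v → Selected b v × 6 ≤ d[ u , v ]) → 6 ≤ dist ⟦ u ⟧ (w B 6 b)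
      transport (v , s , le) = subst (6 ≤_) (sym (dist-selected u s)) le
    conclude : w B 6 a ≈ ⟦ u ⟧ ⊎ w B 6 a <[ B ] ⟦ u ⟧ → ∃ λ v → Selected a v × (v ≡ u ⊎ v ⊏ u)
    conclude (inj₁ eq) = u , selects eq , inj₁ refl
    conclude (inj₂ lt) = let v , v⊏u , eq = <-combination B {z = w B 6 a} u lt in v , selects eq , inj₂ v⊏u

  0≱6 : (u : Vec 𝔽 (suc n)) → ¬ 6 ≤ d[ u , u ]
  0≱6 u le with subst (6 ≤_) (dst-refl ξ η u) le
  ... | ()

  near-far : ∀ {u v : Vec 𝔽 j} → d[ u , v ] ≤ 5 → ¬ 6 ≤ d[ u , v ]
  near-far near far = ℕₚ.<⇒≱ far near

  Smaller : Vec 𝔽 n → Set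
  Smaller v = (∃ λ c → v ≡ codeword C c) ⊎ ∃ λ c → codeword C c ⊏ v × d[ v , codeword C c ] ≤ 5

  smaller : ∀ v → Smaller v
  smaller v with point-surjective C v
  ... | r , c , refl with greedy r c
  ...   | inj₁ refl = inj₁ (c , refl)
  ...   | inj₂ near = inj₂ near

  -- All smaller words have been selected before and are far from `word c`, so the choice is at most
  -- `word c`. A choice below it would be a smaller codeword or within 5 of one, and these are taken
  -- already.
  selected-word : ∀ c → Selected (rank c) (word c)
  selected-word c = <-rec (λ a → ∀ c → rank c ≡ a → Selected a (word c)) step (rank c) c refl
    where
    step : ∀ a → (∀ {b} → b < a → ∀ c → rank c ≡ b → Selected b (word c)) → ∀ c → rank c ≡ a → Selected a (word c)
    step a rec c refl = conclude (select a (word c) λ b b<a →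
        let c′ , eq = unrank k b (ℕₚ.<-trans b<a (rank<3^n c)) in
        word c′ , rec b<a c′ eq , word-spaced c c′ λ c≡c′ → ℕₚ.<-irrefl (trans (sym eq) (cong rank (sym c≡c′))) b<a)
      where
      conclude : (∃ λ v → Selected a v × (v ≡ word c ⊎ v ⊏ word c)) → Selected a (word c)
      conclude (v , s , inj₁ refl) = s
      conclude (x ∷ v , s , inj₂ lt) with ⊏-∷⁻ lt
      ... | inj₁ ()
      ... | inj₂ (refl , v⊏c) with smaller v
      ...   | inj₁ (c′ , refl) = let c′<c = rank-< (point-cancel-⊏ C 𝟎 c′ c v⊏c) in
        contradiction (selected-< c′<c s (rec c′<c c′ refl)) (0≱6 (word c′))
      ...   | inj₂ (c′ , c′⊏v , near) = let c′<c = rank-< (point-cancel-⊏ C 𝟎 c′ c (by-rank (ℕₚ.<-trans (rank-< c′⊏v) (rank-< v⊏c)))) in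
        contradiction (selected-< c′<c s (rec c′<c c′ refl))
          (near-far (subst (_≤ 5) (sym (dst-0∷ ξ η v (codeword C c′))) near))

  Lex⇒word : ∀ {x} → Lex B 6 k x → ∃ λ c → x ≈ ⟦ word c ⟧
  Lex⇒word (a , a<3^k , eq) = let c , rank≡a = unrank k a a<3^k in
    c , λ i → trans (eq i) (w≈ (subst (λ a → Selected a (word c)) rank≡a (selected-word c)) i)

  word⇒Lex : ∀ {x} c → x ≈ ⟦ word c ⟧ → Lex B 6 k x
  word⇒Lex c eq = rank c , rank<3^n c , λ i → trans (eq i) (sym (w≈ (selected-word c) i))

  linear : IsLinear (Lex B 6 k)
  linear = record
    { 0-closed = word⇒Lex {0ᴹ} 𝟎 λ i → sym (zero-word i)
    ; +-closed = λ {x} {y} x∈ y∈ → let c , eqx = Lex⇒word {x} x∈ ; d , eqy = Lex⇒word {y} y∈ in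
        word⇒Lex {x +ᴹ y} (c ⊕ d) λ i → trans (cong₂ _+_ (eqx i) (eqy i))
          (trans (sym (combination-⊕ B (word c) (word d) i)) (cong (λ v → coord ⟦ v ⟧ i) (sym (codeword-⊕ (free C) c d))))
    ; *-closed = λ s {x} x∈ → let c , eq = Lex⇒word {x} x∈ in
        word⇒Lex {s *ₗ x} (s ⊙ c) λ i → trans (cong (s *_) (eq i))
          (trans (sym (combination-⊙ B s (word c) i)) (cong (λ v → coord ⟦ v ⟧ i) (sym (codeword-⊙ (free C) s c))))
    }
    where
    zero-word : ⟦ word 𝟎 ⟧ ≈ 0ᴹ
    zero-word i = trans (cong (λ v → coord ⟦ v ⟧ i) (trans (codeword-𝟎 (free C)) (sym (⊙-zeroˡ (𝟎 {suc n})))))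
      (trans (combination-⊙ B 0′ (𝟎 {suc n}) i) (𝔽ᵣ.zeroˡ (coord ⟦ 𝟎 {suc n} ⟧ i)))

  Listed : ℕ → Vec 𝔽 (suc n) → Set
  Listed k′ v = ∃ λ a → a < 3 ℕ.^ k′ × Selected a v

  record ListsSubspace (k′ : ℕ) : Set where
    field
      listed-⊕ : ∀ {u v} → Listed k′ u → Listed k′ v → Listed k′ (u ⊕ v)
      listed-⊙ : ∀ s {v} → Listed k′ v → Listed k′ (s ⊙ v)

  lists-subspace : ∀ k′ → IsLinear (Lex B 6 k′) → ListsSubspace k′
  lists-subspace k′ linear′ = record
    { listed-⊕ = λ {u} {v} (a , a< , s) (b , b< , s′) →
        let c , c< , eq = +-closed {⟦ u ⟧} {⟦ v ⟧} (a , a< , sym ∘ w≈ s) (b , b< , sym ∘ w≈ s′) in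
        c , c< , selects λ i → trans (sym (eq i)) (sym (combination-⊕ B u v i))
    ; listed-⊙ = λ t {v} (a , a< , s) → let c , c< , eq = *-closed t {⟦ v ⟧} (a , a< , sym ∘ w≈ s) in
        c , c< , selects λ i → trans (sym (eq i)) (sym (combination-⊙ B t v i))
    }
    where open IsSubspace linear′

  -- If Lex k′ is linear for some k′ > k, it contains the first vector 1 ∷ u that is far from C,
  -- hence also 2 ∷ 2 u, which comes after 1 ∷ x; so 1 ∷ x has to be selected as well, although its
  -- difference to 1 ∷ u is not in C.
  module Obstructed (u x : Vec 𝔽 n)
    (first : ∀ v → v ⊏ u → ∃ λ c → d[ 1′ ∷ v , word c ] ≤ 5)
    (u-far : ∀ c → 6 ≤ d[ 1′ ∷ u , word c ])
    (x-far : ∀ c → 6 ≤ d[ 1′ ∷ x , word c ])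
    (x-far-u : ∀ c → x ⊏ (u ⊕ codeword C c) ⊎ 6 ≤ d[ 0′ ∷ x , 0′ ∷ u ⊕ codeword C c ])
    {k′} (k<k′ : k < k′) (lists : ListsSubspace k′) where

    open ListsSubspace lists

    private
      3^k<3^k′ : 3 ℕ.^ k < 3 ℕ.^ k′
      3^k<3^k′ = ℕₚ.^-monoʳ-< 3 (s≤s (s≤s z≤n)) k<k′

    -- A non-codeword lies within 5 of a codeword, which is selected too, while distinct selected
    -- vectors are at distance at least 6.
    low : ∀ v → Listed k′ (0′ ∷ v) → ∃ λ c → v ≡ codeword C c
    low v (a , _ , s) with smaller v
    ... | inj₁ eq = eq
    ... | inj₂ (c , c⊏v , near) = contradiction
      (selected-≢ s (selected-word c) λ eq → ⊏-irrefl (subst (word c ⊏_) eq (⊏-tail c⊏v)))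
      (near-far (subst (_≤ 5) (sym (dst-0∷ ξ η v (codeword C c))) near))

    Before : ℕ → Vec 𝔽 (suc n) → Set
    Before a y = ∀ b → b < a → ∃ λ v → Selected b v × v ⊏ y

    before-suc : ∀ {a y v} → Before a y → Selected a v → v ⊏ y → Before (suc a) y
    before-suc {v = v} before s v⊏y b b<1+a = Sum.[ before b , (λ { refl → v , s , v⊏y }) ]′ (ℕₚ.m≤n⇒m<n∨m≡n (ℕ.s≤s⁻¹ b<1+a))

    -- As long as every selected vector lies below `y`, it is far from `y`, so `y` remains
    -- admissible and the next choice is `y` or again below it.
    listed-or-late : ∀ y → (∀ v → Listed k′ v → v ⊏ y → 6 ≤ d[ y , v ]) → ∀ a → a ≤ 3 ℕ.^ k′ → Listed k′ y ⊎ Before a y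
    listed-or-late y far zero    _  = inj₂ λ _ ()
    listed-or-late y far (suc a) a< = Sum.[ inj₁ , next-step ]′ (listed-or-late y far a (ℕₚ.<⇒≤ a<))
      where
      next-step : Before a y → Listed k′ y ⊎ Before (suc a) y
      next-step before = conclude (select a y λ b b<a → far-from b b<a (before b b<a))
        where
        far-from : ∀ b → b < a → (∃ λ v → Selected b v × v ⊏ y) → ∃ λ v → Selected b v × 6 ≤ d[ y , v ]
        far-from b b<a (v , s , v⊏y) = v , s , far v (b , ℕₚ.<-trans b<a a< , s) v⊏y
        conclude : (∃ λ v → Selected a v × (v ≡ y ⊎ v ⊏ y)) → Listed k′ y ⊎ Before (suc a) y
        conclude (_ , s , inj₁ refl) = inj₁ (a , a< , s)
        conclude (_ , s , inj₂ v⊏y)  = inj₂ (before-suc before s v⊏y)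

    before-u : ∀ v → Listed k′ v → v ⊏ (1′ ∷ u) → ∃ λ c → v ≡ word c
    before-u (y ∷ v) listed lt with ⊏-∷⁻ lt
    before-u (0′ ∷ v) listed lt | inj₁ _ = let c , eq = low v listed in c , cong (0′ ∷_) eq
    before-u (suc _ ∷ v) listed lt | inj₁ (s≤s ())
    before-u (_ ∷ v) (a , _ , s) lt | inj₂ (refl , v⊏u) = let c , near = first v v⊏u in
      contradiction (selected-≢ s (selected-word c) λ ()) (near-far near)

    u-listed : Listed k′ (1′ ∷ u)
    u-listed = Sum.[ id , ⊥-elim ∘ late ]′ (listed-or-late (1′ ∷ u) far-from-listed (3 ℕ.^ k′) ℕₚ.≤-refl)
      where
      far-from-listed : ∀ v → Listed k′ v → v ⊏ (1′ ∷ u) → 6 ≤ d[ 1′ ∷ u , v ]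
      far-from-listed v listed lt = let c , eq = before-u v listed lt in
        subst (λ v → 6 ≤ d[ 1′ ∷ u , v ]) (sym eq) (u-far c)
      late : ¬ Before (3 ℕ.^ k′) (1′ ∷ u)
      -- The words use up the indices below 3^k, so the element with index 3^k would repeat a word,
      -- at distance 0 from itself.
      late before = refute (before (3 ℕ.^ k) 3^k<3^k′)
        where
        refute : ¬ ∃ λ v → Selected (3 ℕ.^ k) v × v ⊏ (1′ ∷ u)
        refute (v , s , v⊏u) = let c , v≡c = before-u v (3 ℕ.^ k , 3^k<3^k′ , s) v⊏u in
          0≱6 (word c) (selected-< (rank<3^n c) (subst (Selected (3 ℕ.^ k)) v≡c s) (selected-word c))

    -- By linearity the difference from 1 ∷ u is listed; its leading entry is 0, so `low` applies.
    differ-by-codeword : ∀ v → Listed k′ (1′ ∷ v) → ∃ λ c → v ≡ u ⊕ codeword C c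
    differ-by-codeword v listed = let c , eq = low (v ⊕ 2′ ⊙ u) (listed-⊕ listed (listed-⊙ 2′ u-listed)) in
      c , ⊕-move v u (codeword C c) eq

    before-x : ∀ v → Listed k′ v → v ⊏ (1′ ∷ x) → 6 ≤ d[ 1′ ∷ x , v ]
    before-x (y ∷ v) listed lt with ⊏-∷⁻ lt
    before-x (0′ ∷ v) listed lt | inj₁ _ = let c , eq = low v listed in
      subst (λ v → 6 ≤ d[ 1′ ∷ x , 0′ ∷ v ]) (sym eq) (x-far c)
    before-x (suc _ ∷ v) listed lt | inj₁ (s≤s ())
    before-x (_ ∷ v) listed lt | inj₂ (refl , v⊏x) = apart (differ-by-codeword v listed) v⊏x
      where
      apart : (∃ λ c → v ≡ u ⊕ codeword C c) → v ⊏ x → 6 ≤ d[ 1′ ∷ x , 1′ ∷ v ]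
      apart (c , refl) v⊏x with x-far-u c
      ... | inj₁ x⊏v = contradiction v⊏x (⊏-asym x⊏v)
      ... | inj₂ le  = subst (6 ≤_) (sym (same-head (u ⊕ codeword C c))) le
        where
        same-head : ∀ v → d[ 1′ ∷ x , 1′ ∷ v ] ≡ d[ 0′ ∷ x , 0′ ∷ v ]
        same-head v = trans (cong₂ (λ a b → d[ 1′ ∷ a , 1′ ∷ b ]) (sym (⊕-identityʳ x)) (sym (⊕-identityʳ v)))
          (dst-⊕ ξ η (0′ ∷ x) (0′ ∷ v) (1′ ∷ 𝟎))

    contradictory : ⊥
    contradictory = Sum.[ x-not-listed , x-not-late ]′ (listed-or-late (1′ ∷ x) before-x (3 ℕ.^ k′) ℕₚ.≤-refl)
      where
      x-not-listed : ¬ Listed k′ (1′ ∷ x)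
      x-not-listed listed = let c , x≡ = differ-by-codeword x listed in
        Sum.[ (λ lt → ⊏-irrefl (subst (x ⊏_) (sym x≡) lt))
            , (λ le → 0≱6 (0′ ∷ x) (subst (λ v → 6 ≤ d[ 0′ ∷ x , 0′ ∷ v ]) (sym x≡) le)) ]′ (x-far-u c)
      x-not-late : ¬ Before (3 ℕ.^ k′) (1′ ∷ x)
      x-not-late before = refute (listed-⊙ 2′ u-listed)
        where
        2⋢1 : ∀ {y z : Vec 𝔽 n} → ¬ (2′ ∷ y) ⊏ (1′ ∷ z)
        2⋢1 lt with ⊏-∷⁻ lt
        ... | inj₁ (s≤s ())
        ... | inj₂ (() , _)
        refute : ¬ Listed k′ (2′ ∷ 2′ ⊙ u)
        refute (a , a< , s) = let v , s′ , lt = before a a< in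
          2⋢1 (subst (_⊏ (1′ ∷ x)) (sym (selected-unique s s′)) lt)

-- Bases that act alike on short vectors

no-shift : ∀ a b {c} → c ≡ 0# → a ≡ a + c * b
no-shift a b refl = sym (trans (cong (a +_) (0*  b)) (a+0 a))
  where
  0* : ∀ b → 0# * b ≡ 0#
  0* b = trans (sym (⊠≡* 0# b)) refl
  a+0 : ∀ a → a + 0# ≡ a
  a+0 a = trans (sym (⊞≡+ a 0#)) (⊞-identityʳ a)

-- The entry at ξ ≥ n is 0, so the shift by it vanishes and `dst ξ η` is the plain Hamming distance.
-- `isometric-F-ξ` rests on the same remark.
isometric-E : ∀ ξ η → n ≤ ξ → Isometric E ξ η n
isometric-E {n} ξ η n≤ξ = isometric λ u v →
  dist≡dst ξ η (combination E u) (combination E v) u v (formula u) (formula v)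
  where
  formula : ∀ (u : Vec 𝔽 n) i → coord (combination E u) i ≡ at u i + at u ξ * δ η i
  formula u i = trans (expansion E (sequence u) i) (no-shift (at u i) (δ η i) (at-≥ u n≤ξ))

module _ {ξ η : ℕ} (ξ≢η : ξ ≢ η) where

  isometric-F : Isometric (F ξ η ξ≢η) ξ η n
  isometric-F = isometric λ u v → dist≡dst ξ η (combination (F ξ η ξ≢η) u) (combination (F ξ η ξ≢η) v) u v
    (expand-F ξ η (sequence u)) (expand-F ξ η (sequence v))

  isometric-F-η : ∀ η′ → n ≤ η → n ≤ η′ → Isometric (F ξ η ξ≢η) ξ η′ n
  isometric-F-η η′ n≤η n≤η′ = isometric λ u v → trans (Isometric.dist≡ isometric-F u v) (dst-irrelevant ξ u v n≤η n≤η′)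

  isometric-F-ξ : ∀ ξ′ η′ → n ≤ ξ → n ≤ ξ′ → Isometric (F ξ η ξ≢η) ξ′ η′ n
  isometric-F-ξ {n} ξ′ η′ n≤ξ n≤ξ′ = isometric λ u v →
    dist≡dst ξ′ η′ (combination (F ξ η ξ≢η) u) (combination (F ξ η ξ≢η) v) u v (formula u) (formula v)
    where
    formula : ∀ (u : Vec 𝔽 n) i → coord (combination (F ξ η ξ≢η) u) i ≡ at u i + at u ξ′ * δ η′ i
    formula u i = trans (expand-F ξ η (sequence u) i) (trans (sym (no-shift (at u i) (δ η i) (at-≥ u n≤ξ)))
      (no-shift (at u i) (δ η′ i) (at-≥ u n≤ξ′)))

-- From Boolean checks to the value of K

not-𝟎 : ∀ {a} {c : Vec 𝔽 k} → c ≢ 𝟎 → T (isZero c ∨ a) → T a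
not-𝟎 {c = c} c≢𝟎 t = Sum.[ (λ z → contradiction (isZero⇒≡𝟎 c z) c≢𝟎) , id ]′ (∨⁻ t)

isSpaced-sound : ∀ ξ η (C : Code n m k) → T (isSpaced ξ η C) → ∀ c → c ≢ 𝟎 → 6 ≤ dst ξ η 𝟎 (codeword C c)
isSpaced-sound ξ η C t c c≢𝟎 = ¬close⇒dst ξ η 5 𝟎 (codeword C c)
  (not-𝟎 c≢𝟎 (all-vecs (λ c → isZero c ∨ not (close 5 (standard ξ η 𝟎) (standard ξ η (codeword C c)))) t c))

isFar-sound : ∀ ξ η (C : Code n m k) u → T (isFar ξ η C u) → ∀ c → 6 ≤ dst ξ η (1′ ∷ u) (codeword (free C) c)
isFar-sound ξ η C u t c = ¬close⇒dst ξ η 5 (1′ ∷ u) (codeword (free C) c)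
  (all-image (λ σ → not (close 5 (standard ξ η (1′ ∷ u)) σ)) (standard ξ η ∘ codeword (free C)) t c)

isLaterFar-sound : ∀ ξ η (C : Code n m k) u x → T (isLaterFar ξ η C u x) → ∀ c →
  x ⊏ (u ⊕ codeword C c) ⊎ 6 ≤ dst ξ η (0′ ∷ x) (0′ ∷ u ⊕ codeword C c)
isLaterFar-sound ξ η C u x t c = Sum.map (λ lt → by-rank (ℕₚ.<ᵇ⇒< _ _ lt))
  (¬close⇒dst ξ η 5 (0′ ∷ x) (0′ ∷ u ⊕ codeword C c))
  (∨⁻ {rank x <ᵇ rank (u ⊕ codeword C c)} (all-vecs (λ c → (rank x <ᵇ rank (u ⊕ codeword C c)) ∨
    not (close 5 (standard ξ η (0′ ∷ x)) (standard ξ η (0′ ∷ u ⊕ codeword C c)))) t c))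

isFirst-sound : ∀ ξ η j (C : Code n m k) u → T (isFirst ξ η j C u) → ∀ v → v ⊏ u →
  ∃ λ c → dst ξ η (replicate j 1′ ++ v) (codeword (j ↑ C) c) ≤ 5
isFirst-sound ξ η j C u t v v⊏u =
  let p , f , t = near (before u) (fits-before u v v⊏u) t in
  allNearCode-sound ξ η 4 (j ↑ C) (replicate j (just 1′) ++ p) t (replicate j 1′ ++ v) (fits-ones j f)
  where
  test : Pattern _ → Bool
  test p = allNearCode ξ η 4 (j ↑ C) (replicate j (just 1′) ++ p)
  near : ∀ ps → Any (λ p → Fits p v) ps → T (all test ps) → ∃ λ p → Fits p v × T (test p)
  near (p ∷ ps) (here f)  t = p , f , proj₁ (∧⁻ t)
  near (p ∷ ps) (there h) t = near ps h (proj₂ (∧⁻ {test p} t))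
  fits-ones : ∀ j {p} → Fits p v → Fits (replicate j (just 1′) ++ p) (replicate j 1′ ++ v)
  fits-ones zero    f = f
  fits-ones (suc j) f = by (fits-ones j f)

maximal : ∀ B ξ η (C : Code n m k) (u x : Vec 𝔽 n) → Isometric B ξ η (suc n) →
  (∀ c → c ≢ 𝟎 → 6 ≤ dst ξ η 𝟎 (codeword C c)) → Greedy ξ η C →
  (∀ v → v ⊏ u → ∃ λ c → dst ξ η (1′ ∷ v) (codeword (free C) c) ≤ 5) →
  (∀ c → 6 ≤ dst ξ η (1′ ∷ u) (codeword (free C) c)) →
  (∀ c → 6 ≤ dst ξ η (1′ ∷ x) (codeword (free C) c)) →
  (∀ c → x ⊏ (u ⊕ codeword C c) ⊎ 6 ≤ dst ξ η (0′ ∷ x) (0′ ∷ u ⊕ codeword C c)) → IsK B 6 (fin k)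
maximal B ξ η C u x link spaced greedy first u-far x-far later = L.linear , λ k′ linear′ → ℕₚ.≮⇒≥ λ k<k′ →
  L.Obstructed.contradictory u x first u-far x-far later k<k′ (L.lists-subspace k′ linear′)
  where module L = Lexicode B ξ η C link spaced greedy

-- A code that is an initial piece of a lexicode, and the entries below the leading 1 of the first
-- vector outside its span and of a later one; vectors are written in decimal, top coordinate first.
record Obstruction (n m k : ℕ) : Set where
  constructor _⟨_,_⟩
  field
    code  : Code n m k
    first : ℕ
    later : ℕ

infix 4 _⟨_,_⟩

isObstruction : ℕ → ℕ → Obstruction n m k → Bool
isObstruction {n} ξ η (C ⟨ u , x ⟩) = isSpaced ξ η C ∧ isGreedy ξ η C ∧
  isFirst ξ η 1 C (decimal n u) ∧ isFar ξ η C (decimal n u) ∧ isFar ξ η C (decimal n x) ∧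
  isLaterFar ξ η C (decimal n u) (decimal n x)

obstruction⇒IsK : ∀ B ξ η (O : Obstruction n m k) → Isometric B ξ η (suc n) → T (isObstruction ξ η O) → IsK B 6 (fin k)
obstruction⇒IsK {n} B ξ η (C ⟨ u , x ⟩) link t =
  let spaced , t = ∧⁻ {isSpaced ξ η C} t
      greedy , t = ∧⁻ {isGreedy ξ η C} t
      first  , t = ∧⁻ {isFirst ξ η 1 C (decimal n u)} t
      u-far  , t = ∧⁻ {isFar ξ η C (decimal n u)} t
      x-far  , t = ∧⁻ {isFar ξ η C (decimal n x)} t
  in maximal B ξ η C (decimal n u) (decimal n x) link (isSpaced-sound ξ η C spaced) (isGreedy-sound ξ η C greedy)
       (isFirst-sound ξ η 1 C (decimal n u) first) (isFar-sound ξ η C (decimal n u) u-far)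
       (isFar-sound ξ η C (decimal n x) x-far) (isLaterFar-sound ξ η C (decimal n u) (decimal n x) t)

-- Words of finite length

module _ {A B : Set} {P : Pred A 0ℓ} {Q : Pred B 0ℓ} (P? : Decidable P) (Q? : Decidable Q) where

  length-filter-tabulate : (f : Fin n → A) (g : Fin n → B) → (∀ i → P (f i) → Q (g i)) → (∀ i → Q (g i) → P (f i)) →
    length (filter P? (tabulate f)) ≡ length (filter Q? (tabulate g))
  length-filter-tabulate {zero}  f g to from = refl
  length-filter-tabulate {suc n} f g to from with P? (f zero) | Q? (g zero)
  ... | yes _ | yes _ = cong suc (length-filter-tabulate (f ∘ suc) (g ∘ suc) (to ∘ suc) (from ∘ suc))
  ... | no  _ | no  _ = length-filter-tabulate (f ∘ suc) (g ∘ suc) (to ∘ suc) (from ∘ suc)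
  ... | yes p | no ¬q = contradiction (to zero p) ¬q
  ... | no ¬p | yes q = contradiction (from zero q) ¬p

applyUpTo≡tabulate : ∀ {A : Set} (f : ℕ → A) n → applyUpTo f n ≡ tabulate {n = n} (f ∘ toℕ)
applyUpTo≡tabulate f zero    = refl
applyUpTo≡tabulate f (suc n) = cong (f 0 ∷_) (applyUpTo≡tabulate (f ∘ suc) n)

hamming≡dist : ∀ x y {u v : Word n} → (∀ j → u j ≡ coord x (toℕ j)) → (∀ j → v j ≡ coord y (toℕ j)) →
  (∀ {i} → n ≤ i → coord x i ≡ coord y i) → hamming u v ≡ dist x y
hamming≡dist {n} x y {u} {v} equ eqv beyond = begin
  hamming u v
    ≡⟨ length-filter-tabulate (λ i → ¬? (u i Finₚ.≟ v i)) (differ? x y) id toℕ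
         (λ i ne eq → ne (trans (equ i) (trans eq (sym (eqv i)))))
         (λ i ne eq → ne (trans (sym (equ i)) (trans eq (eqv i)))) ⟩
  length (filter (differ? x y) (tabulate {n = n} toℕ))   ≡⟨ cong (length ∘ filter (differ? x y)) (applyUpTo≡tabulate id n) ⟨
  countBelow (differ? x y) n                             ≡⟨ dist≡count x y n beyond ⟨
  dist x y                                               ∎
  where open ≡-Reasoning

unit : Fin k → Vec 𝔽 k
unit zero    = 1′ ∷ 𝟎
unit (suc i) = 0′ ∷ unit i

-- A linear map is determined by the images of the unit vectors.
linearCombination-unit : (f : Vec 𝔽 k → Word n) → (∀ j → f 𝟎 j ≡ 0#) → (∀ u v j → f (u ⊕ v) j ≡ f u j + f v j) →
  (∀ s v j → f (s ⊙ v) j ≡ s * f v j) → (c : Fin k → 𝔽) → linearCombination (Word-module n) c (f ∘ unit) ≗ f (Vec.tabulate c)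
linearCombination-unit {zero}  f f-0 f-+ f-* c j = sym (f-0 j)
linearCombination-unit {suc k} f f-0 f-+ f-* c j = begin
  c zero * f (1′ ∷ 𝟎) j + linearCombination (Word-module _) (c ∘ suc) (f ∘ (0′ ∷_) ∘ unit) j
    ≡⟨ cong₂ _+_ (sym (f-* (c zero) (1′ ∷ 𝟎) j))
         (linearCombination-unit (f ∘ (0′ ∷_)) f-0 (λ u v → f-+ (0′ ∷ u) (0′ ∷ v))
           (λ s v j → trans (cong (λ a → f (a ∷ s ⊙ v) j) (sym (s⊠0 s))) (f-* s (0′ ∷ v) j)) (c ∘ suc) j) ⟩
  f (c zero ⊙ (1′ ∷ 𝟎)) j + f (0′ ∷ Vec.tabulate (c ∘ suc)) j
    ≡⟨ f-+ (c zero ⊙ (1′ ∷ 𝟎)) (0′ ∷ Vec.tabulate (c ∘ suc)) j ⟨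
  f ((c zero ⊠ 1′ ⊞ 0′) ∷ (c zero ⊙ 𝟎 ⊕ Vec.tabulate (c ∘ suc))) j
    ≡⟨ cong₂ (λ a v → f (a ∷ v) j) (s1+0 (c zero)) (trans (cong (_⊕ Vec.tabulate (c ∘ suc)) (⊙-zeroʳ (c zero))) (⊕-identityˡ _)) ⟩
  f (c zero ∷ Vec.tabulate (c ∘ suc)) j ∎
  where
  open ≡-Reasoning
  s⊠0 : ∀ s → s ⊠ 0′ ≡ 0′
  s⊠0 0′ = refl
  s⊠0 1′ = refl
  s⊠0 2′ = refl
  s1+0 : ∀ s → s ⊠ 1′ ⊞ 0′ ≡ s
  s1+0 0′ = refl
  s1+0 1′ = refl
  s1+0 2′ = refl

-- The case η = 9 and the Golay code

sumEntry : ℕ → ℕ → Vec 𝔽 n → ℕ → 𝔽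
sumEntry ξ η v j = at (addAt η (at v ξ) v) j

isSupported : ℕ → ℕ → Code n m k → Bool
isSupported {n} {k = k} ξ η C = all (λ j → any (λ c → not (sumEntry ξ η (codeword C c) (toℕ j) == 0′)) (vecs k)) (allFin n)

-- The obstruction sits three coordinates above the code. The covering radius 3 replaces the
-- searches over the coordinates 12 and 13, so only vectors led by 1, 1, 1 are tested for being
-- first.
isGolay : ℕ → Vec 𝔽 k → Obstruction n m k → Bool
isGolay {n = n} ξ c (C ⟨ u , x ⟩) = isSpaced ξ 9 C ∧ isGreedy ξ 9 C ∧ isCovering ξ 9 C ∧
  isFirst ξ 9 3 C (decimal n u) ∧
  isFar ξ 9 (2 ↑ C) (1′ ∷ 1′ ∷ decimal n u) ∧ isFar ξ 9 (2 ↑ C) (1′ ∷ 1′ ∷ decimal n x) ∧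
  isLaterFar ξ 9 (2 ↑ C) (1′ ∷ 1′ ∷ decimal n u) (1′ ∷ 1′ ∷ decimal n x) ∧
  isSupported ξ 9 C ∧ close 6 (standard ξ 9 𝟎) (standard ξ 9 (codeword C c))

record IsGolay (ξ : ℕ) (c : Vec 𝔽 k) (C : Code n m k) (u x : Vec 𝔽 n) : Set where
  field
    spaced    : ∀ c → c ≢ 𝟎 → 6 ≤ dst ξ 9 𝟎 (codeword C c)
    greedy    : Greedy ξ 9 C
    covered   : ∀ r → ∃ λ d → dst ξ 9 (point C r 𝟎) (codeword C d) ≤ 3
    first     : ∀ v → v ⊏ u → ∃ λ d → dst ξ 9 (1′ ∷ 1′ ∷ 1′ ∷ v) (codeword (3 ↑ C) d) ≤ 5
    u-far     : ∀ d → 6 ≤ dst ξ 9 (1′ ∷ 1′ ∷ 1′ ∷ u) (codeword (3 ↑ C) d)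
    x-far     : ∀ d → 6 ≤ dst ξ 9 (1′ ∷ 1′ ∷ 1′ ∷ x) (codeword (3 ↑ C) d)
    later     : ∀ d → (1′ ∷ 1′ ∷ x) ⊏ ((1′ ∷ 1′ ∷ u) ⊕ codeword (2 ↑ C) d) ⊎
                      6 ≤ dst ξ 9 (0′ ∷ 1′ ∷ 1′ ∷ x) (0′ ∷ (1′ ∷ 1′ ∷ u) ⊕ codeword (2 ↑ C) d)
    supported : (j : Fin n) → ∃ λ d → sumEntry ξ 9 (codeword C d) (toℕ j) ≢ 0#
    lightest  : dst ξ 9 𝟎 (codeword C c) ≤ 6

isSupported-sound : ∀ ξ η (C : Code n m k) → T (isSupported ξ η C) → ∀ j → ∃ λ d → sumEntry ξ η (codeword C d) (toℕ j) ≢ 0#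
isSupported-sound {n} {k = k} ξ η C t j = found (Any.satisfied (any⁻ p (vecs k) (All.lookup (all⁺ q (allFin n) t) (∈-allFin j))))
  where
  p : Vec 𝔽 k → Bool
  p c = not (sumEntry ξ η (codeword C c) (toℕ j) == 0′)
  q : Fin n → Bool
  q j = any (λ c → not (sumEntry ξ η (codeword C c) (toℕ j) == 0′)) (vecs k)
  nonzero : ∀ a → T (not (a == 0′)) → a ≢ 0#
  nonzero 0′ ()
  nonzero 1′ _ ()
  nonzero 2′ _ ()
  found : (∃ λ c → T (p c)) → ∃ λ d → sumEntry ξ η (codeword C d) (toℕ j) ≢ 0#
  found (c , t) = c , nonzero _ t

isCovering-sound : ∀ ξ η (C : Code n m k) → T (isCovering ξ η C) → ∀ r → ∃ λ d → dst ξ η (point C r 𝟎) (codeword C d) ≤ 3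
isCovering-sound ξ η C t r = allNearCode-sound ξ η 2 C (rep-pattern C) t (point C r 𝟎) (fits-rep C r)

isGolay-sound : ∀ ξ c (O : Obstruction n m k) → T (isGolay ξ c O) →
  IsGolay ξ c (Obstruction.code O) (decimal n (Obstruction.first O)) (decimal n (Obstruction.later O))
isGolay-sound {n = n} ξ c (C ⟨ first , later ⟩) t =
  let u = decimal n first
      x = decimal n later
      spaced    , t = ∧⁻ {isSpaced ξ 9 C} t
      greedy    , t = ∧⁻ {isGreedy ξ 9 C} t
      covering  , t = ∧⁻ {isCovering ξ 9 C} t
      first     , t = ∧⁻ {isFirst ξ 9 3 C u} t
      u-far     , t = ∧⁻ {isFar ξ 9 (2 ↑ C) (1′ ∷ 1′ ∷ u)} t
      x-far     , t = ∧⁻ {isFar ξ 9 (2 ↑ C) (1′ ∷ 1′ ∷ x)} t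
      later     , t = ∧⁻ {isLaterFar ξ 9 (2 ↑ C) (1′ ∷ 1′ ∷ u) (1′ ∷ 1′ ∷ x)} t
      supported , t = ∧⁻ {isSupported ξ 9 C} t
  in record
    { spaced    = isSpaced-sound ξ 9 C spaced
    ; greedy    = isGreedy-sound ξ 9 C greedy
    ; covered   = isCovering-sound ξ 9 C covering
    ; first     = isFirst-sound ξ 9 3 C u first
    ; u-far     = isFar-sound ξ 9 (2 ↑ C) (1′ ∷ 1′ ∷ u) u-far
    ; x-far     = isFar-sound ξ 9 (2 ↑ C) (1′ ∷ 1′ ∷ x) x-far
    ; later     = isLaterFar-sound ξ 9 (2 ↑ C) (1′ ∷ 1′ ∷ u) (1′ ∷ 1′ ∷ x) later
    ; supported = isSupported-sound ξ 9 C supported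
    ; lightest  = close⇒dst ξ 9 6 𝟎 (codeword C c) t
    }

module Golay (ξ : ℕ) (ξ<9 : ξ < 9) (ξ≢9 : ξ ≢ 9) (c₀ : Vec 𝔽 6) (c₀≢𝟎 : c₀ ≢ 𝟎) (C : Code 12 6 6) (u x : Vec 𝔽 12)
  (golay : IsGolay ξ c₀ C u x) where

  open IsGolay golay

  private
    B = F ξ 9 ξ≢9

    d[_,_] : Vec 𝔽 j → Vec 𝔽 j → ℕ
    d[_,_] = dst ξ 9

    spaced₂ : ∀ c → c ≢ 𝟎 → 6 ≤ d[ 𝟎 , codeword (2 ↑ C) c ]
    spaced₂ c c≢𝟎 = subst (6 ≤_) (sym (trans (dst-0∷ ξ 9 (0′ ∷ 𝟎) (0′ ∷ codeword C c)) (dst-0∷ ξ 9 𝟎 (codeword C c)))) (spaced c c≢𝟎)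

    within3 : ∀ v → ∃ λ d → d[ v , codeword C d ] ≤ 3
    within3 v with point-surjective C v
    ... | r , c , refl = let d , le = covered r in
      d ⊕ c , subst (λ z → d[ point C r z , codeword C (d ⊕ c) ] ≤ 3) (⊕-identityˡ c)
        (subst (_≤ 3) (sym (dst-translate ξ 9 C r 𝟎 d c)) le)

    9<12 : 9 < 12
    9<12 = ℕₚ.<ᵇ⇒< 9 12 _

    ∷-near : ∀ {j} a (v w : Vec 𝔽 n) → 12 ≤ n → d[ v , w ] ≤ j → d[ a ∷ v , 0′ ∷ w ] ≤ suc j
    ∷-near a v w 12≤n le = subst (_≤ _) (sym (dst-∷ ξ 9 (ℕₚ.<-≤-trans (ℕₚ.<-trans ξ<9 9<12) 12≤n) (ℕₚ.<-≤-trans 9<12 12≤n) a 0′ v w))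
      (ℕₚ.+-mono-≤ (miss≤1 a 0′) le)

    0∷-near : ∀ {j} (v w : Vec 𝔽 n) → d[ v , w ] ≤ j → d[ 0′ ∷ v , 0′ ∷ w ] ≤ j
    0∷-near v w = subst (_≤ _) (sym (dst-0∷ ξ 9 v w))

    -- Nonzero entries at the coordinates 12 and 13 cost at most 2 beyond the covering radius, and 3
    -- + 2 = 5 is still too close.
    greedy₂ : Greedy ξ 9 (2 ↑ C)
    greedy₂ = greedy-free ξ 9 (1 ↑ C) (greedy-free ξ 9 C greedy
        (λ a r → let d , le = covered r in
          d , ℕₚ.m≤n⇒m≤1+n (∷-near (suc a) (point C r 𝟎) (codeword C d) ℕₚ.≤-refl le)))
      λ { a (b ∷ r) → let d , le = covered r in
          d , ∷-near (suc a) (b ∷ point C r 𝟎) (0′ ∷ codeword C d) (ℕₚ.n≤1+n 12) (∷-near b (point C r 𝟎) (codeword C d) ℕₚ.≤-refl le) }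

    -- A 0 at coordinate 13 or 12 leaves at most two mismatches on top, again 3 + 2 = 5. Three ones
    -- on top are the only remaining possibility, which `first` covers.
    first₂ : ∀ v → v ⊏ (1′ ∷ 1′ ∷ u) → ∃ λ c → d[ 1′ ∷ v , codeword (3 ↑ C) c ] ≤ 5
    first₂ (a ∷ b ∷ v) lt with ⊏-∷⁻ lt
    first₂ (0′ ∷ b ∷ v) lt | inj₁ _ = let d , le = within3 v in
      d , ∷-near 1′ (0′ ∷ b ∷ v) (0′ ∷ 0′ ∷ codeword C d) (ℕₚ.m≤n+m 12 2)
            (0∷-near (b ∷ v) (0′ ∷ codeword C d) (∷-near b v (codeword C d) ℕₚ.≤-refl le))
    first₂ (suc _ ∷ b ∷ v) lt | inj₁ (s≤s ())
    first₂ (_ ∷ b ∷ v) lt | inj₂ (refl , lt′) with ⊏-∷⁻ lt′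
    first₂ (_ ∷ 0′ ∷ v) lt | inj₂ (refl , lt′) | inj₁ _ = let d , le = within3 v in
      d , ∷-near 1′ (1′ ∷ 0′ ∷ v) (0′ ∷ 0′ ∷ codeword C d) (ℕₚ.m≤n+m 12 2)
            (∷-near 1′ (0′ ∷ v) (0′ ∷ codeword C d) (ℕₚ.n≤1+n 12) (0∷-near v (codeword C d) le))
    first₂ (_ ∷ suc _ ∷ v) lt | inj₂ (refl , lt′) | inj₁ (s≤s ())
    first₂ (_ ∷ _ ∷ v) lt | inj₂ (refl , lt′) | inj₂ (refl , v⊏u) = first v v⊏u

  isK : IsK B 6 (fin 6)
  isK = maximal B ξ 9 (2 ↑ C) (1′ ∷ 1′ ∷ u) (1′ ∷ 1′ ∷ x) (isometric-F ξ≢9) spaced₂ greedy₂ first₂ u-far x-far later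

  private
    module L = Lexicode B ξ 9 (2 ↑ C) (isometric-F ξ≢9) spaced₂ greedy₂

    ⟪_⟫ : Vec 𝔽 6 → 𝔽^ℕ
    ⟪ c ⟫ = combination B (L.word c)

    ⟪⟫∈Lex : ∀ c → ⟪ c ⟫ ∈ Lex B 6 6
    ⟪⟫∈Lex c = L.word⇒Lex {⟪ c ⟫} c λ _ → refl

    at-word : ∀ c i → at (L.word c) i ≡ at (codeword C c) i
    at-word c i = trans (at-0∷ (0′ ∷ 0′ ∷ codeword C c) i) (trans (at-0∷ (0′ ∷ codeword C c) i) (at-0∷ (codeword C c) i))

    ⟪⟫-entry : ∀ c i → coord ⟪ c ⟫ i ≡ sumEntry ξ 9 (codeword C c) i
    ⟪⟫-entry c i = trans (expand-F ξ 9 (sequence (L.word c)) i)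
      (trans (cong₂ (λ a b → a + b * δ 9 i) (at-word c i) (at-word c ξ))
        (sym (at-addAt 9 (at (codeword C c) ξ) (codeword C c) 9<12 i)))

    ⟪⟫-beyond : ∀ c {i} → 12 ≤ i → coord ⟪ c ⟫ i ≡ 0#
    ⟪⟫-beyond c {i} 12≤i = trans (⟪⟫-entry c i) (at-≥ (addAt 9 (at (codeword C c) ξ) (codeword C c)) 12≤i)

    ⟪⟫-⊕ : ∀ c d i → coord ⟪ c ⊕ d ⟫ i ≡ coord ⟪ c ⟫ i + coord ⟪ d ⟫ i
    ⟪⟫-⊕ c d i = trans (cong (λ v → coord (combination B v) i) (codeword-⊕ (3 ↑ C) c d)) (combination-⊕ B (L.word c) (L.word d) i)

    ⟪⟫-⊙ : ∀ s c i → coord ⟪ s ⊙ c ⟫ i ≡ s * coord ⟪ c ⟫ i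
    ⟪⟫-⊙ s c i = trans (cong (λ v → coord (combination B v) i) (codeword-⊙ (3 ↑ C) s c)) (combination-⊙ B s (L.word c) i)

    ⟪⟫-𝟎 : ∀ i → coord ⟪ 𝟎 ⟫ i ≡ 0#
    ⟪⟫-𝟎 i = trans (⟪⟫-⊙ 0′ 𝟎 i) (trans (sym (⊠≡* 0′ (coord ⟪ 𝟎 ⟫ i))) refl)

    truncated : Vec 𝔽 6 → Word 12
    truncated c j = coord ⟪ c ⟫ (toℕ j)

    truncated-injective : ∀ c d → truncated c ≗ truncated d → c ≡ d
    truncated-injective c d eq = L.word-injective (combination-injective B (L.word c) (L.word d) λ i → agree-at i (i ℕₚ.<? 12))
      where
      agree-at : ∀ i → Dec (i < 12) → coord ⟪ c ⟫ i ≡ coord ⟪ d ⟫ i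
      agree-at i (yes i<12) = subst (λ i → coord ⟪ c ⟫ i ≡ coord ⟪ d ⟫ i) (toℕ-fromℕ< i<12) (eq (fromℕ< i<12))
      agree-at i (no  i≮12) = trans (⟪⟫-beyond c (ℕₚ.≮⇒≥ i≮12)) (sym (⟪⟫-beyond d (ℕₚ.≮⇒≥ i≮12)))

    hamming-truncated : ∀ {v w} c d → v ≗ truncated c → w ≗ truncated d → hamming v w ≡ d[ L.word c , L.word d ]
    hamming-truncated c d eqv eqw = trans
      (hamming≡dist ⟪ c ⟫ ⟪ d ⟫ eqv eqw λ 12≤i → trans (⟪⟫-beyond c 12≤i) (sym (⟪⟫-beyond d 12≤i)))
      (Isometric.dist≡ (isometric-F ξ≢9) (L.word c) (L.word d))

  surviving : Surviving (Lex B 6 6) 12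
  surviving = record
    { position   = toℕ
    ; increasing = id
    ; sound      = λ j deleted → let d , ≢0 = supported j in
        ≢0 (trans (sym (⟪⟫-entry d (toℕ j))) (deleted ⟪ d ⟫ (⟪⟫∈Lex d)))
    ; complete   = λ i ¬deleted → locate i ¬deleted (i ℕₚ.<? 12)
    }
    where
    locate : ∀ i → ¬ Deleted (Lex B 6 6) i → Dec (i < 12) → ∃[ j ] toℕ {12} j ≡ i
    locate i ¬deleted (yes i<12) = fromℕ< i<12 , toℕ-fromℕ< i<12
    locate i ¬deleted (no  i≮12) = contradiction (λ y y∈ → let c , eq = L.Lex⇒word {y} y∈ in
      trans (eq i) (⟪⟫-beyond c (ℕₚ.≮⇒≥ i≮12))) ¬deleted

  private
    Code₁₂ : Pred (Word 12) 0ℓ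
    Code₁₂ = Res (Lex B 6 6) surviving

    truncated∈ : ∀ c → truncated c ∈ Code₁₂
    truncated∈ c = ⟪ c ⟫ , ⟪⟫∈Lex c , λ _ → refl

    ∈⇒truncated : ∀ {v} → v ∈ Code₁₂ → ∃ λ c → v ≗ truncated c
    ∈⇒truncated (y , y∈ , eq) = let c , eq′ = L.Lex⇒word {y} y∈ in c , λ j → trans (eq j) (eq′ (toℕ j))

    combine : ∀ c → linearCombination (Word-module 12) c (truncated ∘ unit) ≗ truncated (Vec.tabulate c)
    combine = linearCombination-unit truncated (⟪⟫-𝟎 ∘ toℕ) (λ c d → ⟪⟫-⊕ c d ∘ toℕ) (λ s c → ⟪⟫-⊙ s c ∘ toℕ)

    minimum-distance : HasMinimumDistance Code₁₂ 6
    minimum-distance =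
      (truncated 𝟎 , truncated c₀ , truncated∈ 𝟎 , truncated∈ c₀
        , (λ eq → c₀≢𝟎 (sym (truncated-injective 𝟎 c₀ eq)))
        , trans (hamming-truncated 𝟎 c₀ (λ _ → refl) (λ _ → refl))
            (ℕₚ.≤-antisym (subst (_≤ 6) (sym word-𝟎) lightest) (L.word-spaced 𝟎 c₀ (c₀≢𝟎 ∘ sym))))
      , λ v w v∈ w∈ v≢w → spaced-apart v w (∈⇒truncated v∈) (∈⇒truncated w∈) v≢w
      where
      word-𝟎 : d[ L.word 𝟎 , L.word c₀ ] ≡ d[ 𝟎 , codeword C c₀ ]
      word-𝟎 = trans (dst-0∷ ξ 9 (0′ ∷ 0′ ∷ codeword C 𝟎) (0′ ∷ 0′ ∷ codeword C c₀))
        (trans (dst-0∷ ξ 9 (0′ ∷ codeword C 𝟎) (0′ ∷ codeword C c₀))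
          (trans (dst-0∷ ξ 9 (codeword C 𝟎) (codeword C c₀)) (cong (λ v → d[ v , codeword C c₀ ]) (codeword-𝟎 C))))
      spaced-apart : ∀ v w → (∃ λ c → v ≗ truncated c) → (∃ λ d → w ≗ truncated d) → ¬ (v ≗ w) → 6 ≤ hamming v w
      spaced-apart v w (c , eqv) (d , eqw) v≢w = subst (6 ≤_) (sym (hamming-truncated c d eqv eqw))
        (L.word-spaced c d λ { refl → v≢w λ j → trans (eqv j) (sym (eqw j)) })

  isTernaryGolay : IsTernaryGolayCode Code₁₂
  isTernaryGolay = record
    { isSubspace = record
      { 0-closed = 0ᴹ , 0-closed , λ _ → refl
      ; +-closed = λ (y , y∈ , eqy) (z , z∈ , eqz) →
          y +ᴹ z , +-closed {y} {z} y∈ z∈ , λ j → cong₂ _+_ (eqy j) (eqz j)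
      ; *-closed = λ s (y , y∈ , eq) → s *ₗ y , *-closed s {y} y∈ , λ j → cong (s *_) (eq j)
      }
    ; dimension = truncated ∘ unit , truncated∈ ∘ unit , independent , λ {v} v∈ → spanned v (∈⇒truncated v∈)
    ; minimumDistance = minimum-distance
    }
    where
    open IsSubspace L.linear
    independent : ∀ c → (∀ j → linearCombination (Word-module 12) c (truncated ∘ unit) j ≡ 0#) → ∀ i → c i ≡ 0#
    independent c eq i = trans (sym (lookup∘tabulate c i)) (trans (cong (λ v → lookup v i)
      (truncated-injective (Vec.tabulate c) 𝟎 λ j → trans (sym (combine c j)) (trans (eq j) (sym (⟪⟫-𝟎 (toℕ j))))))
      (lookup-replicate i 0#))
    spanned : ∀ v → (∃ λ c → v ≗ truncated c) → ∃[ c ] linearCombination (Word-module 12) c (truncated ∘ unit) ≗ v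
    spanned v (c , eq) = lookup c , λ j → trans (combine (lookup c) j)
      (trans (cong (λ c → truncated c j) (tabulate∘lookup c)) (sym (eq j)))

  solution : IsK B 6 (fin 6) × ∃[ s ] IsTernaryGolayCode (Res (Lex B 6 6) s)
  solution = isK , surviving , isTernaryGolay

-- The certificates and their evaluation

belowNine : Vec (Vec (Obstruction 8 6 2) 9) 9
belowNine =
  (
   (101122 ▸ 1 ↑ 11111 ▸ 5 ↑ [] ⟨ 1010212 , 1102021 ⟩) ∷
   (101102 ▸ 1 ↑ 11101 ▸ 5 ↑ [] ⟨ 1010211 , 1102022 ⟩) ∷
   (101012 ▸ 1 ↑ 11011 ▸ 5 ↑ [] ⟨ 1010121 , 1102202 ⟩) ∷
   (100112 ▸ 1 ↑ 10111 ▸ 5 ↑ [] ⟨ 1011021 , 1102202 ⟩) ∷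
   (100112 ▸ 1 ↑ 1111 ▸ 5 ↑ [] ⟨ 1011021 , 10012120 ⟩) ∷
   (100112 ▸ 2 ↑ 1111 ▸ 4 ↑ [] ⟨ 1101021 , 10102120 ⟩) ∷
   (10112 ▸ 2 ↑ 1111 ▸ 4 ↑ [] ⟨ 1101021 , 11002120 ⟩) ∷
   (1 ↑ 10112 ▸ 1 ↑ 1111 ▸ 4 ↑ [] ⟨ 10101021 , 11002120 ⟩) ∷
   (1 ↑ 10112 ▸ 1 ↑ 1111 ▸ 4 ↑ [] ⟨ 10101021 , 11002120 ⟩) ∷ []) ∷
  (
   (101120 ▸ 1 ↑ 11110 ▸ 5 ↑ [] ⟨ 1010211 , 1102022 ⟩) ∷
   (101122 ▸ 1 ↑ 11111 ▸ 5 ↑ [] ⟨ 1010212 , 1102021 ⟩) ∷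
   (101021 ▸ 1 ↑ 11011 ▸ 5 ↑ [] ⟨ 1010112 , 1102220 ⟩) ∷
   (100121 ▸ 1 ↑ 10111 ▸ 5 ↑ [] ⟨ 1011012 , 1102220 ⟩) ∷
   (100121 ▸ 1 ↑ 1111 ▸ 5 ↑ [] ⟨ 1011012 , 10012102 ⟩) ∷
   (100121 ▸ 2 ↑ 1111 ▸ 4 ↑ [] ⟨ 1101012 , 10102102 ⟩) ∷
   (10121 ▸ 2 ↑ 1111 ▸ 4 ↑ [] ⟨ 1101012 , 11002102 ⟩) ∷
   (1 ↑ 10121 ▸ 1 ↑ 1111 ▸ 4 ↑ [] ⟨ 10101012 , 11002102 ⟩) ∷
   (1 ↑ 10121 ▸ 1 ↑ 1111 ▸ 4 ↑ [] ⟨ 10101012 , 11002102 ⟩) ∷ []) ∷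
  (
   (101121 ▸ 1 ↑ 11110 ▸ 5 ↑ [] ⟨ 1010210 , 1102021 ⟩) ∷
   (101112 ▸ 1 ↑ 11101 ▸ 5 ↑ [] ⟨ 1010201 , 1102012 ⟩) ∷
   (101122 ▸ 1 ↑ 11111 ▸ 5 ↑ [] ⟨ 1010212 , 1102021 ⟩) ∷
   (100122 ▸ 1 ↑ 10111 ▸ 5 ↑ [] ⟨ 1011212 , 1102021 ⟩) ∷
   (100122 ▸ 1 ↑ 1111 ▸ 5 ↑ [] ⟨ 1011212 , 10012110 ⟩) ∷
   (100122 ▸ 2 ↑ 1111 ▸ 4 ↑ [] ⟨ 1101212 , 10102110 ⟩) ∷
   (10122 ▸ 2 ↑ 1111 ▸ 4 ↑ [] ⟨ 1101212 , 11002110 ⟩) ∷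
   (1 ↑ 10122 ▸ 1 ↑ 1111 ▸ 4 ↑ [] ⟨ 10101212 , 11002110 ⟩) ∷
   (1 ↑ 10122 ▸ 1 ↑ 1111 ▸ 4 ↑ [] ⟨ 10101212 , 11002110 ⟩) ∷ []) ∷
  (
   (101121 ▸ 1 ↑ 11110 ▸ 5 ↑ [] ⟨ 1010212 , 1102022 ⟩) ∷
   (101112 ▸ 1 ↑ 11101 ▸ 5 ↑ [] ⟨ 1010212 , 1102001 ⟩) ∷
   (101022 ▸ 1 ↑ 11011 ▸ 5 ↑ [] ⟨ 1010212 , 1102121 ⟩) ∷
   (101122 ▸ 1 ↑ 11111 ▸ 5 ↑ [] ⟨ 1010212 , 1102021 ⟩) ∷
   (101022 ▸ 1 ↑ 1111 ▸ 5 ↑ [] ⟨ 1011201 , 10012121 ⟩) ∷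
   (101022 ▸ 2 ↑ 1111 ▸ 4 ↑ [] ⟨ 1101201 , 10102121 ⟩) ∷
   (11022 ▸ 2 ↑ 1111 ▸ 4 ↑ [] ⟨ 1101201 , 11002121 ⟩) ∷
   (1 ↑ 11022 ▸ 1 ↑ 1111 ▸ 4 ↑ [] ⟨ 10101201 , 11002121 ⟩) ∷
   (1 ↑ 11022 ▸ 1 ↑ 1111 ▸ 4 ↑ [] ⟨ 10101201 , 11002121 ⟩) ∷ []) ∷
  (
   (101122 ▸ 1 ↑ 11110 ▸ 5 ↑ [] ⟨ 1010211 , 1102021 ⟩) ∷
   (101122 ▸ 1 ↑ 11101 ▸ 5 ↑ [] ⟨ 1010202 , 1102021 ⟩) ∷
   (101122 ▸ 1 ↑ 11011 ▸ 5 ↑ [] ⟨ 1010112 , 1102021 ⟩) ∷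
   (101122 ▸ 1 ↑ 10111 ▸ 5 ↑ [] ⟨ 1011012 , 1100221 ⟩) ∷
   (101122 ▸ 1 ↑ 11111 ▸ 5 ↑ [] ⟨ 1010212 , 1102021 ⟩) ∷
   (101122 ▸ 2 ↑ 1111 ▸ 4 ↑ [] ⟨ 1100212 , 10102021 ⟩) ∷
   (11122 ▸ 2 ↑ 1111 ▸ 4 ↑ [] ⟨ 1100212 , 11002021 ⟩) ∷
   (1 ↑ 11122 ▸ 1 ↑ 1111 ▸ 4 ↑ [] ⟨ 10100212 , 11002021 ⟩) ∷
   (1 ↑ 11122 ▸ 1 ↑ 1111 ▸ 4 ↑ [] ⟨ 10100212 , 11002021 ⟩) ∷ []) ∷
  (
   (101122 ▸ 1 ↑ 11110 ▸ 5 ↑ [] ⟨ 1010212 , 1102020 ⟩) ∷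
   (101122 ▸ 1 ↑ 11101 ▸ 5 ↑ [] ⟨ 1010212 , 1102011 ⟩) ∷
   (101122 ▸ 1 ↑ 11011 ▸ 5 ↑ [] ⟨ 1010212 , 1102221 ⟩) ∷
   (101122 ▸ 1 ↑ 10111 ▸ 5 ↑ [] ⟨ 1010212 , 1101021 ⟩) ∷
   (101122 ▸ 1 ↑ 1111 ▸ 5 ↑ [] ⟨ 1010212 , 10012021 ⟩) ∷
   (101122 ▸ 1 ↑ 11111 ▸ 5 ↑ [] ⟨ 1010212 , 1102021 ⟩) ∷
   (11122 ▸ 1 ↑ 1111 ▸ 5 ↑ [] ⟨ 1010212 , 11002021 ⟩) ∷
   (1 ↑ 11122 ▸ 1111 ▸ 5 ↑ [] ⟨ 10010212 , 11002021 ⟩) ∷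
   (1 ↑ 11122 ▸ 1111 ▸ 5 ↑ [] ⟨ 10010212 , 11002021 ⟩) ∷ []) ∷
  (
   (101121 ▸ 1 ↑ 11111 ▸ 5 ↑ [] ⟨ 1010211 , 1102020 ⟩) ∷
   (101112 ▸ 1 ↑ 11111 ▸ 5 ↑ [] ⟨ 1010202 , 1102011 ⟩) ∷
   (101022 ▸ 1 ↑ 11111 ▸ 5 ↑ [] ⟨ 1010112 , 1102221 ⟩) ∷
   (100122 ▸ 1 ↑ 11111 ▸ 5 ↑ [] ⟨ 1011012 , 1102221 ⟩) ∷
   (100122 ▸ 1 ↑ 11111 ▸ 5 ↑ [] ⟨ 1002201 , 10001212 ⟩) ∷
   (100122 ▸ 1 ↑ 11111 ▸ 5 ↑ [] ⟨ 1002201 , 10001212 ⟩) ∷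
   (101122 ▸ 1 ↑ 11111 ▸ 5 ↑ [] ⟨ 1010212 , 1102021 ⟩) ∷
   (1 ↑ 1122 ▸ 11111 ▸ 5 ↑ [] ⟨ 10010212 , 10102021 ⟩) ∷
   (1 ↑ 1122 ▸ 11111 ▸ 5 ↑ [] ⟨ 10010212 , 10102021 ⟩) ∷ []) ∷
  (
   (101121 ▸ 1 ↑ 11111 ▸ 5 ↑ [] ⟨ 1010212 , 1102021 ⟩) ∷
   (101112 ▸ 1 ↑ 11111 ▸ 5 ↑ [] ⟨ 1010212 , 1102021 ⟩) ∷
   (101022 ▸ 1 ↑ 11111 ▸ 5 ↑ [] ⟨ 1010212 , 1102021 ⟩) ∷
   (100122 ▸ 1 ↑ 11111 ▸ 5 ↑ [] ⟨ 1010212 , 1102021 ⟩) ∷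
   (100122 ▸ 1 ↑ 11111 ▸ 5 ↑ [] ⟨ 1001212 , 10002201 ⟩) ∷
   (100122 ▸ 1 ↑ 11111 ▸ 5 ↑ [] ⟨ 1001212 , 10002201 ⟩) ∷
   (1122 ▸ 1 ↑ 11111 ▸ 5 ↑ [] ⟨ 1010212 , 1102021 ⟩) ∷
   (101122 ▸ 1 ↑ 11111 ▸ 5 ↑ [] ⟨ 1010212 , 1102021 ⟩) ∷
   (1122 ▸ 1 ↑ 11111 ▸ 5 ↑ [] ⟨ 1010212 , 1102021 ⟩) ∷ []) ∷
  (
   (101122 ▸ 1 ↑ 11111 ▸ 5 ↑ [] ⟨ 1010211 , 1102020 ⟩) ∷
   (101122 ▸ 1 ↑ 11111 ▸ 5 ↑ [] ⟨ 1010202 , 1102011 ⟩) ∷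
   (101122 ▸ 1 ↑ 11111 ▸ 5 ↑ [] ⟨ 1010112 , 1102221 ⟩) ∷
   (101122 ▸ 1 ↑ 11111 ▸ 5 ↑ [] ⟨ 1011012 , 1102221 ⟩) ∷
   (101122 ▸ 1 ↑ 11111 ▸ 5 ↑ [] ⟨ 1000212 , 10002021 ⟩) ∷
   (101122 ▸ 1 ↑ 11111 ▸ 5 ↑ [] ⟨ 1000212 , 10002021 ⟩) ∷
   (101122 ▸ 1 ↑ 11111 ▸ 5 ↑ [] ⟨ 10212 , 102021 ⟩) ∷
   (101122 ▸ 1 ↑ 11111 ▸ 5 ↑ [] ⟨ 10212 , 102021 ⟩) ∷
   (101122 ▸ 1 ↑ 11111 ▸ 5 ↑ [] ⟨ 1010212 , 1102021 ⟩) ∷ []) ∷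
  []

-- Indexed by ξ. Below coordinate 9 the bases F(ξ,9) and F(ξ,η) with η ≥ 10 act alike, so these
-- codes consist of the three lowest generators of those in `atNine`; the coordinates 9, 10 and 11
-- each add a generator there.
aboveNine : Vec (Obstruction 9 6 3) 9
aboveNine =
  (101012 ▸ 1 ↑ 10112 ▸ 1 ↑ 1111 ▸ 4 ↑ [] ⟨ 10100011 , 11001110 ⟩) ∷
  (101021 ▸ 1 ↑ 10121 ▸ 1 ↑ 1111 ▸ 4 ↑ [] ⟨ 10100011 , 11001101 ⟩) ∷
  (101201 ▸ 1 ↑ 10122 ▸ 1 ↑ 1111 ▸ 4 ↑ [] ⟨ 10100220 , 11001100 ⟩) ∷
  (101202 ▸ 1 ↑ 11022 ▸ 1 ↑ 1111 ▸ 4 ↑ [] ⟨ 10100112 , 10111000 ⟩) ∷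
  (101212 ▸ 1 ↑ 11122 ▸ 1 ↑ 1111 ▸ 4 ↑ [] ⟨ 10100111 , 10111002 ⟩) ∷
  (101212 ▸ 1 ↑ 11122 ▸ 1111 ▸ 5 ↑ [] ⟨ 10010111 , 10111002 ⟩) ∷
  (101212 ▸ 1 ↑ 1122 ▸ 11111 ▸ 5 ↑ [] ⟨ 10010122 , 10102201 ⟩) ∷
  (101212 ▸ 1122 ▸ 1 ↑ 11111 ▸ 5 ↑ [] ⟨ 1010122 , 1102201 ⟩) ∷
  (1212 ▸ 101122 ▸ 1 ↑ 11111 ▸ 5 ↑ [] ⟨ 1010212 , 1102021 ⟩) ∷
  []

atNine : Vec (Obstruction 12 6 6) 9
atNine =
  (121001 ▸ 120202 ▸ 112210 ▸ 101012 ▸ 1 ↑ 10112 ▸ 1 ↑ 1111 ▸ 4 ↑ [] ⟨ 11 , 11100 ⟩) ∷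
  (121010 ▸ 120220 ▸ 112201 ▸ 101021 ▸ 1 ↑ 10121 ▸ 1 ↑ 1111 ▸ 4 ↑ [] ⟨ 11 , 11100 ⟩) ∷
  (121011 ▸ 120101 ▸ 112110 ▸ 101201 ▸ 1 ↑ 10122 ▸ 1 ↑ 1111 ▸ 4 ↑ [] ⟨ 101 , 11010 ⟩) ∷
  (122200 ▸ 121010 ▸ 112112 ▸ 101202 ▸ 1 ↑ 11022 ▸ 1 ↑ 1111 ▸ 4 ↑ [] ⟨ 111 , 11000 ⟩) ∷
  (122022 ▸ 121101 ▸ 110221 ▸ 101212 ▸ 1 ↑ 11122 ▸ 1 ↑ 1111 ▸ 4 ↑ [] ⟨ 111 , 11000 ⟩) ∷
  (122022 ▸ 121101 ▸ 110221 ▸ 101212 ▸ 1 ↑ 11122 ▸ 1111 ▸ 5 ↑ [] ⟨ 111 , 101000 ⟩) ∷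
  (122011 ▸ 121120 ▸ 110221 ▸ 101212 ▸ 1 ↑ 1122 ▸ 11111 ▸ 5 ↑ [] ⟨ 111 , 111000 ⟩) ∷
  (122011 ▸ 121120 ▸ 110221 ▸ 101212 ▸ 1122 ▸ 1 ↑ 11111 ▸ 5 ↑ [] ⟨ 111 , 111000 ⟩) ∷
  (122101 ▸ 121210 ▸ 110221 ▸ 1212 ▸ 101122 ▸ 1 ↑ 11111 ▸ 5 ↑ [] ⟨ 111 , 111000 ⟩) ∷
  []

all-fin : (p : Fin n → Bool) → all p (allFin n) ≡ true → ∀ i → T (p i)
all-fin p eq i = All.lookup (all⁺ p _ (Equivalence.from T-≡ eq)) (∈-allFin i)

-- The message of the generator with the lowest leading coordinate; its weight in standard
-- coordinates is 6 for each ξ ≤ 8.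
lightest : Vec 𝔽 6
lightest = 0′ ∷ 0′ ∷ 0′ ∷ 0′ ∷ 0′ ∷ 1′ ∷ []

standardObstruction : Obstruction 8 6 2
standardObstruction = 101122 ▸ 1 ↑ 11111 ▸ 5 ↑ [] ⟨ 1010212 , 1102021 ⟩

-- Equations with `true` rather than T (…) ≡ ⊤, since the latter would be evaluated several times.
standard-obstructed : isObstruction 9 10 standardObstruction ≡ true
standard-obstructed = refl

belowNine-obstructed : all (λ i → all (λ j → does (i Finₚ.≟ j) ∨
  isObstruction (toℕ i) (toℕ j) (lookup (lookup belowNine i) j)) (allFin 9)) (allFin 9) ≡ true
belowNine-obstructed = refl

aboveNine-obstructed : all (λ i → isObstruction (toℕ i) 10 (lookup aboveNine i)) (allFin 9) ≡ true
aboveNine-obstructed = refl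

atNine-golay : all (λ i → isGolay (toℕ i) lightest (lookup atNine i)) (allFin 9) ≡ true
atNine-golay = refl

-- Assembling the cases

below-nine : ∀ (i j : Fin 9) (ξ≢η : toℕ i ≢ toℕ j) → IsK (F (toℕ i) (toℕ j) ξ≢η) 6 (fin 2)
below-nine i j ξ≢η = obstruction⇒IsK (F (toℕ i) (toℕ j) ξ≢η) (toℕ i) (toℕ j) (lookup (lookup belowNine i) j) (isometric-F ξ≢η)
  (distinct (i Finₚ.≟ j) (all-fin (λ j → does (i Finₚ.≟ j) ∨ isObstruction (toℕ i) (toℕ j) (lookup (lookup belowNine i) j))
    (Equivalence.to T-≡ (all-fin (λ i → all (λ j → does (i Finₚ.≟ j) ∨ isObstruction (toℕ i) (toℕ j) (lookup (lookup belowNine i) j)) (allFin 9))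
      belowNine-obstructed i)) j))
  where
  distinct : ∀ {a} (i≟j : Dec (i ≡ j)) → T (does i≟j ∨ a) → T a
  distinct (yes i≡j) _ = contradiction (cong toℕ i≡j) ξ≢η
  distinct (no  _)   t = t

above-nine : ∀ (i : Fin 9) {η} (ξ≢η : toℕ i ≢ η) → 10 ≤ η → IsK (F (toℕ i) η ξ≢η) 6 (fin 3)
above-nine i {η} ξ≢η 10≤η = obstruction⇒IsK (F (toℕ i) η ξ≢η) (toℕ i) 10 (lookup aboveNine i) (isometric-F-η ξ≢η 10 10≤η ℕₚ.≤-refl)
  (all-fin (λ i → isObstruction (toℕ i) 10 (lookup aboveNine i)) aboveNine-obstructed i)

golay⇒IsK : ∀ ξ c (O : Obstruction 12 6 6) (ξ≢9 : ξ ≢ 9) → ξ < 9 → c ≢ 𝟎 → T (isGolay ξ c O) →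
  IsK (F ξ 9 ξ≢9) 6 (fin 6) × ∃[ s ] IsTernaryGolayCode (Res (Lex (F ξ 9 ξ≢9) 6 6) s)
golay⇒IsK ξ c O ξ≢9 ξ<9 c≢𝟎 t = Golay.solution ξ ξ<9 ξ≢9 c c≢𝟎
  (Obstruction.code O) (decimal 12 (Obstruction.first O)) (decimal 12 (Obstruction.later O)) (isGolay-sound ξ c O t)

at-nine : ∀ (i : Fin 9) (ξ≢9 : toℕ i ≢ 9) →
  IsK (F (toℕ i) 9 ξ≢9) 6 (fin 6) × ∃[ s ] IsTernaryGolayCode (Res (Lex (F (toℕ i) 9 ξ≢9) 6 6) s)
at-nine i ξ≢9 = golay⇒IsK (toℕ i) lightest (lookup atNine i) ξ≢9 (toℕ<n i) (λ ())
  (all-fin (λ i → isGolay (toℕ i) lightest (lookup atNine i)) atNine-golay i)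

index : ∀ {i} → i ≤ 8 → ∃ λ (j : Fin 9) → toℕ j ≡ i
index i≤8 = fromℕ< (s≤s i≤8) , toℕ-fromℕ< (s≤s i≤8)

theorem1p6 : (B : 𝓕) →
    (Case₁ B → IsK (basis B) 6 (fin 6))
  × (Case₂ B → IsK (basis B) 6 (fin 3))
  × (¬ Case₁ B → ¬ Case₂ B → IsK (basis B) 6 (fin 2))
  × (Case₁ B → ∃[ s ] IsTernaryGolayCode (Res (Lex (basis B) 6 6) s))
theorem1p6 std =
    (λ ())
  , (λ ())
  , (λ _ _ → obstruction⇒IsK E 9 10 standardObstruction (isometric-E 9 10 ℕₚ.≤-refl) (Equivalence.from T-≡ standard-obstructed))
  , λ ()
theorem1p6 (pair ξ η ξ≢η) =
    (λ { (ξ≤8 , refl) → proj₁ (case₁ (index ξ≤8) ξ≢η) })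
  , (λ { (ξ≤8 , 10≤η) → case₂ (index ξ≤8) ξ≢η 10≤η })
  , case₃ (ξ ℕₚ.≤? 8) (ℕₚ.<-cmp η 9) ξ≢η
  , λ { (ξ≤8 , refl) → proj₂ (case₁ (index ξ≤8) ξ≢η) }
  where
  case₁ : ∀ {ξ} → (∃ λ (i : Fin 9) → toℕ i ≡ ξ) → (ξ≢9 : ξ ≢ 9) →
    IsK (F ξ 9 ξ≢9) 6 (fin 6) × ∃[ s ] IsTernaryGolayCode (Res (Lex (F ξ 9 ξ≢9) 6 6) s)
  case₁ (i , refl) = at-nine i
  case₂ : ∀ {ξ η} → (∃ λ (i : Fin 9) → toℕ i ≡ ξ) → (ξ≢η : ξ ≢ η) → 10 ≤ η → IsK (F ξ η ξ≢η) 6 (fin 3)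
  case₂ (i , refl) = above-nine i
  inside : ∀ {ξ η} → (∃ λ (i : Fin 9) → toℕ i ≡ ξ) → (∃ λ (j : Fin 9) → toℕ j ≡ η) → (ξ≢η : ξ ≢ η) → IsK (F ξ η ξ≢η) 6 (fin 2)
  inside (i , refl) (j , refl) = below-nine i j
  case₃ : ∀ {ξ η} → Dec (ξ ≤ 8) → Tri (η < 9) (η ≡ 9) (9 < η) → (ξ≢η : ξ ≢ η) →
    ¬ Case₁ (pair ξ η ξ≢η) → ¬ Case₂ (pair ξ η ξ≢η) → IsK (F ξ η ξ≢η) 6 (fin 2)
  -- The obstruction involves only the entries 0 to 8, on which a basis with ξ ≥ 9 agrees with `E`;
  -- the pair 9, 10 is a representative.
  case₃ {ξ} {η} (no ξ≰8) _ ξ≢η _ _ = obstruction⇒IsK (F ξ η ξ≢η) 9 10 standardObstruction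
    (isometric-F-ξ ξ≢η 9 10 (ℕₚ.≰⇒> ξ≰8) ℕₚ.≤-refl) (Equivalence.from T-≡ standard-obstructed)
  case₃ (yes ξ≤8) (tri≈ _ η≡9 _) _   ¬case₁ _      = contradiction (ξ≤8 , η≡9) ¬case₁
  case₃ (yes ξ≤8) (tri> _ _ 9<η) _   _      ¬case₂ = contradiction (ξ≤8 , 9<η) ¬case₂
  case₃ (yes ξ≤8) (tri< (s≤s η≤8) _ _) ξ≢η _ _     = inside (index ξ≤8) (index η≤8) ξ≢η
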